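{- Let $k\ge2$, $m\ge3$ and $0<\alpha<1$. Among all $k$-uniform linear unicyclic hypergraphs with $m$ hyperedges, the last hypergraph in $S_\alpha$-order is $C_3^{(k)}\odot S_{m-3}^{(k)}$.
   Context: Hypergraphs are finite; $k$-uniform means every hyperedge has exactly $k$ vertices; linear means any two distinct hyperedges share at most one vertex; unicyclic means connected with exactly one cycle. A cored vertex is a vertex of degree one. "Adding a pendant hyperedge to a vertex $v$" means adding a new hyperedge consisting of $v$ and $k-1$ new vertices. The hypercycle $C_g^{(k)}$ is obtained from the cycle graph $C_g$ by inserting $k-2$ new (cored) vertices into each edge. $C_3^{(k)}\odot S_{m-3}^{(k)}$ is obtained from $C_3^{(k)}$ by adding $m-3$ pendant hyperedges to one non-cored vertex of $C_3^{(k)}$. For a $k$-uniform hypergraph $\mathcal{H}$ on $[n]$, $\mathcal{A}(\mathcal{H})$ is the $k$-order $n$-dimensional tensor with entry $\frac1{(k-1)!}$ at $(i_1,\dots,i_k)$ if $\{i_1,\dots,i_k\}\in E(\mathcal{H})$ and $0$ otherwise; $\mathcal{D}(\mathcal{H})$ is the diagonal tensor of vertex degrees; $\mathcal{A}_\alpha(\mathcal{H})=\alpha\mathcal{D}(\mathcal{H})+(1-\alpha)\mathcal{A}(\mathcal{H})$. For a tensor $\mathcal{T}$, $\mathrm{Tr}_d(\mathcal{T})$ is the sum of the $d$-th powers of all $n(k-1)^{n-1}$ eigenvalues of $\mathcal{T}$ (roots of its characteristic polynomial, with multiplicity); in particular $\mathrm{Tr}_0(\mathcal{T})=n(k-1)^{n-1}$,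 and for $d\ge1$ $$\mathrm{Tr}_{d}(\mathcal{T})=(k-1)^{n-1}\sum_{d_1+\cdots+d_n=d}\ \prod_{i=1}^{n}\frac{1}{(d_i(k-1))!}\Big(\sum_{\gamma\in[n]^{k-1}}(\mathcal{T})_{i\gamma}\frac{\partial}{\partial a_{i\gamma}}\Big)^{d_i}\mathrm{tr}\big(A^{d(k-1)}\big),$$ with $A=(a_{ij})$ an $n\times n$ matrix of indeterminates, $d_i\ge0$ integers, $\frac{\partial}{\partial a_{i\gamma}}=\frac{\partial}{\partial a_{i i_2}}\cdots\frac{\partial}{\partial a_{i i_k}}$ for $\gamma=i_2\cdots i_k$. $S_\alpha$-order: for $k$-uniform hypergraphs $\mathcal{H}_1,\mathcal{H}_2$ with $n$ vertices, $\mathcal{H}_1\prec_\alpha\mathcal{H}_2$ if there is $d\in\{1,\dots,n(k-1)^{n-1}-1\}$ with $\mathrm{Tr}_t(\mathcal{A}_\alpha(\mathcal{H}_1))=\mathrm{Tr}_t(\mathcal{A}_\alpha(\mathcal{H}_2))$ for $t=0,\dots,d-1$ and $\mathrm{Tr}_d(\mathcal{A}_\alpha(\mathcal{H}_1))<\mathrm{Tr}_d(\mathcal{A}_\alpha(\mathcal{H}_2))$. "$X$ is the last hypergraph in a class" means $X$ is in the class and $\mathcal{H}\prec_\alpha X$ for every $\mathcal{H}$ in the class not isomorphic to $X$. -}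

module Defs where

open import Level using (_⊔_) renaming (suc to lsuc)
open import Algebra.Apartness.Bundles using (HeytingCommutativeRing; HeytingField)
open import Algebra.Bundles using (CommutativeRing)
import Algebra.Definitions.RawMonoid
open import Data.Bool.Base using (if_then_else_; _∧_)
import Data.Bool.Properties as Bool
open import Data.Fin.Base using (Fin; zero; suc; toℕ; _↑ˡ_)
open import Data.Fin.Properties using (any?) renaming (_≟_ to _≟ᶠ_)
open import Data.Fin.Subset using (Subset; _∈_; ⁅_⁆; ⊤; ⊥; _∪_; _∩_; ⋃; ∣_∣)
open import Data.Fin.Subset.Properties using (_∈?_)
open import Data.List.Base as List using (List)
open import Data.Nat.Base as ℕ using (ℕ; zero; suc; _∸_; _^_; _!)
open import Data.Nat.DivMod using (_mod_)
open import Data.Nat.GeneralisedArithmetic using (fold)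
open import Data.Nat.Properties using (_!≢0)
open import Data.Product.Base using (_×_; proj₁; ∃-syntax; Σ-syntax)
open import Data.Sum.Base using (_⊎_)
open import Data.Vec.Base as Vec using (Vec; []; _∷_; _++_)
open import Data.Vec.Properties using (≡-dec; ++-injectiveˡ; ++-injectiveʳ)
open import Function.Bundles using (_↔_; _⇔_; Inverse)
open import Function.Definitions using (Injective)
open import Relation.Binary.Core using (Rel)
open import Relation.Binary.Structures using (IsStrictPartialOrder)
open import Relation.Binary.Construct.Closure.ReflexiveTransitive using (Star)
open import Relation.Binary.PropositionalEquality using (_≡_; _≢_; refl; cong)
open import Relation.Nullary using (¬_; does)

-- The order is not assumed decidable or total, so that
-- real numbers are an instance constructively as well as classically.
record OrderedField c ℓ₁ ℓ₂ ℓ₃ : Set (lsuc (c ⊔ ℓ₁ ⊔ ℓ₂ ⊔ ℓ₃)) where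
  infix 4 _<_
  field
    heytingField : HeytingField c ℓ₁ ℓ₂

  open HeytingField heytingField public

  field
    _<_                  : Rel Carrier ℓ₃
    isStrictPartialOrder : IsStrictPartialOrder _≈_ _<_
    #⇒<⊎>                : ∀ {x y} → x # y → x < y ⊎ y < x
    <⇒#                  : ∀ {x y} → x < y → x # y
    +-monoˡ-<            : ∀ {x y} z → x < y → x + z < y + z
    *-pos                : ∀ {x y} → 0# < x → 0# < y → 0# < x * y
    0<1                  : 0# < 1#

  open HeytingCommutativeRing heytingCommutativeRing public
    using (commutativeRing)

  open IsStrictPartialOrder isStrictPartialOrder public
    using (<-resp-≈; <-respˡ-≈; <-respʳ-≈)
    renaming (trans to <-trans; irrefl to <-irrefl)

  fromℕ : ℕ → Carrier
  fromℕ n = n Mult.× 1#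
    where module Mult = Algebra.Definitions.RawMonoid
            (CommutativeRing.+-rawMonoid commutativeRing)

  0<fromℕ-suc : ∀ n → 0# < fromℕ (suc n)
  0<fromℕ-suc zero    = <-respʳ-≈ (sym (+-identityʳ 1#)) 0<1
  0<fromℕ-suc (suc n) = <-trans (0<fromℕ-suc n)
    (<-respˡ-≈ (+-identityˡ _) (+-monoˡ-< (fromℕ (suc n)) 0<1))

  0<fromℕ : ∀ n → .{{ℕ.NonZero n}} → 0# < fromℕ n
  0<fromℕ (suc n) = 0<fromℕ-suc n

  -- Obtained as an inverse of (n !) - 0#, the form in which Heyting fields
  -- provide inverses of elements apart from 0#.
  1/_! : ℕ → Carrier
  1/ n ! = proj₁ (#⇒invertible (#-sym (<⇒# (0<fromℕ (n !) {{n !≢0}}))))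

record Hypergraph : Set where
  field
    order     : ℕ
    size      : ℕ
    edge      : Fin size → Subset order
    injective : Injective _≡_ _≡_ edge

open Hypergraph public

degree : (H : Hypergraph) → Fin (order H) → ℕ
degree H v = Vec.count (λ e → v ∈? edge H e) (Vec.allFin (size H))

Uniform : ℕ → Hypergraph → Set
Uniform k H = ∀ e → ∣ edge H e ∣ ≡ k

Linear : Hypergraph → Set
Linear H = ∀ e f → e ≢ f → ∣ edge H e ∩ edge H f ∣ ℕ.≤ 1

Adjacent : (H : Hypergraph) → Fin (order H) → Fin (order H) → Set
Adjacent H u v = ∃[ e ] (u ∈ edge H e × v ∈ edge H e)

Connected : Hypergraph → Set
Connected H = ∀ u v → Star (Adjacent H) u v

next : ∀ {g} → Fin (suc g) → Fin (suc g)
next {g} i = suc (toℕ i) mod suc g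

-- A cycle v₀ e₀ v₁ e₁ … v_{g-1} e_{g-1} v₀ of length g = 2 + extra, with
-- distinct vertices, distinct hyperedges and vᵢ , vᵢ₊₁ ∈ eᵢ.
record Cycle (H : Hypergraph) : Set where
  field
    extra          : ℕ
    cvert          : Fin (2 ℕ.+ extra) → Fin (order H)
    cedge          : Fin (2 ℕ.+ extra) → Fin (size H)
    cvert-distinct : Injective _≡_ _≡_ cvert
    cedge-distinct : Injective _≡_ _≡_ cedge
    here∈          : ∀ i → cvert i ∈ edge H (cedge i)
    next∈          : ∀ i → cvert (next i) ∈ edge H (cedge i)

  Link : Fin (order H) → Fin (size H) → Set
  Link v e = ∃[ i ] (e ≡ cedge i × (v ≡ cvert i ⊎ v ≡ cvert (next i)))

-- Cycles are counted up to the choice of starting point and direction: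
-- two cyclic sequences are the same cycle when they join the same vertices
-- to the same hyperedges.
SameCycle : ∀ {H} → Cycle H → Cycle H → Set
SameCycle C C′ = ∀ v e → Cycle.Link C v e ⇔ Cycle.Link C′ v e

Unicyclic : Hypergraph → Set
Unicyclic H = Connected H × ∃[ C ] (∀ (C′ : Cycle H) → SameCycle C C′)

LinearUnicyclic : (k m : ℕ) → Hypergraph → Set
LinearUnicyclic k m H = Uniform k H × Linear H × Unicyclic H × size H ≡ m

_≅_ : Hypergraph → Hypergraph → Set
H ≅ H′ =
  Σ[ σ ∈ (Fin (order H) ↔ Fin (order H′)) ]
  Σ[ τ ∈ (Fin (size H) ↔ Fin (size H′)) ]
  (∀ v e → v ∈ edge H e ⇔ Inverse.to σ v ∈ edge H′ (Inverse.to τ e))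

C₃ : Hypergraph
C₃ = record
  { order     = 3
  ; size      = 3
  ; edge      = λ i → ⁅ i ⁆ ∪ ⁅ next i ⁆
  ; injective = λ {i} {j} → inj i j
  }
  where
  inj : (i j : Fin 3) → ⁅ i ⁆ ∪ ⁅ next i ⁆ ≡ ⁅ j ⁆ ∪ ⁅ next j ⁆ → i ≡ j
  inj zero             zero             _ = refl
  inj zero             (suc zero)       ()
  inj zero             (suc (suc zero)) ()
  inj (suc zero)       zero             ()
  inj (suc zero)       (suc zero)       _ = refl
  inj (suc zero)       (suc (suc zero)) ()
  inj (suc (suc zero)) zero             ()
  inj (suc (suc zero)) (suc zero)       ()
  inj (suc (suc zero)) (suc (suc zero)) _ = refl

-- The new vertices come in one block of s vertices per hyperedge.
block : ∀ {m} s → Fin m → Subset (m ℕ.* s)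
block s e = Vec.concat (Vec.tabulate λ f → if does (e ≟ᶠ f) then ⊤ {s} else ⊥)

insertCored : ℕ → Hypergraph → Hypergraph
insertCored s H = record
  { order     = order H ℕ.+ size H ℕ.* s
  ; size      = size H
  ; edge      = λ e → edge H e ++ block s e
  ; injective = λ eq → injective H (++-injectiveˡ _ _ eq)
  }

-- The new hyperedge consists of v and 1 + s new vertices.
addPendant : ℕ → (H : Hypergraph) → Fin (order H) → Hypergraph
addPendant s H v = record
  { order     = order H ℕ.+ suc s
  ; size      = suc (size H)
  ; edge      = edge′
  ; injective = λ {e} {f} → inj e f
  }
  where
  edge′ : Fin (suc (size H)) → Subset (order H ℕ.+ suc s)
  edge′ zero    = ⁅ v ⁆ ++ ⊤
  edge′ (suc e) = edge H e ++ ⊥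

  inj : ∀ e f → edge′ e ≡ edge′ f → e ≡ f
  inj zero    zero    _  = refl
  inj zero    (suc f) eq with () ← ++-injectiveʳ ⁅ v ⁆ (edge H f) eq
  inj (suc e) zero    eq with () ← ++-injectiveʳ (edge H e) ⁅ v ⁆ eq
  inj (suc e) (suc f) eq = cong suc (injective H (++-injectiveˡ _ _ eq))

addPendants : ℕ → ℕ → (H : Hypergraph) → Fin (order H) → Hypergraph
addPendants s zero    H v = H
addPendants s (suc p) H v =
  addPendants s p (addPendant s H v) (v ↑ˡ suc s)

-- C₃⁽ᵏ⁾ ⊙ S_p⁽ᵏ⁾ for k ≥ 2: each pendant hyperedge has k - 1 = 1 + (k ∸ 2)
-- new vertices.  The first three vertices are those of the triangle.
C₃⟨_⟩⊙S_ : ℕ → ℕ → Hypergraph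
C₃⟨ k ⟩⊙S p = addPendants (k ∸ 2) p (insertCored (k ∸ 2) C₃) zero

words : ∀ n r → List (Vec (Fin n) r)
words n zero    = List.[ [] ]
words n (suc r) = List.cartesianProductWith _∷_ (List.allFin n) (words n r)

compositions : ∀ n → ℕ → List (Vec ℕ n)
compositions zero    zero    = List.[ [] ]
compositions zero    (suc d) = List.[]
compositions (suc n) d       = List.concatMap
  (λ e → List.map (e ∷_) (compositions n (d ∸ e))) (List.upTo (suc d))

module _ {c ℓ₁ ℓ₂ ℓ₃} (F : OrderedField c ℓ₁ ℓ₂ ℓ₃) where

  open OrderedField F

  -- Polynomials in the n² indeterminates a_ij, as formal expressions.
  data Poly (n : ℕ) : Set c where
    con     : Carrier → Poly n
    var     : Fin n → Fin n → Poly n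
    _⊕_ _⊗_ : Poly n → Poly n → Poly n

  ∂ : ∀ {n} → Fin n → Fin n → Poly n → Poly n
  ∂ i j (con x)   = con 0#
  ∂ i j (var u v) = con (if does (i ≟ᶠ u) ∧ does (j ≟ᶠ v) then 1# else 0#)
  ∂ i j (p ⊕ q)   = ∂ i j p ⊕ ∂ i j q
  ∂ i j (p ⊗ q)   = (∂ i j p ⊗ q) ⊕ (p ⊗ ∂ i j q)

  constantTerm : ∀ {n} → Poly n → Carrier
  constantTerm (con x)   = x
  constantTerm (var _ _) = 0#
  constantTerm (p ⊕ q)   = constantTerm p + constantTerm q
  constantTerm (p ⊗ q)   = constantTerm p * constantTerm q

  ∑ : ∀ {A : Set} → List A → (A → Carrier) → Carrier
  ∑ xs f = List.foldr (λ x s → f x + s) 0# xs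

  ∑ᴾ : ∀ {A : Set} {n} → List A → (A → Poly n) → Poly n
  ∑ᴾ xs f = List.foldr (λ x s → f x ⊕ s) (con 0#) xs

  -- Entries of the N-th power of the matrix A = (a_ij).
  A^ : ∀ {n} → ℕ → Fin n → Fin n → Poly n
  A^ zero    i j = con (if does (i ≟ᶠ j) then 1# else 0#)
  A^ (suc N) i j = ∑ᴾ (List.allFin _) λ l → var i l ⊗ A^ N l j

  trA^ : ∀ n → ℕ → Poly n
  trA^ n N = ∑ᴾ (List.allFin n) λ i → A^ N i i

  -- Tensors of order 1 + r and dimension n: T i γ is the entry T_{iγ}.
  Tensor : ℕ → ℕ → Set c
  Tensor r n = Fin n → Vec (Fin n) r → Carrier

  ∂ʷ : ∀ {n r} → Fin n → Vec (Fin n) r → Poly n → Poly n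
  ∂ʷ i γ p = Vec.foldr′ (∂ i) p γ

  rowOperator : ∀ {r n} → Tensor r n → Fin n → Poly n → Poly n
  rowOperator {r} {n} T i p = ∑ᴾ (words n r) λ γ → con (T i γ) ⊗ ∂ʷ i γ p

  traceOperator : ∀ {r n} → Tensor r n → Vec ℕ n → Poly n → Poly n
  traceOperator {r} {n} T ds p = List.foldr
    (λ i q → con (1/ (Vec.lookup ds i ℕ.* r) !)
               ⊗ fold q (rowOperator T i) (Vec.lookup ds i))
    p (List.allFin n)

  -- The trace of order d, with r = k - 1.  For d ≥ 1 the operators apply
  -- d·r derivatives to a form of degree d·r, so the result is a constant
  -- polynomial, which constantTerm reads as a scalar.
  Tr : ∀ {r n} → ℕ → Tensor r n → Carrier
  Tr {r} {n} zero      T = fromℕ (n ℕ.* r ^ (n ∸ 1))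
  Tr {r} {n} d@(suc _) T = fromℕ (r ^ (n ∸ 1)) *
    ∑ (compositions n d) λ ds →
      constantTerm (traceOperator T ds (trA^ n (d ℕ.* r)))

  adjacencyTensor : ∀ r (H : Hypergraph) → Tensor r (order H)
  adjacencyTensor r H i γ =
    if does (any? λ e →
      ≡-dec Bool._≟_ (⋃ (List.map ⁅_⁆ (Vec.toList (i ∷ γ)))) (edge H e))
    then 1/ r ! else 0#

  degreeTensor : ∀ r (H : Hypergraph) → Tensor r (order H)
  degreeTensor r H i γ =
    if does (≡-dec _≟ᶠ_ γ (Vec.replicate r i))
    then fromℕ (degree H i) else 0#

  Aα : Carrier → ∀ r (H : Hypergraph) → Tensor r (order H)
  Aα α r H i γ =
    α * degreeTensor r H i γ + (1# - α) * adjacencyTensor r H i γ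

  -- The Sα-order for k-uniform hypergraphs; only hypergraphs with the same
  -- number of vertices are comparable.
  _∙_⊢_≺_ : Carrier → ℕ → Hypergraph → Hypergraph → Set (ℓ₁ ⊔ ℓ₃)
  α ∙ k ⊢ H₁ ≺ H₂ =
    order H₁ ≡ order H₂ ×
    ∃[ d ] (1 ℕ.≤ d ×
            d ℕ.≤ order H₁ ℕ.* (k ∸ 1) ^ (order H₁ ∸ 1) ∸ 1 ×
            (∀ t → t ℕ.< d → Tr t (Aα α (k ∸ 1) H₁) ≈ Tr t (Aα α (k ∸ 1) H₂)) ×
            Tr d (Aα α (k ∸ 1) H₁) < Tr d (Aα α (k ∸ 1) H₂))

  IsLast : Carrier → ℕ → (Hypergraph → Set) → Hypergraph → Set (ℓ₁ ⊔ ℓ₃)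
  IsLast α k Class X =
    Class X × (∀ H → Class H → ¬ (H ≅ X) → α ∙ k ⊢ H ≺ X)

{-# OPTIONS --safe #-}

-- For k and m fixed, Tr₀ and Tr₁ depend only on the number n of vertices, and
-- Tr₂ is a strictly increasing function of Σ d(v)², because closed walks that
-- use the rows of two distinct vertices contribute only if k = 2, and then a
-- constant.  Growing a connected part of the hypergraph one hyperedge at a time
-- and following its Euler characteristic gives n = m(k - 1), so the order is
-- decided at d = 2.
--
-- By linearity, Σ d(v)² plus the number of ordered pairs of disjoint hyperedges
-- is a constant.  Take three consecutive hyperedges of the cycle: every other
-- hyperedge misses one of them, since otherwise there is a second cycle.  So
-- there are at least 2(m - 3) such pairs, and equality forces the three to form
-- a triangle and all other hyperedges to pass through the same vertex of it.
-- This structure determines the hypergraph up to isomorphism.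
module Submission where

open import Defs
open import Algebra.Bundles using (CommutativeRing; Semiring)
open import Data.Bool.Base using (Bool; true; false; if_then_else_; _∧_)
import Data.Bool.Properties as Bool
open import Data.Fin.Base as Fin using (Fin; zero; suc; punchIn; splitAt; _↑ˡ_; _↑ʳ_)
import Data.Fin.Permutation as Perm
import Data.Fin.Properties as Fin
open import Data.Fin.Properties using (any?) renaming (_≟_ to _≟ᶠ_)
open import Data.Fin.Relation.Unary.Top using (view; ‵fromℕ; ‵inject₁)
open import Data.Fin.Subset using (Subset; _∈_; _∉_; _⊆_; ⁅_⁆; ⊤; ⊥; _∪_; _∩_; ⋃; ∣_∣)
open import Data.Fin.Subset.Properties
open import Data.List.Base as List using (List; []; _∷_)
open import Data.List.Relation.Unary.All as All using (All; []; _∷_)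
open import Data.List.Relation.Unary.Any as Any using (Any; here; there)
open import Data.Maybe.Base using (Maybe; just; nothing)
import Data.Maybe.Properties as Maybe
open import Data.Nat.Base as ℕ using (ℕ; zero; suc; _∸_; _^_; _!; _≤_)
import Data.Nat.DivMod as ℕ
open import Data.Nat.GeneralisedArithmetic using (fold)
import Data.Nat.Properties as ℕ
open import Data.Product.Base using (_×_; _,_; proj₁; proj₂; ∃-syntax)
open import Data.Sum.Base as Sum using (_⊎_; inj₁; inj₂)
import Data.Sum.Properties as Sum
open import Data.Vec.Base as Vec using (Vec; []; _∷_; _++_; lookup; here; there)
import Data.Vec.Properties as Vec
import Data.Vec.Relation.Unary.All as VAll
import Data.Vec.Relation.Unary.Any as VAny
open import Function.Base using (id; _∘_)
open import Function.Bundles using (_⇔_; mk⇔; Equivalence)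
open import Function.Construct.Composition using (_⇔-∘_)
open import Function.Construct.Symmetry using (⇔-sym)
open import Function.Definitions using (Injective)
open import Relation.Binary.Construct.Closure.ReflexiveTransitive as Star using (Star; ε; _◅_; _◅◅_)
open import Relation.Binary.Definitions using (DecidableEquality)
open import Relation.Binary.PropositionalEquality as ≡ using (_≡_; _≢_)
open import Relation.Nullary using (¬_; Dec; does; yes; no; contradiction)
open import Relation.Nullary.Decidable
  using (dec-true; dec-false; from-yes; ¬?; _×-dec_; _→-dec_)

-- Polynomials are formal expressions without normal forms, so traces are read off through
-- coefficients: a word of derivatives applied to tr(A^N), evaluated at zero, counts the orderings
-- of the word that are closed walks. With a single row only loops survive, and the number of their
-- orderings cancels the factorial in the trace operator; hence the diagonal part of Tr₂ is α² Σ
-- d(v)² up to a factor depending on n and k. With two rows and k ≥ 3 there remain loops at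
-- different vertices, which no walk joins; for k = 2 there remains an edge walked forth and back.
-- The bound 2(m - 3) comes from one miss for each of the m - 3 hyperedges off the arc, counted in
-- both orders. The equality case and the extremal hypergraph are described by the same record
-- `Sun`, so that uniqueness is proved once for this record and the explicit construction only needs
-- an induction over its pendant hyperedges.

-- Finite sums over indices and over pairs of indices

module Summation {c ℓ} (R : Semiring c ℓ) where

  open Semiring R hiding (zero)
  import Algebra.Properties.Semiring.Sum R as Finite
  open import Relation.Binary.Reasoning.Setoid setoid

  -- Opaque, so that the summand is inferred from the sum by unification.
  opaque
    sum : ∀ {n} → (Fin n → Carrier) → Carrier
    sum = Finite.sum

    sum-suc : ∀ {n} (f : Fin (suc n) → Carrier) → sum f ≡ f zero + sum (f ∘ suc)
    sum-suc f = ≡.refl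

    sum-empty : ∀ (f : Fin 0 → Carrier) → sum f ≡ 0#
    sum-empty f = ≡.refl

    sum-cong : ∀ {n} {f g : Fin n → Carrier} → (∀ i → f i ≈ g i) → sum f ≈ sum g
    sum-cong = Finite.sum-cong-≋

    sum-zero : ∀ {n} {f : Fin n → Carrier} → (∀ i → f i ≈ 0#) → sum f ≈ 0#
    sum-zero {n} f≈0 = trans (sum-cong f≈0) (Finite.sum-replicate-zero n)

    sum-+ : ∀ {n} (f g : Fin n → Carrier) → sum (λ i → f i + g i) ≈ sum f + sum g
    sum-+ = Finite.∑-distrib-+

    sum-comm : ∀ {m n} (f : Fin m → Fin n → Carrier) →
               sum (λ i → sum (f i)) ≈ sum (λ j → sum λ i → f i j)
    sum-comm = Finite.∑-comm

    sum-*ˡ : ∀ {n} x (f : Fin n → Carrier) → sum (λ i → x * f i) ≈ x * sum f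
    sum-*ˡ x f = sym (Finite.*-distribˡ-sum x f)

    sum-*ʳ : ∀ {n} x (f : Fin n → Carrier) → sum (λ i → f i * x) ≈ sum f * x
    sum-*ʳ x f = sym (Finite.*-distribʳ-sum x f)

    sum-remove : ∀ {n} (i : Fin (suc n)) (f : Fin (suc n) → Carrier) →
                 sum f ≈ f i + sum (f ∘ punchIn i)
    sum-remove i f = Finite.sum-remove f

  ind : Bool → Carrier
  ind b = if b then 1# else 0#

  ind-∧ : ∀ x y → ind (x ∧ y) ≈ ind x * ind y
  ind-∧ true  y = sym (*-identityˡ _)
  ind-∧ false y = sym (zeroˡ _)

  ind-≢ : ∀ {n} {i j : Fin n} → i ≢ j → ind (does (i ≟ᶠ j)) ≈ 0#
  ind-≢ {i = i} {j} i≢j = reflexive (≡.cong ind (dec-false (i ≟ᶠ j) i≢j))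

  ind-refl : ∀ {n} (i : Fin n) → ind (does (i ≟ᶠ i)) ≈ 1#
  ind-refl i = reflexive (≡.cong ind (dec-true (i ≟ᶠ i) ≡.refl))

  sum-single : ∀ {n} (b : Fin n) (f : Fin n → Carrier) → (∀ l → l ≢ b → f l ≈ 0#) → sum f ≈ f b
  sum-single zero    f f≈0 = trans (reflexive (sum-suc f))
    (trans (+-congˡ (sum-zero λ l → f≈0 (suc l) λ ())) (+-identityʳ _))
  sum-single (suc b) f f≈0 = trans (reflexive (sum-suc f))
    (trans (+-cong (f≈0 zero λ ()) (sum-single b (f ∘ suc) λ l l≢b →
      f≈0 (suc l) λ { ≡.refl → l≢b ≡.refl })) (+-identityˡ _))

  sum-δ : ∀ {n} (b : Fin n) (f : Fin n → Carrier) →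
          sum (λ l → ind (does (b ≟ᶠ l)) * f l) ≈ f b
  sum-δ b f = trans
    (sum-single b _ λ l l≢b → trans (*-congʳ (ind-≢ (l≢b ∘ ≡.sym))) (zeroˡ _))
    (trans (*-congʳ (ind-refl b)) (*-identityˡ _))

  opaque
    -- Each unordered pair is taken once, as i < j. Peeling off index `zero` follows the recursion
    -- of `compositions`, which fixes the exponent of the first row.
    pairs : ∀ {n} → (Fin n → Fin n → Carrier) → Carrier
    pairs {zero}  g = 0#
    pairs {suc n} g = sum (λ j → g zero (suc j)) + pairs (λ i j → g (suc i) (suc j))

    pairs-empty : ∀ (g : Fin 0 → Fin 0 → Carrier) → pairs g ≡ 0#
    pairs-empty g = ≡.refl

    pairs-suc : ∀ {n} (g : Fin (suc n) → Fin (suc n) → Carrier) →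
                pairs g ≡ sum (λ j → g zero (suc j)) + pairs (λ i j → g (suc i) (suc j))
    pairs-suc g = ≡.refl

    pairs-cong : ∀ {n} {g h : Fin n → Fin n → Carrier} →
                 (∀ i j → i ≢ j → g i j ≈ h i j) → pairs g ≈ pairs h
    pairs-cong {zero}  g≈h = refl
    pairs-cong {suc n} g≈h = +-cong (sum-cong λ j → g≈h zero (suc j) λ ())
      (pairs-cong λ i j i≢j → g≈h (suc i) (suc j) λ { ≡.refl → i≢j ≡.refl })

    pairs-zero : ∀ {n} {g : Fin n → Fin n → Carrier} →
                 (∀ i j → i ≢ j → g i j ≈ 0#) → pairs g ≈ 0#
    pairs-zero {zero}  g≈0 = refl
    pairs-zero {suc n} g≈0 = trans (+-cong (sum-zero λ j → g≈0 zero (suc j) λ ())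
      (pairs-zero λ i j i≢j → g≈0 (suc i) (suc j) λ { ≡.refl → i≢j ≡.refl })) (+-identityˡ _)

    pairs-*ˡ : ∀ {n} x (g : Fin n → Fin n → Carrier) → pairs (λ i j → x * g i j) ≈ x * pairs g
    pairs-*ˡ {zero}  x g = sym (zeroʳ x)
    pairs-*ˡ {suc n} x g = trans (+-cong (sum-*ˡ x _) (pairs-*ˡ x λ i j → g (suc i) (suc j)))
      (sym (distribˡ _ _ _))

    pairs-+ : ∀ {n} (g h : Fin n → Fin n → Carrier) →
              pairs (λ i j → g i j + h i j) ≈ pairs g + pairs h
    pairs-+ {zero}  g h = sym (+-identityʳ 0#)
    pairs-+ {suc n} g h = trans
      (+-cong (sum-+ _ _) (pairs-+ (λ i j → g (suc i) (suc j)) (λ i j → h (suc i) (suc j))))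
      (interchange _ _ _ _)
      where open import Algebra.Properties.CommutativeSemigroup +-commutativeSemigroup using
              (interchange)

  sum-pairs : ∀ {n} (g : Fin n → Fin n → Carrier) → (∀ i j → g i j ≈ g j i) →
              sum (λ i → sum (g i)) ≈ sum (λ i → g i i) + (pairs g + pairs g)
  sum-pairs {zero}  g comm = begin
    sum (λ i → sum (g i))     ≡⟨ ≡.trans (sum-empty _) (≡.sym (sum-empty _)) ⟩
    sum d                     ≈⟨ +-identityʳ _ ⟨
    sum d + 0#                ≈⟨ +-congˡ (+-identityʳ _) ⟨
    sum d + (0# + 0#)         ≡⟨ ≡.cong (λ p → sum d + (p + p)) (pairs-empty g) ⟨
    sum d + (pairs g + pairs g) ∎
    where d = λ i → g i i
  sum-pairs {suc n} g comm = begin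
    sum (λ i → sum (g i))
      ≡⟨ sum-suc _ ⟩
    sum (g zero) + sum (λ i → sum (g (suc i)))
      ≈⟨ +-cong (reflexive (sum-suc _)) (trans (sum-cong λ i → reflexive (sum-suc (g (suc i))))
        (sum-+ _ _)) ⟩
    (a + b) + (sum (λ i → g (suc i) zero) + sum (λ i → sum λ j → g (suc i) (suc j)))
      ≈⟨ +-congˡ (+-cong (sum-cong λ i → comm (suc i) zero)
        (sum-pairs (λ i j → g (suc i) (suc j)) λ i j → comm (suc i) (suc j))) ⟩
    (a + b) + (b + (d + (p + p)))
      ≈⟨ trans (+-assoc a b _) (+-congˡ (x+[x+[y+[z+z]]] b d p)) ⟩
    a + (d + ((b + p) + (b + p)))
      ≈⟨ +-assoc a d _ ⟨
    (a + d) + ((b + p) + (b + p))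
      ≡⟨ ≡.cong₂ (λ x y → x + (y + y)) (sum-suc (λ i → g i i)) (pairs-suc g) ⟨
    sum (λ i → g i i) + (pairs g + pairs g) ∎
    where
    a = g zero zero
    b = sum (λ j → g zero (suc j))
    d = sum (λ i → g (suc i) (suc i))
    p = pairs (λ i j → g (suc i) (suc j))

    x+[x+[y+[z+z]]] : ∀ x y z → x + (x + (y + (z + z))) ≈ y + ((x + z) + (x + z))
    x+[x+[y+[z+z]]] = solve 3
      (λ x y z → x ⊕ (x ⊕ (y ⊕ (z ⊕ z))) ⊜ y ⊕ ((x ⊕ z) ⊕ (x ⊕ z))) refl
      where open import Algebra.Solver.CommutativeMonoid +-commutativeMonoid

-- Double counting of degrees and codegrees

module Counting where

  open import Data.Nat.Base using (_+_; _*_)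
  open ≡ using (refl; sym; trans; cong; cong₂; module ≡-Reasoning)
  open Summation ℕ.+-*-semiring public

  infix 8 _∈#_
  _∈#_ : ∀ {n} → Fin n → Subset n → ℕ
  v ∈# S = ind (does (v ∈? S))

  ∈#-yes : ∀ {n} {v : Fin n} {S} → v ∈ S → v ∈# S ≡ 1
  ∈#-yes {v = v} {S} v∈S = cong ind (dec-true (v ∈? S) v∈S)

  ∈#-no : ∀ {n} {v : Fin n} {S} → v ∉ S → v ∈# S ≡ 0
  ∈#-no {v = v} {S} v∉S = cong ind (dec-false (v ∈? S) v∉S)

  ∣∣≡sum : ∀ {n} (S : Subset n) → ∣ S ∣ ≡ sum (_∈# S)
  ∣∣≡sum []          = sym (sum-empty _)
  ∣∣≡sum (true  ∷ S) = trans (cong suc (∣∣≡sum S)) (sym (sum-suc _))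
  ∣∣≡sum (false ∷ S) = trans (∣∣≡sum S) (sym (sum-suc _))

  count≡sum : ∀ {A : Set} {P : A → Set} (P? : ∀ x → Dec (P x)) {n} (f : Fin n → A) →
              Vec.count P? (Vec.tabulate f) ≡ sum (λ i → ind (does (P? (f i))))
  count≡sum P? {zero}  f = sym (sum-empty _)
  count≡sum P? {suc n} f with count≡sum P? (f ∘ suc) | sum-suc (λ i → ind (does (P? (f i))))
  ... | ih | eq rewrite eq with does (P? (f zero))
  ... | true  = cong suc ih
  ... | false = ih

  ∈#-∩ : ∀ {n} (v : Fin n) S T → v ∈# (S ∩ T) ≡ v ∈# S * v ∈# T
  ∈#-∩ v S T with v ∈? S | v ∈? T
  ... | yes v∈S | yes v∈T = ∈#-yes (x∈p∩q⁺ (v∈S , v∈T))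
  ... | yes v∈S | no  v∉T = ∈#-no (v∉T ∘ proj₂ ∘ x∈p∩q⁻ S T)
  ... | no  v∉S | _       = ∈#-no (v∉S ∘ proj₁ ∘ x∈p∩q⁻ S T)

  ∈#-idem : ∀ {n} (v : Fin n) S → v ∈# S * v ∈# S ≡ v ∈# S
  ∈#-idem v S with does (v ∈? S)
  ... | true  = refl
  ... | false = refl

  sum-const : ∀ n x → sum {n} (λ _ → x) ≡ n * x
  sum-const zero    x = sum-empty _
  sum-const (suc n) x = trans (sum-suc _) (cong (x +_) (sum-const n x))

  sum-*-sum : ∀ {m n} (f : Fin m → ℕ) (g : Fin n → ℕ) →
              sum f * sum g ≡ sum (λ i → sum λ j → f i * g j)
  sum-*-sum f g = trans (sym (sum-*ʳ (sum g) f)) (sum-cong λ i → sym (sum-*ˡ (f i) g))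

  module _ (H : Hypergraph) where

    degree≡sum : ∀ v → degree H v ≡ sum (λ e → v ∈# edge H e)
    degree≡sum v = count≡sum (λ e → v ∈? edge H e) id

    -- For a linear 2-uniform hypergraph this is the adjacency matrix off the diagonal.
    codegree : Fin (order H) → Fin (order H) → ℕ
    codegree u v = sum λ e → u ∈# edge H e * v ∈# edge H e

    codegree-comm : ∀ u v → codegree u v ≡ codegree v u
    codegree-comm u v = sum-cong λ e → ℕ.*-comm (u ∈# edge H e) _

    codegree-diag : ∀ v → codegree v v ≡ degree H v
    codegree-diag v = trans (sum-cong λ e → ∈#-idem v (edge H e)) (sym (degree≡sum v))

    sum-degree : ∀ {k} → Uniform k H → sum (degree H) ≡ size H * k
    sum-degree {k} unif = begin
      sum (degree H)                             ≡⟨ sum-cong degree≡sum ⟩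
      sum (λ v → sum λ e → v ∈# edge H e)        ≡⟨ sum-comm _ ⟩
      sum (λ e → sum λ v → v ∈# edge H e)        ≡⟨ sum-cong
        (λ e → trans (sym (∣∣≡sum (edge H e))) (unif e)) ⟩
      sum {size H} (λ e → k)                     ≡⟨ sum-const (size H) k ⟩
      size H * k                                 ∎
      where open ≡-Reasoning

    -- Both sides count triples (v, e, f) with v in e and in f, the case e = f included; this turns
    -- degrees into intersections of hyperedges.
    sum-degree² : sum (λ v → degree H v * degree H v) ≡
                  sum (λ e → sum λ f → ∣ edge H e ∩ edge H f ∣)
    sum-degree² = begin
      sum (λ v → degree H v * degree H v)
        ≡⟨ sum-cong (λ v → trans (cong₂ _*_ (degree≡sum v) (degree≡sum v)) (sum-*-sum _ _)) ⟩
      sum (λ v → sum λ e → sum λ f → v ∈# edge H e * v ∈# edge H f)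
        ≡⟨ sum-comm _ ⟩
      sum (λ e → sum λ v → sum λ f → v ∈# edge H e * v ∈# edge H f)
        ≡⟨ sum-cong (λ e → sum-comm _) ⟩
      sum (λ e → sum λ f → sum λ v → v ∈# edge H e * v ∈# edge H f)
        ≡⟨ sum-cong (λ e → sum-cong λ f → trans
          (sum-cong λ v → sym (∈#-∩ v (edge H e) (edge H f)))
            (sym (∣∣≡sum (edge H e ∩ edge H f)))) ⟩
      sum (λ e → sum λ f → ∣ edge H e ∩ edge H f ∣) ∎
      where open ≡-Reasoning

    sum-codegree : ∀ {k} → Uniform k H → sum (λ u → sum λ v → codegree u v) ≡ size H * (k * k)
    sum-codegree {k} unif = begin
      sum (λ u → sum λ v → sum λ e → u ∈# edge H e * v ∈# edge H e)
        ≡⟨ trans (sum-cong λ u → sum-comm _) (sum-comm _) ⟩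
      sum (λ e → sum λ u → sum λ v → u ∈# edge H e * v ∈# edge H e)
        ≡⟨ sum-cong (λ e → trans (sym (sum-*-sum _ _)) (cong₂ _*_ (∣e∣ e) (∣e∣ e))) ⟩
      sum {size H} (λ e → k * k)
        ≡⟨ sum-const (size H) _ ⟩
      size H * (k * k) ∎
      where
      open ≡-Reasoning
      ∣e∣ : ∀ e → sum (_∈# edge H e) ≡ k
      ∣e∣ e = trans (sym (∣∣≡sum (edge H e))) (unif e)

    -- Of the 4m triples (u, v, e) with u and v in e, the diagonal u = v takes the degree sum 2m;
    -- symmetry splits the other 2m evenly.
    pairs-codegree : Uniform 2 H → pairs codegree + pairs codegree ≡ size H * 2
    pairs-codegree unif = ℕ.+-cancelˡ-≡ (size H * 2) _ _ (begin
      size H * 2 + (pairs codegree + pairs codegree)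
        ≡⟨ cong (_+ (pairs codegree + pairs codegree))
          (trans (sum-cong codegree-diag) (sum-degree unif)) ⟨
      sum (λ v → codegree v v) + (pairs codegree + pairs codegree)
        ≡⟨ sum-pairs codegree codegree-comm ⟨
      sum (λ u → sum λ v → codegree u v)
        ≡⟨ sum-codegree unif ⟩
      size H * 4
        ≡⟨ ℕ.*-distribˡ-+ (size H) 2 2 ⟩
      size H * 2 + size H * 2 ∎)
      where open ≡-Reasoning

-- Cardinalities of subsets and linearity

module Subsets where

  open import Data.Fin.Subset using (_-_)
  open import Data.Nat.Base using (_+_; _≤_; z≤n; s≤s)
  open ≡ using (refl; sym; trans; cong; subst)

  private variable
    n : ℕ

  ∣∪∣+∣∩∣ : ∀ (S T : Subset n) → ∣ S ∪ T ∣ + ∣ S ∩ T ∣ ≡ ∣ S ∣ + ∣ T ∣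
  ∣∪∣+∣∩∣ []          []          = refl
  ∣∪∣+∣∩∣ (true  ∷ S) (true  ∷ T) = cong suc (trans (ℕ.+-suc _ _)
    (trans (cong suc (∣∪∣+∣∩∣ S T)) (sym (ℕ.+-suc _ _))))
  ∣∪∣+∣∩∣ (true  ∷ S) (false ∷ T) = cong suc (∣∪∣+∣∩∣ S T)
  ∣∪∣+∣∩∣ (false ∷ S) (true  ∷ T) = trans (cong suc (∣∪∣+∣∩∣ S T)) (sym (ℕ.+-suc _ _))
  ∣∪∣+∣∩∣ (false ∷ S) (false ∷ T) = ∣∪∣+∣∩∣ S T

  ∣∪∣≤ : ∀ (S T : Subset n) → ∣ S ∪ T ∣ ≤ ∣ S ∣ + ∣ T ∣
  ∣∪∣≤ S T = subst (∣ S ∪ T ∣ ≤_) (∣∪∣+∣∩∣ S T) (ℕ.m≤m+n _ _)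

  member : ∀ {S : Subset n} → 1 ≤ ∣ S ∣ → ∃[ x ] x ∈ S
  member {S = true  ∷ S} _   = zero , here
  member {S = false ∷ S} 1≤S = let x , x∈S = member 1≤S in suc x , there x∈S

  ∣S∣≤1+∣S-x∣ : ∀ (S : Subset n) x → ∣ S ∣ ≤ suc ∣ S - x ∣
  ∣S∣≤1+∣S-x∣ S x = begin
    ∣ S ∣              ≤⟨ p⊆q⇒∣p∣≤∣q∣ cover ⟩
    ∣ ⁅ x ⁆ ∪ (S - x) ∣  ≤⟨ ∣∪∣≤ ⁅ x ⁆ (S - x) ⟩
    ∣ ⁅ x ⁆ ∣ + ∣ S - x ∣ ≡⟨ cong (_+ ∣ S - x ∣) (∣⁅x⁆∣≡1 x) ⟩
    suc ∣ S - x ∣ ∎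
    where
    open ℕ.≤-Reasoning
    open import Data.Sum.Base using (inj₁; inj₂)
    cover : S ⊆ ⁅ x ⁆ ∪ (S - x)
    cover {y} y∈S with y ≟ᶠ x
    ... | yes refl = x∈p∪q⁺ (inj₁ (x∈⁅x⁆ x))
    ... | no  y≢x  = x∈p∪q⁺ (inj₂ (x∈p∧x≢y⇒x∈p-y y∈S y≢x))

  ∈-⇒≢ : ∀ {S : Subset n} {x y} → y ∈ S - x → y ∈ S × y ≢ x
  ∈-⇒≢ {S = S} {x} y∈ = p─q⊆p S ⁅ x ⁆ y∈ , λ { refl → x∉p-x S x y∈ }
    where
    x∉p-x : ∀ {n} (S : Subset n) x → x ∉ S - x
    x∉p-x (s ∷ S) zero    ()
    x∉p-x (s ∷ S) (suc x) (there x∈) = x∉p-x S x x∈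

  two-members : ∀ {S : Subset n} → 2 ≤ ∣ S ∣ → ∃[ x ] ∃[ y ] (x ∈ S × y ∈ S × y ≢ x)
  two-members {S = S} 2≤S =
    let x , x∈ = member (ℕ.≤-trans (s≤s z≤n) 2≤S)
        y , y∈ = member (ℕ.s≤s⁻¹ (ℕ.≤-trans 2≤S (∣S∣≤1+∣S-x∣ S x)))
        y∈S , y≢x = ∈-⇒≢ y∈
    in x , y , x∈ , y∈S , y≢x

  three-members : ∀ {S : Subset n} → 3 ≤ ∣ S ∣ →
    ∃[ x ] ∃[ y ] ∃[ z ] (x ∈ S × y ∈ S × z ∈ S × y ≢ x × z ≢ x × z ≢ y)
  three-members {S = S} 3≤S =
    let x , x∈ = member (ℕ.≤-trans (s≤s z≤n) 3≤S)
        y , z , y∈ , z∈ , z≢y = two-members (ℕ.s≤s⁻¹ (ℕ.≤-trans 3≤S (∣S∣≤1+∣S-x∣ S x)))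
        y∈S , y≢x = ∈-⇒≢ y∈
        z∈S , z≢x = ∈-⇒≢ z∈
    in x , y , z , x∈ , y∈S , z∈S , y≢x , z≢x , z≢y

  members⇒1≤ : ∀ {S : Subset n} {x} → x ∈ S → 1 ≤ ∣ S ∣
  members⇒1≤ {S = S} {x} x∈ = ℕ.≤-trans (s≤s z≤n) (x∈p⇒∣p-x∣<∣p∣ x∈)

  members⇒2≤ : ∀ {S : Subset n} {x y} → x ∈ S → y ∈ S → y ≢ x → 2 ≤ ∣ S ∣
  members⇒2≤ {S = S} {x} {y} x∈ y∈ y≢x =
    ℕ.≤-trans (s≤s (members⇒1≤ (x∈p∧x≢y⇒x∈p-y y∈ y≢x))) (x∈p⇒∣p-x∣<∣p∣ x∈)

  ⊆∧∣∣≥⇒≡ : ∀ {S T : Subset n} → S ⊆ T → ∣ T ∣ ≤ ∣ S ∣ → S ≡ T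
  ⊆∧∣∣≥⇒≡ {S = S} {T} S⊆T T≤S = ⊆-antisym S⊆T T⊆S
    where
    T⊆S : T ⊆ S
    T⊆S {x} x∈T with x ∈? S
    ... | yes x∈S = x∈S
    ... | no  x∉S = contradiction (ℕ.<-≤-trans (p⊂q⇒∣p∣<∣q∣ (S⊆T , x , x∈T , x∉S)) T≤S)
      (ℕ.<-irrefl refl)

  linear-unique : ∀ {H} → Linear H → ∀ {e f} → e ≢ f → ∀ {u v} →
    u ∈ edge H e → u ∈ edge H f → v ∈ edge H e → v ∈ edge H f → u ≡ v
  linear-unique {H} lin {e} {f} e≢f {u} {v} ue uf ve vf with u ≟ᶠ v
  ... | yes u≡v = u≡v
  ... | no  u≢v = contradiction (ℕ.≤-trans (members⇒2≤ (x∈p∩q⁺ (ve , vf)) (x∈p∩q⁺ (ue , uf)) u≢v)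
    (lin e f e≢f)) λ { (s≤s ()) }

-- Coefficients of tr(A^N) as counts of closed walks

module Traces {c ℓ₁ ℓ₂ ℓ₃} (F : OrderedField c ℓ₁ ℓ₂ ℓ₃) where

  open OrderedField F hiding (zero)
  open CommutativeRing commutativeRing using (semiring)
  open import Relation.Binary.Reasoning.Setoid setoid
  open Summation semiring
  open import Algebra.Properties.Semiring.Mult semiring
    using (×-homo-+; ×1-homo-*)

  x≈0⇒y*x≈0 : ∀ {x} y → x ≈ 0# → y * x ≈ 0#
  x≈0⇒y*x≈0 y x≈0 = trans (*-congˡ x≈0) (zeroʳ y)

  ∑-cong : ∀ {A : Set} (xs : List A) {f g : A → Carrier} →
           (∀ x → f x ≈ g x) → ∑ F xs f ≈ ∑ F xs g
  ∑-cong []       f≈g = refl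
  ∑-cong (x ∷ xs) f≈g = +-cong (f≈g x) (∑-cong xs f≈g)

  ∑-zero : ∀ {A : Set} (xs : List A) {f : A → Carrier} →
           (∀ x → f x ≈ 0#) → ∑ F xs f ≈ 0#
  ∑-zero []       f≈0 = refl
  ∑-zero (x ∷ xs) f≈0 = trans (+-cong (f≈0 x) (∑-zero xs f≈0)) (+-identityˡ _)

  ∑-++ : ∀ {A : Set} (xs ys : List A) (f : A → Carrier) →
         ∑ F (xs List.++ ys) f ≈ ∑ F xs f + ∑ F ys f
  ∑-++ []       ys f = sym (+-identityˡ _)
  ∑-++ (x ∷ xs) ys f = trans (+-congˡ (∑-++ xs ys f)) (sym (+-assoc _ _ _))

  ∑-map : ∀ {A B : Set} (h : A → B) (xs : List A) (f : B → Carrier) →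
          ∑ F (List.map h xs) f ≈ ∑ F xs (f ∘ h)
  ∑-map h []       f = refl
  ∑-map h (x ∷ xs) f = +-congˡ (∑-map h xs f)

  +-interchange : ∀ a b c d → (a + b) + (c + d) ≈ (a + c) + (b + d)
  +-interchange a b c d = begin
    (a + b) + (c + d)  ≈⟨ +-assoc _ _ _ ⟩
    a + (b + (c + d))  ≈⟨ +-congˡ (+-assoc _ _ _) ⟨
    a + ((b + c) + d)  ≈⟨ +-congˡ (+-congʳ (+-comm b c)) ⟩
    a + ((c + b) + d)  ≈⟨ +-congˡ (+-assoc _ _ _) ⟩
    a + (c + (b + d))  ≈⟨ +-assoc _ _ _ ⟨
    (a + c) + (b + d)  ∎

  ∑-+ : ∀ {A : Set} (xs : List A) (f g : A → Carrier) →
        ∑ F xs (λ x → f x + g x) ≈ ∑ F xs f + ∑ F xs g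
  ∑-+ []       f g = sym (+-identityˡ _)
  ∑-+ (x ∷ xs) f g = trans (+-congˡ (∑-+ xs f g)) (+-interchange _ _ _ _)

  ∑-tabulate : ∀ {A : Set} {n} (h : Fin n → A) (f : A → Carrier) →
               ∑ F (List.tabulate h) f ≈ sum (f ∘ h)
  ∑-tabulate {n = zero}  h f = reflexive (≡.sym (sum-empty _))
  ∑-tabulate {n = suc n} h f = trans (+-congˡ (∑-tabulate (h ∘ suc) f))
    (reflexive (≡.sym (sum-suc _)))

  ∑-allFin : ∀ {n} (f : Fin n → Carrier) → ∑ F (List.allFin n) f ≈ sum f
  ∑-allFin = ∑-tabulate id

  ∑-cartesianProductWith : ∀ {A B C : Set} (h : A → B → C) xs ys (f : C → Carrier) →
    ∑ F (List.cartesianProductWith h xs ys) f ≈ ∑ F xs (λ x → ∑ F ys (λ y → f (h x y)))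
  ∑-cartesianProductWith h []       ys f = refl
  ∑-cartesianProductWith h (x ∷ xs) ys f = trans (∑-++ (List.map (h x) ys) _ f)
    (+-cong (∑-map (h x) ys f) (∑-cartesianProductWith h xs ys f))

  ∑-words-single : ∀ {n r} (δ : Vec (Fin n) r) (f : Vec (Fin n) r → Carrier) →
                   (∀ γ → γ ≢ δ → f γ ≈ 0#) → ∑ F (words n r) f ≈ f δ
  ∑-words-single []      f f≈0 = +-identityʳ _
  ∑-words-single {n} {suc r} (b ∷ δ) f f≈0 = begin
    ∑ F (words n (suc r)) f
      ≈⟨ ∑-cartesianProductWith _∷_ (List.allFin n) (words n r) f ⟩
    ∑ F (List.allFin n) (λ a → ∑ F (words n r) (λ γ → f (a ∷ γ)))
      ≈⟨ ∑-allFin (λ a → ∑ F (words n r) (λ γ → f (a ∷ γ))) ⟩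
    sum (λ a → ∑ F (words n r) (λ γ → f (a ∷ γ)))
      ≈⟨ sum-single b _ (λ a a≢b → ∑-zero (words n r) λ γ → f≈0 _ (a≢b ∘ Vec.∷-injectiveˡ)) ⟩
    ∑ F (words n r) (λ γ → f (b ∷ γ))
      ≈⟨ ∑-words-single δ _ (λ γ γ≢δ → f≈0 _ (γ≢δ ∘ Vec.∷-injectiveʳ)) ⟩
    f (b ∷ δ) ∎

  -- A letter (i , j) is at once the derivative along a_ij and an arc from i to j; this double
  -- reading turns coefficients into walks.
  Letter : ℕ → Set
  Letter n = Fin n × Fin n

  Word : ℕ → Set
  Word n = List (Letter n)

  private variable
    n r : ℕ

  -- A polynomial is known through its iterated derivatives at zero. The head of the word is the
  -- derivative applied first.
  coeff : Word n → Poly F n → Carrier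
  coeff []            p = constantTerm F p
  coeff ((i , j) ∷ w) p = coeff w (∂ F i j p)

  infix 4 _≈ᴾ_
  -- Agreement of all derivatives at zero is equality of polynomials in characteristic zero; unlike
  -- agreement of constant terms it is preserved by differentiation.
  _≈ᴾ_ : Poly F n → Poly F n → Set ℓ₁
  p ≈ᴾ q = ∀ w → coeff w p ≈ coeff w q

  coeff-⊕ : ∀ w (p q : Poly F n) → coeff w (p ⊕ q) ≈ coeff w p + coeff w q
  coeff-⊕ []      p q = refl
  coeff-⊕ (l ∷ w) p q = coeff-⊕ w _ _

  coeff-con0 : ∀ w → coeff {n} w (con 0#) ≈ 0#
  coeff-con0 []      = refl
  coeff-con0 (l ∷ w) = coeff-con0 w

  coeff-con⊗ : ∀ w x (p : Poly F n) → coeff w (con x ⊗ p) ≈ x * coeff w p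
  coeff-con⊗ []            x p = refl
  coeff-con⊗ ((i , j) ∷ w) x p = begin
    coeff w ((con 0# ⊗ p) ⊕ (con x ⊗ ∂ F i j p))
      ≈⟨ coeff-⊕ w _ _ ⟩
    coeff w (con 0# ⊗ p) + coeff w (con x ⊗ ∂ F i j p)
      ≈⟨ +-cong (coeff-con⊗ w 0# p) (coeff-con⊗ w x _) ⟩
    0# * coeff w p + x * coeff w (∂ F i j p)
      ≈⟨ trans (+-congʳ (zeroˡ _)) (+-identityˡ _) ⟩
    x * coeff w (∂ F i j p) ∎

  coeff-∑ᴾ : ∀ {A : Set} w (xs : List A) (f : A → Poly F n) →
             coeff w (∑ᴾ F xs f) ≈ ∑ F xs (coeff w ∘ f)
  coeff-∑ᴾ w []       f = coeff-con0 w
  coeff-∑ᴾ w (x ∷ xs) f = trans (coeff-⊕ w _ _) (+-congˡ (coeff-∑ᴾ w xs f))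

  -- The sum over all ways to take one letter out of a word, which is how a
  -- word of derivatives acts on a product with a variable (Leibniz rule).
  sumPick : (Letter n → Word n → Carrier) → Word n → Carrier
  sumPick g []      = 0#
  sumPick g (l ∷ w) = g l w + sumPick (λ l′ w′ → g l′ (l ∷ w′)) w

  sumPick-cong : ∀ {g h : Letter n → Word n → Carrier} w →
                 (∀ l w′ → g l w′ ≈ h l w′) → sumPick g w ≈ sumPick h w
  sumPick-cong []      g≈h = refl
  sumPick-cong (l ∷ w) g≈h = +-cong (g≈h l w) (sumPick-cong w λ l′ w′ → g≈h l′ (l ∷ w′))

  sum-sumPick : ∀ {m} (g : Fin m → Letter n → Word n → Carrier) w →
                sum (λ i → sumPick (g i) w) ≈ sumPick (λ l w′ → sum (λ i → g i l w′)) w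
  sum-sumPick g []      = sum-zero λ _ → refl
  sum-sumPick g (l ∷ w) = trans (sum-+ _ _)
    (+-congˡ (sum-sumPick (λ i l′ w′ → g i l′ (l ∷ w′)) w))

  -- All N positions of a constant word leave the same remainder. The truncated `N ∸ 1` does no harm
  -- at N = 0, where the factor is zero.
  sumPick-replicate : ∀ (g : Letter n → Word n → Carrier) N l →
    sumPick g (List.replicate N l) ≈ fromℕ N * g l (List.replicate (N ∸ 1) l)
  sumPick-replicate g zero          l = sym (zeroˡ _)
  sumPick-replicate g (suc zero)    l = sym (trans (*-congʳ (+-identityʳ 1#))
    (trans (*-identityˡ _) (sym (+-identityʳ _))))
  sumPick-replicate g (suc (suc N)) l = begin
    x + sumPick (λ l′ w′ → g l′ (l ∷ w′)) (List.replicate (suc N) l)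
      ≈⟨ +-congˡ (sumPick-replicate (λ l′ w′ → g l′ (l ∷ w′)) (suc N) l) ⟩
    x + fromℕ (suc N) * x       ≈⟨ +-congʳ (*-identityˡ x) ⟨
    1# * x + fromℕ (suc N) * x  ≈⟨ distribʳ _ _ _ ⟨
    fromℕ (suc (suc N)) * x     ∎
    where x = g l (List.replicate (suc N) l)

  -- Records that a letter really comes from the word, so that what holds for all letters of the
  -- word is available for the one taken out.
  data Pick (l : Letter n) : Word n → Word n → Set where
    here  : ∀ {w} → Pick l (l ∷ w) w
    there : ∀ {x w w′} → Pick l w w′ → Pick l (x ∷ w) (x ∷ w′)

  Pick-All : ∀ {P : Letter n → Set} {l w w′} → Pick l w w′ → All P w → P l × All P w′
  Pick-All here      (px ∷ pw) = px , pw
  Pick-All (there π) (px ∷ pw) = let pl , pw′ = Pick-All π pw in pl , px ∷ pw′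

  Pick-Any : ∀ {P : Letter n → Set} {l w w′} → Pick l w w′ → Any P w → P l ⊎ Any P w′
  Pick-Any here      (here px)  = inj₁ px
  Pick-Any here      (there pw) = inj₂ pw
  Pick-Any (there π) (here px)  = inj₂ (here px)
  Pick-Any (there π) (there pw) with Pick-Any π pw
  ... | inj₁ pl  = inj₁ pl
  ... | inj₂ pw′ = inj₂ (there pw′)

  sumPick-zero : ∀ {g : Letter n → Word n → Carrier} w →
                 (∀ {l w′} → Pick l w w′ → g l w′ ≈ 0#) → sumPick g w ≈ 0#
  sumPick-zero []      g≈0 = refl
  sumPick-zero (l ∷ w) g≈0 =
    trans (+-cong (g≈0 here) (sumPick-zero w λ π → g≈0 (there π))) (+-identityˡ _)

  coeff-var⊗ : ∀ w u v (p : Poly F n) → coeff w (var u v ⊗ p) ≈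
    sumPick (λ (a , b) w′ → ind (does (a ≟ᶠ u) ∧ does (b ≟ᶠ v)) * coeff w′ p) w
  coeff-var⊗ []            u v p = zeroˡ _
  coeff-var⊗ ((a , b) ∷ w) u v p = trans (coeff-⊕ w _ _)
    (+-cong (coeff-con⊗ w _ p) (coeff-var⊗ w u v (∂ F a b p)))

  -- Hence coeff w (A^ N s t), for a word of N letters, counts the orderings
  -- of w that are walks from s to t.
  coeff-A^suc : ∀ w N (s t : Fin n) → coeff w (A^ F (suc N) s t) ≈
    sumPick (λ (a , b) w′ → ind (does (a ≟ᶠ s)) * coeff w′ (A^ F N b t)) w
  coeff-A^suc {n} w N s t = begin
    coeff w (A^ F (suc N) s t)
      ≈⟨ trans (coeff-∑ᴾ w (List.allFin n) _) (∑-allFin λ l → coeff w (var s l ⊗ A^ F N l t)) ⟩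
    sum (λ l → coeff w (var s l ⊗ A^ F N l t))
      ≈⟨ sum-cong (λ l → coeff-var⊗ w s l _) ⟩
    sum (λ l → sumPick (λ (a , b) w′ → ind (does (a ≟ᶠ s) ∧ does (b ≟ᶠ l)) * coeff w′
      (A^ F N l t)) w)
      ≈⟨ sum-sumPick _ w ⟩
    sumPick (λ (a , b) w′ → sum (λ l → ind (does (a ≟ᶠ s) ∧ does (b ≟ᶠ l)) * coeff w′
      (A^ F N l t))) w
      ≈⟨ sumPick-cong w (λ (a , b) w′ → collapse a b w′) ⟩
    sumPick (λ (a , b) w′ → ind (does (a ≟ᶠ s)) * coeff w′ (A^ F N b t)) w ∎
    where
    collapse : ∀ a b w′ →
      sum (λ l → ind (does (a ≟ᶠ s) ∧ does (b ≟ᶠ l)) * coeff w′ (A^ F N l t)) ≈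
      ind (does (a ≟ᶠ s)) * coeff w′ (A^ F N b t)
    collapse a b w′ = begin
      sum (λ l → ind (does (a ≟ᶠ s) ∧ does (b ≟ᶠ l)) * coeff w′ (A^ F N l t))
        ≈⟨ sum-cong (λ l → trans (*-congʳ (ind-∧ (does (a ≟ᶠ s)) _)) (*-assoc _ _ _)) ⟩
      sum (λ l → ind (does (a ≟ᶠ s)) * (ind (does (b ≟ᶠ l)) * coeff w′ (A^ F N l t)))
        ≈⟨ sum-*ˡ (ind (does (a ≟ᶠ s))) _ ⟩
      ind (does (a ≟ᶠ s)) * sum (λ l → ind (does (b ≟ᶠ l)) * coeff w′ (A^ F N l t))
        ≈⟨ *-congˡ (sum-δ b _) ⟩
      ind (does (a ≟ᶠ s)) * coeff w′ (A^ F N b t) ∎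

  -- Any arc (a , b) of the word may open the closed walk; the remaining letters must then lead from
  -- b back to a.
  coeff-trA^suc : ∀ w N → coeff w (trA^ F n (suc N)) ≈
    sumPick (λ (a , b) w′ → coeff w′ (A^ F N b a)) w
  coeff-trA^suc {n} w N = begin
    coeff w (trA^ F n (suc N))
      ≈⟨ trans (coeff-∑ᴾ w (List.allFin n) _) (∑-allFin λ s → coeff w (A^ F (suc N) s s)) ⟩
    sum (λ s → coeff w (A^ F (suc N) s s))
      ≈⟨ sum-cong (λ s → coeff-A^suc w N s s) ⟩
    sum (λ s → sumPick (λ (a , b) w′ → ind (does (a ≟ᶠ s)) * coeff w′ (A^ F N b s)) w)
      ≈⟨ sum-sumPick _ w ⟩
    sumPick (λ (a , b) w′ → sum (λ s → ind (does (a ≟ᶠ s)) * coeff w′ (A^ F N b s))) w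
      ≈⟨ sumPick-cong w (λ (a , b) w′ → sum-δ a _) ⟩
    sumPick (λ (a , b) w′ → coeff w′ (A^ F N b a)) w ∎

  RowFree : Fin n → Word n → Set
  RowFree c = All λ (a , b) → a ≢ c

  -- A nonempty walk from c needs an arc leaving c, and the empty one ends at c.
  no-exit : ∀ N {c t : Fin n} {w} → RowFree c w → c ≢ t → coeff w (A^ F N c t) ≈ 0#
  no-exit zero    {w = []}    _    c≢t = ind-≢ c≢t
  no-exit zero    {w = l ∷ w} _    c≢t = coeff-con0 w
  no-exit (suc N) {c} {w = w} free c≢t = trans (coeff-A^suc w N _ _)
    (sumPick-zero w λ π → trans (*-congʳ (ind-≢ (proj₁ (Pick-All π free)))) (zeroˡ _))

  -- A walk that uses an arc into c is stuck there, so it can only end at c.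
  dead-end : ∀ N {c s t : Fin n} {w} → RowFree c w → Any (λ (a , b) → b ≡ c) w → c ≢ t →
             coeff w (A^ F N s t) ≈ 0#
  dead-end zero    {w = l ∷ w} free enter c≢t = coeff-con0 w
  dead-end (suc N) {c} {t = t} {w = w} free enter c≢t = trans (coeff-A^suc w N _ _)
    (sumPick-zero w λ {(a , b)} π → x≈0⇒y*x≈0 _ (rest π (Pick-Any π enter)))
    where
    rest : ∀ {a b w′} → Pick (a , b) w w′ → b ≡ c ⊎ Any (λ (a , b) → b ≡ c) w′ →
           coeff w′ (A^ F N b t) ≈ 0#
    rest π (inj₁ ≡.refl) = no-exit N (proj₂ (Pick-All π free)) c≢t
    rest π (inj₂ enter′) = dead-end N (proj₂ (Pick-All π free)) enter′ c≢t

  -- A closed walk leaves every vertex that it enters. This is the vanishing criterion behind the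
  -- trace formulas: an index outside the differentiated rows kills its term.
  dead-end-tr : ∀ N {c : Fin n} {w} → RowFree c w → Any (λ (a , b) → b ≡ c) w →
                coeff w (trA^ F n (suc N)) ≈ 0#
  dead-end-tr N {c} {w} free enter = trans (coeff-trA^suc w N)
    (sumPick-zero w λ π → rest π (Pick-Any π enter))
    where
    rest : ∀ {a b w′} → Pick (a , b) w w′ → b ≡ c ⊎ Any (λ (a , b) → b ≡ c) w′ →
           coeff w′ (A^ F N b a) ≈ 0#
    rest π with a≢c , free′ ← Pick-All π free = λ where
      (inj₁ ≡.refl) → no-exit N free′ (a≢c ∘ ≡.sym)
      (inj₂ enter′) → dead-end N free′ enter′ (a≢c ∘ ≡.sym)

  Loops : Word n → Set
  Loops = All λ (a , b) → a ≡ b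

  -- Loops never move the walk, so a loop away from the start cannot be used up.
  loops-elsewhere : ∀ N {s t : Fin n} {w} → Loops w → Any (λ (a , b) → a ≢ s) w →
                    coeff w (A^ F N s t) ≈ 0#
  loops-elsewhere zero    {w = l ∷ w} loops else = coeff-con0 w
  loops-elsewhere (suc N) {s} {t} {w} loops else = trans (coeff-A^suc w N s t)
    (sumPick-zero w rest)
    where
    rest : ∀ {l w′} → Pick l w w′ → ind (does (proj₁ l ≟ᶠ s)) * coeff w′ (A^ F N (proj₂ l) t) ≈ 0#
    rest {a , b} π with Pick-All π loops | Pick-Any π else
    ... | _              , _      | inj₁ a≢s   = trans (*-congʳ (ind-≢ a≢s)) (zeroˡ _)
    ... | ≡.refl , loops′ | inj₂ else′ with a ≟ᶠ s
    ...   | yes ≡.refl = x≈0⇒y*x≈0 _ (loops-elsewhere N loops′ else′)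
    ...   | no  a≢s    = zeroˡ _

  loops-tr : ∀ N {i j : Fin n} {w} → Loops w → i ≢ j →
             Any (λ (a , b) → a ≡ i) w → Any (λ (a , b) → a ≡ j) w →
             coeff w (trA^ F n (suc N)) ≈ 0#
  loops-tr {n} N {i} {j} {w} loops i≢j at-i at-j = trans (coeff-trA^suc w N)
    (sumPick-zero w rest)
    where
    elsewhere : ∀ {a b w′ k} → a ≢ k → Pick (a , b) w w′ → Any (λ (a , b) → a ≡ k) w →
                Any (λ (x , y) → x ≢ a) w′
    elsewhere a≢k π at-k with Pick-Any π at-k
    ... | inj₁ a≡k   = contradiction a≡k a≢k
    ... | inj₂ at-k′ = Any.map (λ x≡k x≡a → a≢k (≡.trans (≡.sym x≡a) x≡k)) at-k′

    rest : ∀ {l w′} → Pick l w w′ → coeff w′ (A^ F N (proj₂ l) (proj₁ l)) ≈ 0#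
    rest {a , b} π with ≡.refl , loops′ ← Pick-All π loops with a ≟ᶠ i
    ... | no a≢i     = loops-elsewhere N loops′ (elsewhere a≢i π at-i)
    ... | yes ≡.refl = loops-elsewhere N loops′ (elsewhere i≢j π at-j)

  -- All N! orderings of N equal loops are walks; equivalently, this is the N-th derivative of the
  -- one relevant monomial, a_ii^N.
  coeff-loop : ∀ N (i : Fin n) → coeff (List.replicate N (i , i)) (A^ F N i i) ≈ fromℕ (N !)
  coeff-loop zero    i = trans (ind-refl i) (sym (+-identityʳ 1#))
  coeff-loop (suc N) i = begin
    coeff (List.replicate (suc N) (i , i)) (A^ F (suc N) i i)
      ≈⟨ coeff-A^suc (List.replicate (suc N) (i , i)) N i i ⟩
    sumPick walks (List.replicate (suc N) (i , i))
      ≈⟨ sumPick-replicate walks (suc N) (i , i) ⟩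
    fromℕ (suc N) * (ind (does (i ≟ᶠ i)) * coeff (List.replicate N (i , i)) (A^ F N i i))
      ≈⟨ *-congˡ (trans (*-cong (ind-refl i) (coeff-loop N i)) (*-identityˡ _)) ⟩
    fromℕ (suc N) * fromℕ (N !)
      ≈⟨ ×1-homo-* (suc N) (N !) ⟨
    fromℕ (suc N !) ∎
    where
    walks : Letter _ → Word _ → Carrier
    walks (a , b) w′ = ind (does (a ≟ᶠ i)) * coeff w′ (A^ F N b i)

  coeff-loop-tr : ∀ N (i : Fin n) →
    coeff (List.replicate (suc N) (i , i)) (trA^ F n (suc N)) ≈ fromℕ (suc N !)
  coeff-loop-tr N i = begin
    coeff (List.replicate (suc N) (i , i)) (trA^ F _ (suc N))
      ≈⟨ coeff-trA^suc (List.replicate (suc N) (i , i)) N ⟩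
    sumPick walks (List.replicate (suc N) (i , i))
      ≈⟨ sumPick-replicate walks (suc N) (i , i) ⟩
    fromℕ (suc N) * coeff (List.replicate N (i , i)) (A^ F N i i)
      ≈⟨ *-congˡ (coeff-loop N i) ⟩
    fromℕ (suc N) * fromℕ (N !)
      ≈⟨ ×1-homo-* (suc N) (N !) ⟨
    fromℕ (suc N !) ∎
    where
    walks : Letter _ → Word _ → Carrier
    walks (a , b) w′ = coeff w′ (A^ F N b a)

-- Expansion of the trace operator in degrees one and two

module Operators {c ℓ₁ ℓ₂ ℓ₃} (F : OrderedField c ℓ₁ ℓ₂ ℓ₃) where

  open OrderedField F hiding (zero)
  open CommutativeRing commutativeRing using (semiring)
  open import Relation.Binary.Reasoning.Setoid setoid
  open Summation semiring
  open Traces F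

  private variable
    n r : ℕ

  1/!*! : ∀ N → 1/ N ! * fromℕ (N !) ≈ 1#
  1/!*! N = trans (*-congˡ (sym x-0≈x)) (proj₁
    (proj₂ (#⇒invertible (#-sym (<⇒# (0<fromℕ (N !) {{N ℕ.!≢0}}))))))
    where
    x-0≈x : fromℕ (N !) - 0# ≈ fromℕ (N !)
    x-0≈x = begin
      fromℕ (N !) - 0#       ≈⟨ +-congˡ (+-identityˡ _) ⟨
      fromℕ (N !) + (0# - 0#) ≈⟨ +-congˡ (-‿inverseʳ 0#) ⟩
      fromℕ (N !) + 0#       ≈⟨ +-identityʳ _ ⟩
      fromℕ (N !) ∎

  1/0! : 1/ 0 ! ≈ 1#
  1/0! = trans (sym (*-identityʳ _)) (trans (*-congˡ (sym (+-identityʳ 1#))) (1/!*! 0))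

  -- The letters enter in reverse order, since `∂ʷ` applies the last index first and `coeff` reads
  -- the head of a word first.
  push : Fin n → Vec (Fin n) r → Word n → Word n
  push i []      w = w
  push i (j ∷ γ) w = push i γ ((i , j) ∷ w)

  coeff-∂ʷ : ∀ i (γ : Vec (Fin n) r) w (p : Poly F n) →
             coeff w (∂ʷ F i γ p) ≡ coeff (push i γ w) p
  coeff-∂ʷ i []      w p = ≡.refl
  coeff-∂ʷ i (j ∷ γ) w p = coeff-∂ʷ i γ ((i , j) ∷ w) p

  compositions₀ : ∀ m → compositions m 0 ≡ Vec.replicate m 0 ∷ []
  compositions₀ zero    = ≡.refl
  compositions₀ (suc m) rewrite compositions₀ m = ≡.refl

  ∑-compositions₀ : ∀ m (f : Vec ℕ m → Carrier) → ∑ F (compositions m 0) f ≈ f (Vec.replicate m 0)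
  ∑-compositions₀ m f rewrite compositions₀ m = +-identityʳ _

  ∑-compositions₁ : ∀ m (f : Vec ℕ (suc m) → Carrier) → ∑ F (compositions (suc m) 1) f ≈
    f (1 ∷ Vec.replicate m 0) + ∑ F (compositions m 1) (λ ds → f (0 ∷ ds))
  ∑-compositions₁ m f = begin
    ∑ F (compositions (suc m) 1) f
      ≈⟨ ∑-++ (List.map (0 ∷_) (compositions m 1)) _ f ⟩
    ∑ F (List.map (0 ∷_) (compositions m 1)) f + ∑ F
      (List.map (1 ∷_) (compositions m 0) List.++ []) f
      ≈⟨ +-cong (∑-map (0 ∷_) (compositions m 1) f)
        (trans (∑-++ (List.map (1 ∷_) (compositions m 0)) [] f)
           (trans (+-identityʳ _) (trans (∑-map (1 ∷_) (compositions m 0) f)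
             (∑-compositions₀ m _)))) ⟩
    ∑ F (compositions m 1) (λ ds → f (0 ∷ ds)) + f (1 ∷ Vec.replicate m 0)
      ≈⟨ +-comm _ _ ⟩
    f (1 ∷ Vec.replicate m 0) + ∑ F (compositions m 1) (λ ds → f (0 ∷ ds)) ∎

  -- Sorted by the first exponent: 2 leaves only zeros, 1 leaves one further row to choose, 0 leaves
  -- the same problem on the other rows.
  ∑-compositions₂ : ∀ m (f : Vec ℕ (suc m) → Carrier) → ∑ F (compositions (suc m) 2) f ≈
    f (2 ∷ Vec.replicate m 0) +
    (∑ F (compositions m 1) (λ ds → f (1 ∷ ds)) + ∑ F (compositions m 2) (λ ds → f (0 ∷ ds)))
  ∑-compositions₂ m f = begin
    ∑ F (compositions (suc m) 2) f
      ≈⟨ trans (∑-++ (List.map (0 ∷_) (compositions m 2)) _ f) (+-congˡ (trans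
           (∑-++ (List.map (1 ∷_) (compositions m 1)) _ f)
             (+-congˡ (∑-++ (List.map (2 ∷_) (compositions m 0)) [] f)))) ⟩
    ∑ F (List.map (0 ∷_) (compositions m 2)) f +
    (∑ F (List.map (1 ∷_) (compositions m 1)) f + (∑ F (List.map (2 ∷_) (compositions m 0)) f + 0#))
      ≈⟨ +-cong (∑-map (0 ∷_) (compositions m 2) f) (+-cong (∑-map (1 ∷_) (compositions m 1) f)
           (trans (+-identityʳ _) (trans (∑-map (2 ∷_) (compositions m 0) f)
             (∑-compositions₀ m _)))) ⟩
    ∑ F (compositions m 2) (λ ds → f (0 ∷ ds)) +
    (∑ F (compositions m 1) (λ ds → f (1 ∷ ds)) + f (2 ∷ Vec.replicate m 0))
      ≈⟨ +-congˡ (+-comm _ _) ⟩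
    ∑ F (compositions m 2) (λ ds → f (0 ∷ ds)) +
    (f (2 ∷ Vec.replicate m 0) + ∑ F (compositions m 1) (λ ds → f (1 ∷ ds)))
      ≈⟨ trans (sym (+-assoc _ _ _)) (trans (+-congʳ (+-comm _ _))
        (trans (+-assoc _ _ _) (+-congˡ (+-comm _ _)))) ⟩
    f (2 ∷ Vec.replicate m 0) +
    (∑ F (compositions m 1) (λ ds → f (1 ∷ ds)) + ∑ F (compositions m 2) (λ ds → f (0 ∷ ds))) ∎

  module _ (T : Tensor F r n) where

    coeff-row : ∀ i w (p : Poly F n) → coeff w (rowOperator F T i p) ≈
                ∑ F (words n r) (λ γ → T i γ * coeff (push i γ w) p)
    coeff-row i w p = trans (coeff-∑ᴾ w (words n r) _) (∑-cong (words n r) λ γ →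
      trans (coeff-con⊗ w _ _) (*-congˡ (reflexive (coeff-∂ʷ i γ w p))))

    op : Fin n → ℕ → Poly F n → Poly F n
    op i d q = con (1/ (d ℕ.* r) !) ⊗ fold q (rowOperator F T i) d

    coeff-op : ∀ i d w q → coeff w (op i d q) ≈
               1/ (d ℕ.* r) ! * coeff w (fold q (rowOperator F T i) d)
    coeff-op i d w q = coeff-con⊗ w _ _

    -- A row with exponent zero still multiplies by 1/0!, so untouched rows disappear only up to
    -- `≈ᴾ`; `op-cong` carries this equality through the outer rows.
    op-0 : ∀ i q → op i 0 q ≈ᴾ q
    op-0 i q w = trans (coeff-op i 0 w q) (trans (*-congʳ 1/0!) (*-identityˡ _))

    row-cong : ∀ i {p q} → p ≈ᴾ q → rowOperator F T i p ≈ᴾ rowOperator F T i q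
    row-cong i {p} {q} p≈q w = trans (coeff-row i w p) (trans
      (∑-cong (words n r) λ γ → *-congˡ (p≈q (push i γ w))) (sym (coeff-row i w q)))

    op-cong : ∀ i d {p q} → p ≈ᴾ q → op i d p ≈ᴾ op i d q
    op-cong i d {p} {q} p≈q w = trans (coeff-op i d w p)
      (trans (*-congˡ (fold-cong d w)) (sym (coeff-op i d w q)))
      where
      fold-cong : ∀ d → fold p (rowOperator F T i) d ≈ᴾ fold q (rowOperator F T i) d
      fold-cong zero    = p≈q
      fold-cong (suc d) = row-cong i (fold-cong d)

    op-con0 : ∀ i → op i 1 (con 0#) ≈ᴾ con 0#
    op-con0 i w = trans (coeff-op i 1 w _) (trans (*-congˡ (trans (coeff-row i w _)
      (∑-zero (words n r) λ γ → x≈0⇒y*x≈0 _ (coeff-con0 (push i γ w)))))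
        (trans (zeroʳ _) (sym (coeff-con0 w))))

    op-⊕ : ∀ i p q → op i 1 (p ⊕ q) ≈ᴾ (op i 1 p ⊕ op i 1 q)
    op-⊕ i p q w = begin
      coeff w (op i 1 (p ⊕ q))
        ≈⟨ trans (coeff-op i 1 w _) (*-congˡ (coeff-row i w _)) ⟩
      x * ∑ F (words n r) (λ γ → T i γ * coeff (push i γ w) (p ⊕ q))
        ≈⟨ *-congˡ (∑-cong (words n r) λ γ → trans (*-congˡ (coeff-⊕ (push i γ w) p q))
          (distribˡ _ _ _)) ⟩
      x * ∑ F (words n r) (λ γ → T i γ * coeff (push i γ w) p + T i γ * coeff (push i γ w) q)
        ≈⟨ trans (*-congˡ (∑-+ (words n r) _ _)) (distribˡ _ _ _) ⟩
      x * ∑ F (words n r) (λ γ → T i γ * coeff (push i γ w) p) +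
      x * ∑ F (words n r) (λ γ → T i γ * coeff (push i γ w) q)
        ≈⟨ +-cong (trans (coeff-op i 1 w _) (*-congˡ (coeff-row i w _)))
          (trans (coeff-op i 1 w _) (*-congˡ (coeff-row i w _))) ⟨
      coeff w (op i 1 p) + coeff w (op i 1 q)
        ≈⟨ coeff-⊕ w _ _ ⟨
      coeff w (op i 1 p ⊕ op i 1 q) ∎
      where x = 1/ (1 ℕ.* r) !

    op-∑ᴾ : ∀ {A : Set} i (xs : List A) f → op i 1 (∑ᴾ F xs f) ≈ᴾ ∑ᴾ F xs (λ x → op i 1 (f x))
    op-∑ᴾ i []       f w = op-con0 i w
    op-∑ᴾ i (x ∷ xs) f w = trans (op-⊕ i _ _ w)
      (trans (coeff-⊕ w _ _) (trans (+-congˡ (op-∑ᴾ i xs f w)) (sym (coeff-⊕ w _ _))))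

    -- The trace operator, acting on the rows f 0, f 1, … only.
    ops : ∀ {m} → (Fin m → Fin n) → Vec ℕ m → Poly F n → Poly F n
    ops f []       p = p
    ops f (d ∷ ds) p = op (f zero) d (ops (f ∘ suc) ds p)

    traceOperator≡ops : ∀ ds p → traceOperator F T ds p ≡ ops id ds p
    traceOperator≡ops ds p = ≡.trans (rows id)
      (≡.cong (λ ds → ops id ds p) (Vec.tabulate∘lookup ds))
      where
      rows : ∀ {m} (f : Fin m → Fin n) →
        List.foldr (λ i → op i (Vec.lookup ds i)) p (List.tabulate f) ≡
        ops f (Vec.tabulate (Vec.lookup ds ∘ f)) p
      rows {zero}  f = ≡.refl
      rows {suc m} f = ≡.cong (op (f zero) (Vec.lookup ds (f zero))) (rows (f ∘ suc))

    ops₀ : ∀ {m} (f : Fin m → Fin n) p → ops f (Vec.replicate m 0) p ≈ᴾ p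
    ops₀ {zero}  f p w = refl
    ops₀ {suc m} f p w = trans (op-0 (f zero) _ w) (ops₀ (f ∘ suc) p w)

    ∑-ops₁ : ∀ {m} (f : Fin m → Fin n) p w →
      ∑ F (compositions m 1) (λ ds → coeff w (ops f ds p)) ≈ sum (λ i → coeff w (op (f i) 1 p))
    ∑-ops₁ {zero}  f p w = reflexive (≡.sym (sum-empty _))
    ∑-ops₁ {suc m} f p w = begin
      ∑ F (compositions (suc m) 1) (λ ds → coeff w (ops f ds p))
        ≈⟨ ∑-compositions₁ m _ ⟩
      coeff w (op (f zero) 1 (ops (f ∘ suc) (Vec.replicate m 0) p)) +
      ∑ F (compositions m 1) (λ ds → coeff w (op (f zero) 0 (ops (f ∘ suc) ds p)))
        ≈⟨ +-cong (op-cong (f zero) 1 (ops₀ (f ∘ suc) p) w)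
             (trans (∑-cong (compositions m 1) λ ds → op-0 (f zero) _ w) (∑-ops₁ (f ∘ suc) p w)) ⟩
      coeff w (op (f zero) 1 p) + sum (λ i → coeff w (op (f (suc i)) 1 p))
        ≡⟨ sum-suc _ ⟨
      sum (λ i → coeff w (op (f i) 1 p)) ∎

    -- Degree two is spent either twice on one row or once on each of two rows; exponent 1 in the
    -- first row contributes its pairs with all later rows.
    ∑-ops₂ : ∀ {m} (f : Fin m → Fin n) p w →
      ∑ F (compositions m 2) (λ ds → coeff w (ops f ds p)) ≈
      sum (λ i → coeff w (op (f i) 2 p)) +
      pairs (λ i j → coeff w (op (f i) 1 (op (f j) 1 p)))
    ∑-ops₂ {zero}  f p w = sym (trans (+-cong (reflexive (sum-empty _))
      (reflexive (pairs-empty _))) (+-identityʳ _))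
    ∑-ops₂ {suc m} f p w = begin
      ∑ F (compositions (suc m) 2) (λ ds → coeff w (ops f ds p))
        ≈⟨ ∑-compositions₂ m _ ⟩
      coeff w (op (f zero) 2 (ops (f ∘ suc) (Vec.replicate m 0) p)) +
      (∑ F (compositions m 1) (λ ds → coeff w (op (f zero) 1 (ops (f ∘ suc) ds p))) +
       ∑ F (compositions m 2) (λ ds → coeff w (op (f zero) 0 (ops (f ∘ suc) ds p))))
        ≈⟨ +-cong (op-cong (f zero) 2 (ops₀ (f ∘ suc) p) w) (+-cong one
             (trans (∑-cong (compositions m 2) λ ds → op-0 (f zero) _ w) (∑-ops₂ (f ∘ suc) p w))) ⟩
      a + (b + (c′ + d))
        ≈⟨ trans (+-congˡ (trans (sym (+-assoc _ _ _))
          (trans (+-congʳ (+-comm b c′)) (+-assoc _ _ _)))) (sym (+-assoc _ _ _)) ⟩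
      (a + c′) + (b + d)
        ≡⟨ ≡.cong₂ _+_ (sum-suc (λ i → coeff w (op (f i) 2 p)))
             (pairs-suc (λ i j → coeff w (op (f i) 1 (op (f j) 1 p)))) ⟨
      sum (λ i → coeff w (op (f i) 2 p)) +
      pairs (λ i j → coeff w (op (f i) 1 (op (f j) 1 p))) ∎
      where
      a  = coeff w (op (f zero) 2 p)
      b  = sum (λ j → coeff w (op (f zero) 1 (op (f (suc j)) 1 p)))
      c′ = sum (λ i → coeff w (op (f (suc i)) 2 p))
      d  = pairs (λ i j → coeff w (op (f (suc i)) 1 (op (f (suc j)) 1 p)))

      -- The operator of the first row acts outside the sum over the later ones, so the degree-one
      -- expansion is needed as an equality of polynomials and not only of scalars.
      gather : ∑ᴾ F (compositions m 1) (λ ds → ops (f ∘ suc) ds p) ≈ᴾ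
               ∑ᴾ F (List.allFin m) (λ j → op (f (suc j)) 1 p)
      gather w = trans (coeff-∑ᴾ w (compositions m 1) _) (trans (∑-ops₁ (f ∘ suc) p w)
        (sym (trans (coeff-∑ᴾ w (List.allFin m) _) (∑-allFin λ j → coeff w (op (f (suc j)) 1 p)))))

      one : ∑ F (compositions m 1) (λ ds → coeff w (op (f zero) 1 (ops (f ∘ suc) ds p))) ≈ b
      one = begin
        ∑ F (compositions m 1) (λ ds → coeff w (op (f zero) 1 (ops (f ∘ suc) ds p)))
          ≈⟨ coeff-∑ᴾ w (compositions m 1) _ ⟨
        coeff w (∑ᴾ F (compositions m 1) (λ ds → op (f zero) 1 (ops (f ∘ suc) ds p)))
          ≈⟨ op-∑ᴾ (f zero) (compositions m 1) _ w ⟨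
        coeff w (op (f zero) 1 (∑ᴾ F (compositions m 1) (λ ds → ops (f ∘ suc) ds p)))
          ≈⟨ op-cong (f zero) 1 gather w ⟩
        coeff w (op (f zero) 1 (∑ᴾ F (List.allFin m) (λ j → op (f (suc j)) 1 p)))
          ≈⟨ op-∑ᴾ (f zero) (List.allFin m) _ w ⟩
        coeff w (∑ᴾ F (List.allFin m) (λ j → op (f zero) 1 (op (f (suc j)) 1 p)))
          ≈⟨ coeff-∑ᴾ w (List.allFin m) _ ⟩
        ∑ F (List.allFin m) (λ j → coeff w (op (f zero) 1 (op (f (suc j)) 1 p)))
          ≈⟨ ∑-allFin (λ j → coeff w (op (f zero) 1 (op (f (suc j)) 1 p))) ⟩
        b ∎

  Tr₁-ops : (T : Tensor F r n) → Tr F 1 T ≈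
            fromℕ (r ^ (n ∸ 1)) * sum (λ i → coeff [] (op T i 1 (trA^ F n (1 ℕ.* r))))
  Tr₁-ops {r} {n} T = *-congˡ (trans
    (∑-cong (compositions n 1) λ ds → reflexive
      (≡.cong (constantTerm F) (traceOperator≡ops T ds _)))
    (∑-ops₁ T id _ []))

  Tr₂-ops : (T : Tensor F r n) → Tr F 2 T ≈ fromℕ (r ^ (n ∸ 1)) *
            (sum (λ i → coeff [] (op T i 2 (trA^ F n (2 ℕ.* r)))) +
             pairs (λ i j → coeff [] (op T i 1 (op T j 1 (trA^ F n (2 ℕ.* r))))))
  Tr₂-ops {r} {n} T = *-congˡ (trans
    (∑-cong (compositions n 2) λ ds → reflexive
      (≡.cong (constantTerm F) (traceOperator≡ops T ds _)))
    (∑-ops₂ T id _ []))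

-- Traces of orders one and two of a general tensor

module TraceFormulas {c ℓ₁ ℓ₂ ℓ₃} (F : OrderedField c ℓ₁ ℓ₂ ℓ₃) where

  open OrderedField F hiding (zero)
  open CommutativeRing commutativeRing using (semiring)
  open import Relation.Binary.Reasoning.Setoid setoid
  open import Algebra.Properties.CommutativeSemigroup
    (CommutativeRing.*-commutativeSemigroup commutativeRing) using (x∙yz≈y∙xz)
  open Summation semiring
  open Traces F
  open Operators F

  private variable
    n r : ℕ

  push-All : ∀ {P : Letter n → Set} {i w} (γ : Vec (Fin n) r) →
             (∀ j → P (i , j)) → All P w → All P (push i γ w)
  push-All []      Pi Pw = Pw
  push-All (j ∷ γ) Pi Pw = push-All γ Pi (Pi j ∷ Pw)

  push-Any : ∀ {P : Letter n → Set} {i w} (γ : Vec (Fin n) r) → Any P w → Any P (push i γ w)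
  push-Any []      Pw = Pw
  push-Any (j ∷ γ) Pw = push-Any γ (there Pw)

  push-new : ∀ {P : Letter n → Set} {i w} {γ : Vec (Fin n) r} →
             VAny.Any (λ j → P (i , j)) γ → Any P (push i γ w)
  push-new {γ = j ∷ γ} (VAny.here p)  = push-Any γ (here p)
  push-new {γ = j ∷ γ} (VAny.there p) = push-new p

  push-replicate : ∀ r N (i : Fin n) → push i (Vec.replicate r i) (List.replicate N (i , i)) ≡
                   List.replicate (r ℕ.+ N) (i , i)
  push-replicate zero    N i = ≡.refl
  push-replicate (suc r) N i = ≡.trans (push-replicate r (suc N) i)
    (≡.cong (λ N → List.replicate N (i , i)) (ℕ.+-suc r N))

  -- The vertex c found here is the dead end to be fed into `dead-end-tr`.
  ≢replicate : ∀ (i : Fin n) (γ : Vec (Fin n) r) → γ ≢ Vec.replicate r i →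
               ∃[ c ] (c ≢ i × VAny.Any (_≡ c) γ)
  ≢replicate i []      γ≢ = contradiction ≡.refl γ≢
  ≢replicate i (j ∷ γ) γ≢ with j ≟ᶠ i
  ... | no  j≢i    = j , j≢i , VAny.here ≡.refl
  ... | yes ≡.refl = let c , c≢i , at = ≢replicate i γ (γ≢ ∘ ≡.cong (i ∷_)) in c , c≢i ,
                           VAny.there at

  Among : Fin n → Fin n → Vec (Fin n) r → Set
  Among i j = VAll.All (λ c → c ≡ i ⊎ c ≡ j)

  among? : ∀ (i j : Fin n) (γ : Vec (Fin n) r) →
           Among i j γ ⊎ ∃[ c ] (c ≢ i × c ≢ j × VAny.Any (_≡ c) γ)
  among? i j []      = inj₁ VAll.[]
  among? i j (c ∷ γ) with c ≟ᶠ i | c ≟ᶠ j | among? i j γ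
  ... | no c≢i  | no c≢j  | _ = inj₂ (c , c≢i , c≢j , VAny.here ≡.refl)
  ... | _       | _       | inj₂ (d , d≢i , d≢j , at) = inj₂ (d , d≢i , d≢j , VAny.there at)
  ... | yes c≡i | _       | inj₁ all = inj₁ (inj₁ c≡i VAll.∷ all)
  ... | no _    | yes c≡j | inj₁ all = inj₁ (inj₂ c≡j VAll.∷ all)

  module _ (T : Tensor F (suc r) n) where

    row-dead : ∀ N {c i w} → RowFree c w → c ≢ i → Any (λ (a , b) → b ≡ c) w →
               coeff w (rowOperator F T i (trA^ F n (suc N))) ≈ 0#
    row-dead N {c} {i} {w} free c≢i enter = trans (coeff-row T i w _)
      (∑-zero (words n (suc r)) λ γ →
      x≈0⇒y*x≈0 _ (dead-end-tr N (push-All γ (λ _ → c≢i ∘ ≡.sym) free) (push-Any γ enter)))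

    -- All letters leave i, so an index c other than i would be entered and never left; only the
    -- constant index word contributes.
    row-loop : ∀ N {i w} → All (λ (a , b) → a ≡ i) w →
      coeff w (rowOperator F T i (trA^ F n (suc N))) ≈
      T i (Vec.replicate (suc r) i) * coeff (push i (Vec.replicate (suc r) i) w) (trA^ F n (suc N))
    row-loop N {i} {w} rows = trans (coeff-row T i w _)
      (∑-words-single (Vec.replicate (suc r) i)
        (λ γ → T i γ * coeff (push i γ w) (trA^ F n (suc N))) λ γ γ≢ →
      let c , c≢i , at = ≢replicate i γ γ≢ in
      x≈0⇒y*x≈0 _ (dead-end-tr N
        (push-All γ (λ _ → c≢i ∘ ≡.sym) (All.map (λ a≡i a≡c → c≢i (≡.trans (≡.sym a≡c) a≡i)) rows))
        (push-new at)))

    -- The (k-1)! orderings of the loops at i cancel the factorial of the trace operator.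
    trace₁-term : ∀ i → coeff [] (op T i 1 (trA^ F n (1 ℕ.* suc r))) ≈ T i (Vec.replicate (suc r) i)
    trace₁-term i = begin
      coeff [] (op T i 1 (trA^ F n (1 ℕ.* suc r)))
        ≈⟨ trans (coeff-op T i 1 [] _) (*-congˡ (row-loop (r ℕ.+ 0) [])) ⟩
      1/ (1 ℕ.* suc r) ! * (t * coeff (push i (Vec.replicate (suc r) i) [])
        (trA^ F n (1 ℕ.* suc r)))
        ≈⟨ *-congˡ (*-congˡ (trans (reflexive
          (≡.cong (λ w → coeff w _) (push-replicate (suc r) 0 i)))
             (coeff-loop-tr (r ℕ.+ 0) i))) ⟩
      1/ (1 ℕ.* suc r) ! * (t * fromℕ ((1 ℕ.* suc r) !))
        ≈⟨ trans (x∙yz≈y∙xz _ _ _) (trans (*-congˡ (1/!*! (1 ℕ.* suc r))) (*-identityʳ _)) ⟩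
      t ∎
      where t = T i (Vec.replicate (suc r) i)

    -- An index other than i in either application is a dead end, since both write into row i. The
    -- surviving 2(k-1) loops have (2(k-1))! orderings, which the factorial in `op` cancels.
    trace₂-term : ∀ i → coeff [] (op T i 2 (trA^ F n (2 ℕ.* suc r))) ≈
                  T i (Vec.replicate (suc r) i) * T i (Vec.replicate (suc r) i)
    trace₂-term i = begin
      coeff [] (op T i 2 p)
        ≈⟨ trans (coeff-op T i 2 [] _) (*-congˡ (trans (coeff-row T i [] _)
             (∑-words-single i^r (λ γ → T i γ * coeff (push i γ []) (rowOperator F T i p)) λ γ γ≢ →
             let c , c≢i , at = ≢replicate i γ γ≢ in
             x≈0⇒y*x≈0 _ (row-dead N (push-All γ (λ _ → c≢i ∘ ≡.sym) []) c≢i (push-new at))))) ⟩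
      1/ (2 ℕ.* suc r) ! * (t * coeff (push i i^r []) (rowOperator F T i p))
        ≈⟨ *-congˡ (*-congˡ (row-loop N (push-All i^r (λ _ → ≡.refl) []))) ⟩
      1/ (2 ℕ.* suc r) ! * (t * (t * coeff (push i i^r (push i i^r [])) p))
        ≈⟨ *-congˡ (*-congˡ (*-congˡ (trans (reflexive (≡.cong (λ w → coeff w p)
             (≡.trans (≡.cong (push i i^r) (push-replicate (suc r) 0 i))
               (push-replicate (suc r) (suc r ℕ.+ 0) i))))
             (coeff-loop-tr N i)))) ⟩
      1/ (2 ℕ.* suc r) ! * (t * (t * fromℕ ((2 ℕ.* suc r) !)))
        ≈⟨ *-congˡ (*-assoc _ _ _) ⟨
      1/ (2 ℕ.* suc r) ! * ((t * t) * fromℕ ((2 ℕ.* suc r) !))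
        ≈⟨ trans (x∙yz≈y∙xz _ _ _) (trans (*-congˡ (1/!*! (2 ℕ.* suc r))) (*-identityʳ _)) ⟩
      t * t ∎
      where
      i^r = Vec.replicate (suc r) i
      t = T i i^r
      N = r ℕ.+ (suc r ℕ.+ 0)
      p = trA^ F n (2 ℕ.* suc r)

    cross-term : ∀ i j p → coeff [] (op T i 1 (op T j 1 p)) ≈
      1/ (1 ℕ.* suc r) ! * ∑ F (words n (suc r)) (λ γ → T i γ *
      (1/ (1 ℕ.* suc r) ! * ∑ F (words n (suc r)) (λ δ → T j δ *
      coeff (push j δ (push i γ [])) p)))
    cross-term i j p = trans (coeff-op T i 1 [] _) (*-congˡ (trans (coeff-row T i [] _)
      (∑-cong (words n (suc r)) λ γ → *-congˡ (trans (coeff-op T j 1 (push i γ []) _)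
        (*-congˡ (coeff-row T j (push i γ []) p))))))

    -- This is what k ≥ 3 provides: indices confined to two vertices cannot fill a hyperedge, so
    -- only diagonal entries remain.
    Sparse : Set ℓ₁
    Sparse = ∀ {i j γ} → Among i j γ → γ ≢ Vec.replicate (suc r) i → T i γ ≈ 0#

    -- With rows i and j only, any third vertex is a dead end. Index words inside the pair are
    -- reduced by sparsity to diagonal entries, hence to loops at two different vertices, which no
    -- closed walk joins.
    cross-zero : Sparse → ∀ {i j} → i ≢ j →
                 coeff [] (op T i 1 (op T j 1 (trA^ F n (2 ℕ.* suc r)))) ≈ 0#
    cross-zero sparse {i} {j} i≢j = trans (cross-term i j _)
      (x≈0⇒y*x≈0 _ (∑-zero (words n (suc r)) λ γ → at-γ γ))
      where
      N = r ℕ.+ (suc r ℕ.+ 0)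
      p = trA^ F n (2 ℕ.* suc r)

      rows : ∀ {c} γ δ → c ≢ i → c ≢ j → RowFree c (push j δ (push i γ []))
      rows γ δ c≢i c≢j = push-All δ (λ _ → c≢j ∘ ≡.sym) (push-All γ (λ _ → c≢i ∘ ≡.sym) [])

      at-δ : ∀ γ → T i γ ≈ 0# ⊎ (∀ δ → T j δ * coeff (push j δ (push i γ [])) p ≈ 0#)
      at-δ γ with among? i j γ
      ... | inj₂ (c , c≢i , c≢j , at) = inj₂ λ δ →
            x≈0⇒y*x≈0 _ (dead-end-tr N (rows γ δ c≢i c≢j) (push-Any δ (push-new at)))
      ... | inj₁ amongγ with Vec.≡-dec _≟ᶠ_ γ (Vec.replicate (suc r) i)
      ...   | no  γ≢     = inj₁ (sparse amongγ γ≢)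
      ...   | yes ≡.refl = inj₂ λ δ → rest δ
        where
        rest : ∀ δ → T j δ * coeff (push j δ (push i (Vec.replicate (suc r) i) [])) p ≈ 0#
        rest δ with among? j i δ
        ... | inj₂ (c , c≢j , c≢i , at) =
              x≈0⇒y*x≈0 _ (dead-end-tr N (rows (Vec.replicate (suc r) i) δ c≢i c≢j) (push-new at))
        ... | inj₁ amongδ with Vec.≡-dec _≟ᶠ_ δ (Vec.replicate (suc r) j)
        ...   | no  δ≢     = trans (*-congʳ (sparse amongδ δ≢)) (zeroˡ _)
        ...   | yes ≡.refl = x≈0⇒y*x≈0 _ (loops-tr N {i} {j}
                  (push-loops (suc r) j (push-loops (suc r) i [])) i≢j
                  (push-Any (Vec.replicate (suc r) j)
                    (push-new {γ = Vec.replicate (suc r) i} (VAny.here ≡.refl)))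
                  (push-new {γ = Vec.replicate (suc r) j} (VAny.here ≡.refl)))
          where
          push-loops : ∀ s (i : Fin n) {w} → Loops w → Loops (push {r = s} i (Vec.replicate s i) w)
          push-loops zero    i loops = loops
          push-loops (suc s) i loops = push-loops s i (≡.refl ∷ loops)

      at-γ : ∀ γ → T i γ * (1/ (1 ℕ.* suc r) ! * ∑ F (words n (suc r)) (λ δ → T j δ *
             coeff (push j δ (push i γ [])) p)) ≈ 0#
      at-γ γ with at-δ γ
      ... | inj₁ Tγ≈0 = trans (*-congʳ Tγ≈0) (zeroˡ _)
      ... | inj₂ δ≈0  = x≈0⇒y*x≈0 _ (x≈0⇒y*x≈0 _ (∑-zero (words n (suc r)) δ≈0))

  1/1! : 1/ 1 ! ≈ 1#
  1/1! = trans (sym (*-identityʳ _)) (trans (*-congˡ (sym (+-identityʳ 1#))) (1/!*! 1))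

  coeff-A^1 : ∀ (a b s t : Fin n) → coeff ((a , b) ∷ []) (A^ F 1 s t) ≈
              ind (does (a ≟ᶠ s)) * ind (does (b ≟ᶠ t))
  coeff-A^1 a b s t = trans (coeff-A^suc ((a , b) ∷ []) 0 s t) (+-identityʳ _)

  -- A walk of length two may start with either of the two arcs, hence two summands.
  coeff-tr2 : ∀ (a b c d : Fin n) → coeff ((a , b) ∷ (c , d) ∷ []) (trA^ F n 2) ≈
              ind (does (c ≟ᶠ b)) * ind (does (d ≟ᶠ a)) + ind (does (a ≟ᶠ d)) * ind (does (b ≟ᶠ c))
  coeff-tr2 a b c d = trans (coeff-trA^suc ((a , b) ∷ (c , d) ∷ []) 1)
    (+-cong (coeff-A^1 c d b a) (trans (+-identityʳ _) (coeff-A^1 a b d c)))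

  -- One arc leaving i and one leaving j close up only as i → j → i; the two possible starting
  -- points give the factor 2.
  cross-term-2 : ∀ (T : Tensor F 1 n) i j →
    coeff [] (op T i 1 (op T j 1 (trA^ F n 2))) ≈
    T i (j ∷ []) * (T j (i ∷ []) * fromℕ 2)
  cross-term-2 {n} T i j = begin
    coeff [] (op T i 1 (op T j 1 (trA^ F n 2)))
      ≈⟨ cross-term T i j _ ⟩
    1/ 1 ! * ∑ F (words n 1) (λ γ → T i γ * (1/ 1 ! * ∑ F (words n 1) (λ δ → T j δ *
      coeff (push j δ (push i γ [])) (trA^ F n 2))))
      ≈⟨ trans (*-congʳ 1/1!) (*-identityˡ _) ⟩
    ∑ F (words n 1) (λ γ → T i γ * (1/ 1 ! * ∑ F (words n 1) (λ δ → T j δ *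
      coeff (push j δ (push i γ [])) (trA^ F n 2))))
      ≈⟨ ∑-words-single (j ∷ []) _ (λ { (g ∷ []) γ≢ → x≈0⇒y*x≈0 _ (x≈0⇒y*x≈0 _
           (∑-zero (words n 1) λ { (d ∷ []) → x≈0⇒y*x≈0 _ (trans (coeff-tr2 j d i g)
             (vanish (x≈0⇒y*x≈0 _ (ind-≢ {i = g} {j} λ { ≡.refl → γ≢ ≡.refl }))
                     (trans (*-congʳ (ind-≢ {i = j} {g} λ { ≡.refl → γ≢ ≡.refl })) (zeroˡ _))))
                       })) }) ⟩
    T i (j ∷ []) * (1/ 1 ! * ∑ F (words n 1) (λ δ → T j δ *
      coeff (push j δ ((i , j) ∷ [])) (trA^ F n 2)))
      ≈⟨ *-congˡ (trans (*-congʳ 1/1!) (*-identityˡ _)) ⟩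
    T i (j ∷ []) * ∑ F (words n 1) (λ δ → T j δ * coeff (push j δ ((i , j) ∷ [])) (trA^ F n 2))
      ≈⟨ *-congˡ (∑-words-single (i ∷ []) _ λ { (d ∷ []) δ≢ → x≈0⇒y*x≈0 _ (trans (coeff-tr2 j d i j)
           (vanish (trans (*-congʳ (ind-≢ {i = i} {d} λ { ≡.refl → δ≢ ≡.refl })) (zeroˡ _))
                   (x≈0⇒y*x≈0 _ (ind-≢ {i = d} {i} λ { ≡.refl → δ≢ ≡.refl })))) }) ⟩
    T i (j ∷ []) * (T j (i ∷ []) * coeff ((j , i) ∷ (i , j) ∷ []) (trA^ F n 2))
      ≈⟨ *-congˡ (*-congˡ (trans (coeff-tr2 j i i j) (+-cong
           (trans (*-cong (ind-refl i) (ind-refl j)) (*-identityˡ _))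
           (trans (*-cong (ind-refl j) (ind-refl i))
             (trans (*-identityˡ _) (sym (+-identityʳ _))))))) ⟩
    T i (j ∷ []) * (T j (i ∷ []) * fromℕ 2) ∎
    where
    vanish : ∀ {x y} → x ≈ 0# → y ≈ 0# → x + y ≈ 0#
    vanish x≈0 y≈0 = trans (+-cong x≈0 y≈0) (+-identityˡ _)

-- The first two traces of the tensor A_α

module AlphaTraces {c ℓ₁ ℓ₂ ℓ₃} (F : OrderedField c ℓ₁ ℓ₂ ℓ₃) where

  open OrderedField F hiding (zero)
  open CommutativeRing commutativeRing using (semiring)
  open import Relation.Binary.Reasoning.Setoid setoid
  open import Algebra.Properties.Semiring.Mult semiring using (×-homo-+; ×1-homo-*)
  open import Algebra.Properties.CommutativeSemigroup
    (CommutativeRing.*-commutativeSemigroup commutativeRing) using (interchange)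
  open Summation semiring
  open Traces F using (x≈0⇒y*x≈0)
  open Operators F
  open TraceFormulas F
  open Counting using (codegree; codegree-comm; sum-degree; pairs-codegree; _∈#_; ∈#-yes)
  open Subsets

  fromℕ-+ : ∀ m n → fromℕ (m ℕ.+ n) ≈ fromℕ m + fromℕ n
  fromℕ-+ = ×-homo-+ 1#

  fromℕ-* : ∀ m n → fromℕ (m ℕ.* n) ≈ fromℕ m * fromℕ n
  fromℕ-* = ×1-homo-*

  fromℕ-sum : ∀ {n} (f : Fin n → ℕ) → fromℕ (Counting.sum f) ≈ sum (λ i → fromℕ (f i))
  fromℕ-sum {zero}  f = reflexive (≡.trans (≡.cong fromℕ (Counting.sum-empty f))
    (≡.sym (sum-empty _)))
  fromℕ-sum {suc n} f = begin
    fromℕ (Counting.sum f)                             ≡⟨ ≡.cong fromℕ (Counting.sum-suc f) ⟩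
    fromℕ (f zero ℕ.+ Counting.sum (f ∘ suc))          ≈⟨ fromℕ-+ (f zero) _ ⟩
    fromℕ (f zero) + fromℕ (Counting.sum (f ∘ suc))    ≈⟨ +-congˡ (fromℕ-sum (f ∘ suc)) ⟩
    fromℕ (f zero) + sum (λ i → fromℕ (f (suc i)))     ≡⟨ sum-suc _ ⟨
    sum (λ i → fromℕ (f i))                            ∎

  fromℕ-pairs : ∀ {n} (g : Fin n → Fin n → ℕ) →
                fromℕ (Counting.pairs g) ≈ pairs (λ i j → fromℕ (g i j))
  fromℕ-pairs {zero}  g = reflexive (≡.trans (≡.cong fromℕ (Counting.pairs-empty g))
    (≡.sym (pairs-empty _)))
  fromℕ-pairs {suc n} g = begin
    fromℕ (Counting.pairs g)
      ≡⟨ ≡.cong fromℕ (Counting.pairs-suc g) ⟩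
    fromℕ (Counting.sum (λ j → g zero (suc j)) ℕ.+ Counting.pairs (λ i j → g (suc i) (suc j)))
      ≈⟨ trans (fromℕ-+ (Counting.sum (λ j → g zero (suc j))) _)
           (+-cong (fromℕ-sum (λ j → g zero (suc j))) (fromℕ-pairs (λ i j → g (suc i) (suc j)))) ⟩
    sum (λ j → fromℕ (g zero (suc j))) + pairs (λ i j → fromℕ (g (suc i) (suc j)))
      ≡⟨ pairs-suc _ ⟨
    pairs (λ i j → fromℕ (g i j)) ∎

  private variable
    n r : ℕ

  support : Fin n → Vec (Fin n) r → Subset n
  support i γ = ⋃ (List.map ⁅_⁆ (Vec.toList (i ∷ γ)))

  support-⊆ : ∀ {i} {γ : Vec (Fin n) r} {S} → i ∈ S → VAll.All (_∈ S) γ → support i γ ⊆ S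
  support-⊆ {i = i} {γ} {S} i∈S γ∈S x∈ with x∈p∪q⁻ ⁅ i ⁆ _ x∈
  ... | inj₁ x∈i = ≡.subst (_∈ S) (≡.sym (x∈⁅y⁆⇒x≡y i x∈i)) i∈S
  support-⊆ {γ = []}    i∈S γ∈S                 x∈ | inj₂ x∈γ = contradiction x∈γ ∉⊥
  support-⊆ {γ = j ∷ γ} i∈S (j∈S VAll.∷ γ∈S) x∈ | inj₂ x∈γ = support-⊆ j∈S γ∈S x∈γ

  module _ (H : Hypergraph) (α : Carrier) (r : ℕ) (unif : Uniform (suc (suc r)) H) where

    T : Tensor F (suc r) (order H)
    T = Aα F α (suc r) H

    adjacency-zero : ∀ i γ → ∣ support i γ ∣ ℕ.≤ suc r → adjacencyTensor F (suc r) H i γ ≈ 0#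
    adjacency-zero i γ small with any? (λ e → Vec.≡-dec Bool._≟_ (support i γ) (edge H e))
    ... | no  _       = refl
    ... | yes (e , s≡e) = contradiction (≡.subst (ℕ._≤ suc r) (≡.trans (≡.cong ∣_∣ s≡e) (unif e))
      small) ℕ.1+n≰n

    degree-zero : ∀ i γ → γ ≢ Vec.replicate (suc r) i → degreeTensor F (suc r) H i γ ≈ 0#
    degree-zero i γ γ≢ with Vec.≡-dec _≟ᶠ_ γ (Vec.replicate (suc r) i)
    ... | no  _  = refl
    ... | yes γ≡ = contradiction γ≡ γ≢

    degree-diagonal : ∀ i γ → γ ≡ Vec.replicate (suc r) i →
                      degreeTensor F (suc r) H i γ ≈ fromℕ (degree H i)
    degree-diagonal i γ γ≡ with Vec.≡-dec _≟ᶠ_ γ (Vec.replicate (suc r) i)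
    ... | yes _  = refl
    ... | no  γ≢ = contradiction γ≡ γ≢

    T-diagonal : ∀ i → T i (Vec.replicate (suc r) i) ≈ α * fromℕ (degree H i)
    T-diagonal i = trans (+-cong (*-congˡ (degree-diagonal i _ ≡.refl))
      (x≈0⇒y*x≈0 _ (adjacency-zero i (Vec.replicate (suc r) i) small))) (+-identityʳ _)
      where
      constant : ∀ s → VAll.All (_∈ ⁅ i ⁆) (Vec.replicate s i)
      constant zero    = VAll.[]
      constant (suc s) = x∈⁅x⁆ i VAll.∷ constant s

      small : ∣ support i (Vec.replicate (suc r) i) ∣ ℕ.≤ suc r
      small = ℕ.≤-trans (p⊆q⇒∣p∣≤∣q∣ (support-⊆ (x∈⁅x⁆ i) (constant (suc r))))
        (≡.subst (ℕ._≤ suc r) (≡.sym (∣⁅x⁆∣≡1 i)) (ℕ.s≤s ℕ.z≤n))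

    -- The diagonal entries sum to α times the degree sum km, so this trace sees nothing of the
    -- hypergraph but n and m.
    Tr₁-uniform : Tr F 1 T ≈ fromℕ (suc r ^ (order H ∸ 1)) * (α * fromℕ (size H ℕ.* suc (suc r)))
    Tr₁-uniform = trans (Tr₁-ops T) (*-congˡ (begin
      sum (λ i → constantTerm F (op T i 1 (trA^ F _ (1 ℕ.* suc r))))
        ≈⟨ sum-cong (λ i → trans (trace₁-term T i) (T-diagonal i)) ⟩
      sum (λ i → α * fromℕ (degree H i))
        ≈⟨ trans (sum-*ˡ α _) (*-congˡ (sym (fromℕ-sum (degree H)))) ⟩
      α * fromℕ (Counting.sum (degree H))
        ≡⟨ ≡.cong (λ d → α * fromℕ d) (sum-degree H unif) ⟩
      α * fromℕ (size H ℕ.* suc (suc r)) ∎))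

    diagonal-part : sum (λ i → constantTerm F (op T i 2 (trA^ F _ (2 ℕ.* suc r)))) ≈
                    (α * α) * fromℕ (Counting.sum (λ v → degree H v ℕ.* degree H v))
    diagonal-part = begin
      sum (λ i → constantTerm F (op T i 2 (trA^ F _ (2 ℕ.* suc r))))
        ≈⟨ sum-cong (λ i → trans (trace₂-term T i) (trans (*-cong (T-diagonal i) (T-diagonal i))
             (trans (interchange _ _ _ _) (*-congˡ (sym (fromℕ-* (degree H i) _)))))) ⟩
      sum (λ i → (α * α) * fromℕ (degree H i ℕ.* degree H i))
        ≈⟨ trans (sum-*ˡ (α * α) _) (*-congˡ (sym (fromℕ-sum (λ v → degree H v ℕ.* degree H v)))) ⟩
      (α * α) * fromℕ (Counting.sum (λ v → degree H v ℕ.* degree H v)) ∎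

  module _ (H : Hypergraph) (α : Carrier) (r : ℕ) (unif : Uniform (suc (suc (suc r))) H) where

    -- The indices cover at most two vertices, too few for a hyperedge with k = r + 3.
    T-sparse : Sparse (Aα F α (suc (suc r)) H)
    T-sparse {i} {j} {γ} among γ≢ = trans (+-cong
      (x≈0⇒y*x≈0 _ (degree-zero H α (suc r) unif i γ γ≢))
      (x≈0⇒y*x≈0 _ (adjacency-zero H α (suc r) unif i γ small))) (+-identityˡ _)
      where
      inside : VAll.All (_∈ ⁅ i ⁆ ∪ ⁅ j ⁆) γ
      inside = VAll.map (λ { (inj₁ ≡.refl) → x∈p∪q⁺ (inj₁ (x∈⁅x⁆ i)) ; (inj₂ ≡.refl) →
        x∈p∪q⁺ (inj₂ (x∈⁅x⁆ j)) }) among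

      small : ∣ support i γ ∣ ℕ.≤ suc (suc r)
      small = ℕ.≤-trans (p⊆q⇒∣p∣≤∣q∣ (support-⊆ (x∈p∪q⁺ (inj₁ (x∈⁅x⁆ i))) inside))
        (ℕ.≤-trans (∣∪∣≤ ⁅ i ⁆ ⁅ j ⁆) (≡.subst (ℕ._≤ suc (suc r))
          (≡.sym (≡.cong₂ ℕ._+_ (∣⁅x⁆∣≡1 i) (∣⁅x⁆∣≡1 j))) (ℕ.s≤s (ℕ.s≤s ℕ.z≤n))))

  module _ (H : Hypergraph) (α : Carrier) (unif : Uniform 2 H) (lin : Linear H) where

    codegree-yes : ∀ {i j} e → i ≢ j → i ∈ edge H e → j ∈ edge H e → codegree H i j ≡ 1
    codegree-yes {i} {j} e i≢j i∈e j∈e = ≡.trans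
      (Counting.sum-single e _ λ f f≢e → other f f≢e)
      (≡.cong₂ ℕ._*_ (∈#-yes i∈e) (∈#-yes j∈e))
      where
      other : ∀ f → f ≢ e → i ∈# edge H f ℕ.* j ∈# edge H f ≡ 0
      other f f≢e with i ∈? edge H f | j ∈? edge H f
      ... | no  _   | _       = ≡.refl
      ... | yes _   | no _    = ≡.refl
      ... | yes i∈f | yes j∈f = contradiction (linear-unique {H} lin f≢e i∈f i∈e j∈f j∈e) i≢j

    codegree-no : ∀ {i j} → (∀ e → ¬ (i ∈ edge H e × j ∈ edge H e)) → codegree H i j ≡ 0
    codegree-no {i} {j} none = Counting.sum-zero other
      where
      other : ∀ f → i ∈# edge H f ℕ.* j ∈# edge H f ≡ 0
      other f with i ∈? edge H f | j ∈? edge H f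
      ... | no  _   | _       = ≡.refl
      ... | yes _   | no _    = ≡.refl
      ... | yes i∈f | yes j∈f = contradiction (i∈f , j∈f) (none f)

    -- An edge gives the entry 1/1! = 1, and by linearity at most one edge passes through two
    -- vertices, so both sides are the same 0 or 1.
    adjacency-codegree : ∀ i j → i ≢ j → adjacencyTensor F 1 H i (j ∷ []) ≈ fromℕ (codegree H i j)
    adjacency-codegree i j i≢j with any? (λ e → Vec.≡-dec Bool._≟_ (support i (j ∷ [])) (edge H e))
    ... | yes (e , s≡e) = trans 1/1! (trans (sym (+-identityʳ 1#)) (reflexive (≡.cong fromℕ (≡.sym
          (codegree-yes e i≢j (≡.subst (i ∈_) s≡e i∈s) (≡.subst (j ∈_) s≡e j∈s))))))
      where
      i∈s : i ∈ support i (j ∷ [])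
      i∈s = x∈p∪q⁺ (inj₁ (x∈⁅x⁆ i))
      j∈s : j ∈ support i (j ∷ [])
      j∈s = x∈p∪q⁺ {p = ⁅ i ⁆} (inj₂ (x∈p∪q⁺ (inj₁ (x∈⁅x⁆ j))))
    ... | no none = reflexive (≡.cong fromℕ (≡.sym (codegree-no λ e (i∈e , j∈e) → none (e ,
          ⊆∧∣∣≥⇒≡ (support-⊆ i∈e (j∈e VAll.∷ VAll.[]))
            (≡.subst (ℕ._≤ _) (≡.sym (unif e)) (members⇒2≤ (x∈p∪q⁺ (inj₁ (x∈⁅x⁆ i)))
              (x∈p∪q⁺ {p = ⁅ i ⁆} (inj₂ (x∈p∪q⁺ (inj₁ (x∈⁅x⁆ j))))) (i≢j ∘ ≡.sym)))))))

    T-edge : ∀ i j → i ≢ j → Aα F α 1 H i (j ∷ []) ≈ (1# - α) * fromℕ (codegree H i j)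
    T-edge i j i≢j = trans (+-cong
      (x≈0⇒y*x≈0 _ (degree-zero H α 0 unif i (j ∷ []) (i≢j ∘ ≡.sym ∘ Vec.∷-injectiveˡ)))
      (*-congˡ (adjacency-codegree i j i≢j))) (+-identityˡ _)

    codegree-idem : ∀ i j → i ≢ j → codegree H i j ℕ.* codegree H i j ≡ codegree H i j
    codegree-idem i j i≢j with any? (λ e → (i ∈? edge H e) ×-dec (j ∈? edge H e))
    ... | yes (e , i∈e , j∈e) rewrite codegree-yes e i≢j i∈e j∈e = ≡.refl
    ... | no none rewrite codegree-no {i} {j} (λ e both → none (e , both)) = ≡.refl

    -- Each pair i < j contributes 2(1-α)² times the square of a 0-1 entry, which is the entry
    -- itself; the sum counts every edge twice.
    cross-part : pairs (λ i j → constantTerm F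
      (op (Aα F α 1 H) i 1 (op (Aα F α 1 H) j 1 (trA^ F (order H) 2)))) ≈
                 ((1# - α) * (1# - α)) * fromℕ (size H ℕ.* 2)
    cross-part = begin
      pairs (λ i j → constantTerm F (op A i 1 (op A j 1 (trA^ F (order H) 2))))
        ≈⟨ pairs-cong (λ i j i≢j → trans (cross-term-2 A i j) (term i j i≢j)) ⟩
      pairs (λ i j → β * fromℕ (codegree H i j ℕ.+ codegree H i j))
        ≈⟨ trans (pairs-*ˡ β _) (*-congˡ (sym
          (fromℕ-pairs (λ i j → codegree H i j ℕ.+ codegree H i j)))) ⟩
      β * fromℕ (Counting.pairs (λ i j → codegree H i j ℕ.+ codegree H i j))
        ≡⟨ ≡.cong (λ d → β * fromℕ d) (≡.trans (Counting.pairs-+ (codegree H) (codegree H))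
          (pairs-codegree H unif)) ⟩
      β * fromℕ (size H ℕ.* 2) ∎
      where
      A = Aα F α 1 H
      β = (1# - α) * (1# - α)

      term : ∀ i j → i ≢ j → A i (j ∷ []) * (A j (i ∷ []) * fromℕ 2) ≈
             β * fromℕ (codegree H i j ℕ.+ codegree H i j)
      term i j i≢j = begin
        A i (j ∷ []) * (A j (i ∷ []) * fromℕ 2)
          ≈⟨ *-cong (T-edge i j i≢j) (*-congʳ (T-edge j i (i≢j ∘ ≡.sym))) ⟩
        ((1# - α) * fromℕ (codegree H i j)) * (((1# - α) * fromℕ (codegree H j i)) * fromℕ 2)
          ≈⟨ *-assoc _ _ _ ⟨
        (((1# - α) * fromℕ (codegree H i j)) * ((1# - α) * fromℕ (codegree H j i))) * fromℕ 2
          ≈⟨ trans (*-congʳ (interchange _ _ _ _)) (*-assoc _ _ _) ⟩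
        β * ((fromℕ (codegree H i j) * fromℕ (codegree H j i)) * fromℕ 2)
          ≈⟨ *-congˡ (trans (*-congʳ (sym (fromℕ-* (codegree H i j) _)))
            (sym (fromℕ-* (codegree H i j ℕ.* codegree H j i) 2))) ⟩
        β * fromℕ (codegree H i j ℕ.* codegree H j i ℕ.* 2)
          ≡⟨ ≡.cong (λ d → β * fromℕ d) (≡.trans
               (≡.cong (ℕ._* 2) (≡.trans (≡.cong (codegree H i j ℕ.*_) (codegree-comm H j i))
                 (codegree-idem i j i≢j)))
               (≡.trans (ℕ.*-comm (codegree H i j) 2)
                 (≡.cong (codegree H i j ℕ.+_) (ℕ.+-identityʳ _)))) ⟩
        β * fromℕ (codegree H i j ℕ.+ codegree H i j) ∎

  -- The natural number matched on is k - 2, so only ordinary graphs have a mixed part. It depends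
  -- on k, m and α alone and cancels in every comparison within the class.
  cross-total : Carrier → ℕ → ℕ → Carrier
  cross-total α zero    m = ((1# - α) * (1# - α)) * fromℕ (m ℕ.* 2)
  cross-total α (suc _) m = 0#

  Tr₂-uniform : ∀ H α r → Uniform (suc (suc r)) H → Linear H →
    Tr F 2 (Aα F α (suc r) H) ≈ fromℕ (suc r ^ (order H ∸ 1)) *
    ((α * α) * fromℕ (Counting.sum (λ v → degree H v ℕ.* degree H v)) + cross-total α r (size H))
  Tr₂-uniform H α r unif lin = trans (Tr₂-ops (Aα F α (suc r) H))
    (*-congˡ (+-cong (diagonal-part H α r unif) (cross r unif)))
    where
    cross : ∀ r → Uniform (suc (suc r)) H →
      pairs (λ i j → constantTerm F (op (Aα F α (suc r) H) i 1
        (op (Aα F α (suc r) H) j 1 (trA^ F (order H) (2 ℕ.* suc r))))) ≈ cross-total α r (size H)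
    cross zero    unif = cross-part H α unif lin
    cross (suc r) unif = pairs-zero λ i j → cross-zero (Aα F α (suc (suc r)) H)
      (T-sparse H α r unif)

-- Cyclic indices, paths without repetition and their closure to cycles

module Cycles where

  open import Data.Fin.Base using (toℕ; inject₁; fromℕ)
  open import Data.Nat.Base using (s≤s)
  open ≡ using (refl; sym; trans; cong; subst; module ≡-Reasoning)
  open Subsets

  next-inject₁ : ∀ {g} (i : Fin g) → next (inject₁ i) ≡ suc i
  next-inject₁ {g} i = Fin.toℕ-injective (begin
    toℕ (next (inject₁ i))             ≡⟨ Fin.toℕ-fromℕ< (ℕ.m%n<n (suc (toℕ (inject₁ i))) (suc g)) ⟩
    suc (toℕ (inject₁ i)) ℕ.% suc g    ≡⟨ cong (λ x → suc x ℕ.% suc g) (Fin.toℕ-inject₁ i) ⟩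
    suc (toℕ i) ℕ.% suc g              ≡⟨ ℕ.m<n⇒m%n≡m (s≤s (Fin.toℕ<n i)) ⟩
    suc (toℕ i)                        ∎)
    where open ≡-Reasoning

  next-fromℕ : ∀ g → next (fromℕ g) ≡ zero
  next-fromℕ g = Fin.toℕ-injective (begin
    toℕ (next (fromℕ g))             ≡⟨ Fin.toℕ-fromℕ< (ℕ.m%n<n (suc (toℕ (fromℕ g))) (suc g)) ⟩
    suc (toℕ (fromℕ g)) ℕ.% suc g    ≡⟨ cong (λ x → suc x ℕ.% suc g) (Fin.toℕ-fromℕ g) ⟩
    suc g ℕ.% suc g                  ≡⟨ ℕ.n%n≡0 (suc g) ⟩
    0                                ∎)
    where open ≡-Reasoning

  -- Its purpose is to name the hyperedge by which a cycle enters a given vertex.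
  prev : ∀ {g} → Fin (suc g) → Fin (suc g)
  prev {g} zero    = fromℕ g
  prev     (suc i) = inject₁ i

  next-prev : ∀ {g} (i : Fin (suc g)) → next (prev i) ≡ i
  next-prev {g} zero    = next-fromℕ g
  next-prev     (suc i) = next-inject₁ i

  next≢ : ∀ {g} (i : Fin (suc (suc g))) → next i ≢ i
  next≢ {g} i with view i
  ... | ‵fromℕ     = λ eq → case (trans (sym (next-fromℕ (suc g))) eq)
    where
    case : zero ≢ fromℕ (suc g)
    case ()
  ... | ‵inject₁ j = λ eq → ℕ.1+n≢n (trans (cong toℕ (trans (sym (next-inject₁ j)) eq))
    (Fin.toℕ-inject₁ j))

  prev≢ : ∀ {g} (i : Fin (suc (suc g))) → prev i ≢ i
  prev≢ i eq = next≢ (prev i) (trans (next-prev i) (sym eq))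

  module _ (H : Hypergraph) where

    private
      V = Fin (order H)
      E = Fin (size H)

    open Cycle

    -- The cyclic order is x a y b z c: x lies on c and a, y on a and b, z on b and c.
    triangle : (a b c : E) (x y z : V) → a ≢ b → b ≢ c → a ≢ c → x ≢ y → y ≢ z → x ≢ z →
      x ∈ edge H c → x ∈ edge H a → y ∈ edge H a → y ∈ edge H b → z ∈ edge H b → z ∈ edge H c →
      Cycle H
    triangle a b c x y z a≢b b≢c a≢c x≢y y≢z x≢z xc xa ya yb zb zc = record
      { extra = 1
      ; cvert = lookup (x ∷ y ∷ z ∷ [])
      ; cedge = lookup (a ∷ b ∷ c ∷ [])
      ; cvert-distinct = distinct x y z x≢y y≢z x≢z
      ; cedge-distinct = distinct a b c a≢b b≢c a≢c
      ; here∈ = λ { zero → xa ; (suc zero) → yb ; (suc (suc zero)) → zc }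
      ; next∈ = λ { zero → ya ; (suc zero) → zb ; (suc (suc zero)) → xc }
      }
      where
      distinct : ∀ {A : Set} (a b c : A) → a ≢ b → b ≢ c → a ≢ c →
                 Injective _≡_ _≡_ (lookup (a ∷ b ∷ c ∷ []))
      distinct a b c a≢b b≢c a≢c {zero}         {zero}         _  = refl
      distinct a b c a≢b b≢c a≢c {zero}         {suc zero}     eq = contradiction eq a≢b
      distinct a b c a≢b b≢c a≢c {zero}         {suc (suc zero)} eq = contradiction eq a≢c
      distinct a b c a≢b b≢c a≢c {suc zero}     {zero}         eq = contradiction (sym eq) a≢b
      distinct a b c a≢b b≢c a≢c {suc zero}     {suc zero}     _  = refl
      distinct a b c a≢b b≢c a≢c {suc zero}     {suc (suc zero)} eq = contradiction eq b≢c
      distinct a b c a≢b b≢c a≢c {suc (suc zero)} {zero}         eq = contradiction (sym eq) a≢c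
      distinct a b c a≢b b≢c a≢c {suc (suc zero)} {suc zero}     eq = contradiction (sym eq) b≢c
      distinct a b c a≢b b≢c a≢c {suc (suc zero)} {suc (suc zero)} _  = refl

    module _ (F : Subset (size H)) where

      AdjacentIn : V → V → Set
      AdjacentIn u v = ∃[ e ] (e ∈ F × u ∈ edge H e × v ∈ edge H e)

      _∉ᵛ_ : ∀ {A : Set} {ℓ} → A → Vec A ℓ → Set
      x ∉ᵛ xs = ∀ i → lookup xs i ≢ x

      -- The last vertex is not listed among the vertices us.
      data Path : ∀ {ℓ} → V → V → Vec V ℓ → Vec E ℓ → Set where
        []   : ∀ {v} → Path v v [] []
        step : ∀ {ℓ u w v e} {us : Vec V ℓ} {es : Vec E ℓ} →
               e ∈ F → u ∈ edge H e → w ∈ edge H e → u ≢ v → u ∉ᵛ us → e ∉ᵛ es →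
               Path w v us es → Path u v (u ∷ us) (e ∷ es)

      SomePath : V → V → Set
      SomePath u v = ∃[ ℓ ] ∃[ us ] ∃[ es ] Path {ℓ} u v us es

      suffix : ∀ {ℓ u v} {us : Vec V ℓ} {es} → Path u v us es → ∀ i → SomePath (lookup us i) v
      suffix p@(step _ _ _ _ _ _ _) zero    = _ , _ , _ , p
      suffix   (step _ _ _ _ _ _ p) (suc i) = suffix p i

      -- A vertex w of a hyperedge already on the path can enter the path by that same hyperedge,
      -- which avoids repeating it.
      shortcut : ∀ {ℓ u v w} {us : Vec V ℓ} {es} → Path u v us es → w ≢ v → w ∉ᵛ us →
                 ∀ i → w ∈ edge H (lookup es i) → SomePath w v
      shortcut (step e∈F _ w∈e _ _ e∉es p) w≢v w∉us zero    w∈e′ =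
        _ , _ , _ , step e∈F w∈e′ w∈e w≢v (w∉us ∘ suc) e∉es p
      shortcut (step _ _ _ _ _ _ p)        w≢v w∉us (suc i) w∈e′ = shortcut p w≢v (w∉us ∘ suc) i
        w∈e′

      -- A repeated vertex is cured by passing to a suffix, a repeated hyperedge by entering the
      -- path at its occurrence.
      extend : ∀ {u w v} → AdjacentIn u w → SomePath w v → SomePath u v
      extend {u} {w} {v} (e , e∈F , u∈e , w∈e) (ℓ , us , es , p) with u ≟ᶠ v
      ... | yes refl = _ , _ , _ , []
      ... | no u≢v with any? (λ i → lookup us i ≟ᶠ u)
      ...   | yes (i , refl) = suffix p i
      ...   | no  u∉us with any? (λ i → lookup es i ≟ᶠ e)
      ...     | yes (i , refl) = shortcut p u≢v (λ i eq → u∉us (i , eq)) i u∈e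
      ...     | no  e∉es       = _ , _ , _ , step e∈F u∈e w∈e u≢v (λ i eq → u∉us (i , eq))
        (λ i eq → e∉es (i , eq)) p

      path : ∀ {u v} → Star AdjacentIn u v → SomePath u v
      path ε        = _ , _ , _ , []
      path (a ◅ as) = extend a (path as)

      path-here : ∀ {ℓ u v} {us : Vec V ℓ} {es} → Path u v us es → ∀ i →
        lookup us i ∈ edge H (lookup es i)
      path-here (step _ u∈e _ _ _ _ p) zero    = u∈e
      path-here (step _ _   _ _ _ _ p) (suc i) = path-here p i

      path-next : ∀ {ℓ u v} {us : Vec V (suc ℓ)} {es} → Path u v us es → (i : Fin ℓ) →
                  lookup us (suc i) ∈ edge H (lookup es (inject₁ i))
      path-next (step _ _ w∈e _ _ _ (step _ _ _ _ _ _ _))   zero    = w∈e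
      path-next (step _ _ _   _ _ _ p@(step _ _ _ _ _ _ _)) (suc i) = path-next p i

      path-last : ∀ {ℓ u v} {us : Vec V (suc ℓ)} {es} → Path u v us es →
        v ∈ edge H (lookup es (fromℕ ℓ))
      path-last (step _ _ w∈e _ _ _ [])                       = w∈e
      path-last (step _ _ _   _ _ _ p@(step _ _ _ _ _ _ _)) = path-last p

      path-∉ : ∀ {ℓ u v} {us : Vec V ℓ} {es} → Path u v us es → v ∉ᵛ us
      path-∉ (step _ _ _ u≢v _ _ p) zero    = u≢v
      path-∉ (step _ _ _ _   _ _ p) (suc i) = path-∉ p i

      path-⊆ : ∀ {ℓ u v} {us : Vec V ℓ} {es} → Path u v us es → ∀ i → lookup es i ∈ F
      path-⊆ (step e∈F _ _ _ _ _ p) zero    = e∈F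
      path-⊆ (step _   _ _ _ _ _ p) (suc i) = path-⊆ p i

      lookup-∷-injective : ∀ {A : Set} {ℓ} {x : A} {xs : Vec A ℓ} → x ∉ᵛ xs →
        Injective _≡_ _≡_ (lookup xs) → Injective _≡_ _≡_ (lookup (x ∷ xs))
      lookup-∷-injective x∉ inj {zero}  {zero}  eq = refl
      lookup-∷-injective x∉ inj {zero}  {suc j} eq = contradiction (sym eq) (x∉ j)
      lookup-∷-injective x∉ inj {suc i} {zero}  eq = contradiction eq (x∉ i)
      lookup-∷-injective x∉ inj {suc i} {suc j} eq = cong suc (inj eq)

      path-us : ∀ {ℓ u v} {us : Vec V ℓ} {es} → Path u v us es → Injective _≡_ _≡_ (lookup us)
      path-us []                      {()}
      path-us (step _ _ _ _ u∉ _ p) = lookup-∷-injective u∉ (path-us p)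

      path-es : ∀ {ℓ u v} {us : Vec V ℓ} {es} → Path u v us es → Injective _≡_ _≡_ (lookup es)
      path-es []                      {()}
      path-es (step _ _ _ _ _ e∉ p) = lookup-∷-injective e∉ (path-es p)

      -- Besides the cycle, the result tells which vertices it links to f and that its other
      -- hyperedges lie in F; uniqueness is exploited by comparing these data for different u and v.
      close : ∀ {u v f} → u ≢ v → f ∉ F → u ∈ edge H f → v ∈ edge H f → Star AdjacentIn u v →
        ∃[ C ] (Link C u f × (∀ x → Link C x f → x ≡ u ⊎ x ≡ v) ×
          (∀ i → cedge C i ≡ f ⊎ cedge C i ∈ F))
      close {u} {v} {f} u≢v f∉F u∈f v∈f walk with path walk
      ... | zero  , [] , [] , [] = contradiction refl u≢v
      ... | suc ℓ , us , es , p  = C , (zero , refl , inj₂ u≡next) , link-f , edges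
        where
        u≡us₀ : ∀ {ℓ u v} {us : Vec V (suc ℓ)} {es} → Path u v us es → u ≡ lookup us zero
        u≡us₀ (step _ _ _ _ _ _ _) = refl

        -- Starting at v with f makes the path from u to v the tail of the cycle. The path is
        -- nonempty since u ≠ v, so the length is ℓ + 2 and `extra` is ℓ.
        cv = lookup (v ∷ us)
        ce = lookup (f ∷ es)

        u≡next : u ≡ cv (next zero)
        u≡next = trans (u≡us₀ p) (cong cv (sym (next-inject₁ zero)))

        f∉es : f ∉ᵛ es
        f∉es i eq = f∉F (subst (_∈ F) eq (path-⊆ p i))

        hereC : ∀ i → cv i ∈ edge H (ce i)
        hereC zero    = v∈f
        hereC (suc i) = path-here p i

        nextC : ∀ i → cv (next i) ∈ edge H (ce i)
        nextC zero    = subst (_∈ edge H f) u≡next u∈f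
        nextC (suc i) with view i
        ... | ‵fromℕ     = subst (λ j → cv j ∈ edge H (lookup es (fromℕ ℓ)))
          (sym (next-fromℕ (suc ℓ))) (path-last p)
        ... | ‵inject₁ j = subst (λ x → cv x ∈ edge H (lookup es (inject₁ j)))
          (sym (next-inject₁ (suc j))) (path-next p j)

        C : Cycle H
        C = record
          { extra = ℓ ; cvert = cv ; cedge = ce
          ; cvert-distinct = lookup-∷-injective (path-∉ p) (path-us p)
          ; cedge-distinct = lookup-∷-injective f∉es (path-es p)
          ; here∈ = hereC ; next∈ = nextC }

        link-f : ∀ x → Link C x f → x ≡ u ⊎ x ≡ v
        link-f x (zero  , _  , inj₁ x≡v) = inj₂ x≡v
        link-f x (zero  , _  , inj₂ x≡u) = inj₁ (trans x≡u (sym u≡next))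
        link-f x (suc i , eq , _)        = contradiction (sym eq) (f∉es i)

        edges : ∀ i → ce i ≡ f ⊎ ce i ∈ F
        edges zero    = inj₁ refl
        edges (suc i) = inj₂ (path-⊆ p i)

-- The number of vertices from the Euler characteristic

module Order where

  open import Data.Nat.Base using (_+_; _*_; _≤_; z≤n; s≤s)
  open import Algebra.Properties.CommutativeSemigroup ℕ.+-commutativeSemigroup using (xy∙z≈xz∙y)
  open ≡ using (refl; sym; trans; cong; cong₂; subst; module ≡-Reasoning)
  open Subsets
  open Cycles
  open Cycle

  links-transfer : ∀ {H} → Unicyclic H → (C C′ : Cycle H) → ∀ {v e} → Link C v e → Link C′ v e
  links-transfer (_ , C₀ , same) C C′ {v} {e} =
    Equivalence.to (same C′ v e) ∘ Equivalence.from (same C v e)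

  edge-transfer : ∀ {H} → Unicyclic H → (C C′ : Cycle H) → ∀ i → ∃[ j ] cedge C i ≡ cedge C′ j
  edge-transfer uni C C′ i =
    let j , eq , _ = links-transfer uni C C′ (i , refl , inj₁ refl) in j , eq

  insert-∉ : ∀ {n} {F : Subset n} {f} → f ∉ F → ∣ F ∪ ⁅ f ⁆ ∣ ≡ suc ∣ F ∣
  insert-∉ {F = F} {f} f∉F = begin
    ∣ F ∪ ⁅ f ⁆ ∣                      ≡⟨ ℕ.+-identityʳ _ ⟨
    ∣ F ∪ ⁅ f ⁆ ∣ + 0                  ≡⟨ cong (∣ F ∪ ⁅ f ⁆ ∣ +_) disjoint ⟨
    ∣ F ∪ ⁅ f ⁆ ∣ + ∣ F ∩ ⁅ f ⁆ ∣      ≡⟨ ∣∪∣+∣∩∣ F ⁅ f ⁆ ⟩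
    ∣ F ∣ + ∣ ⁅ f ⁆ ∣                  ≡⟨ cong (∣ F ∣ +_) (∣⁅x⁆∣≡1 f) ⟩
    ∣ F ∣ + 1                          ≡⟨ ℕ.+-comm _ 1 ⟩
    suc ∣ F ∣                          ∎
    where
    open ≡-Reasoning
    disjoint : ∣ F ∩ ⁅ f ⁆ ∣ ≡ 0
    disjoint with ∣ F ∩ ⁅ f ⁆ ∣ in eq
    ... | zero  = refl
    ... | suc c = let x , x∈ = member (subst (1 ≤_) (sym eq) (s≤s z≤n))
                      x∈F , x∈f = x∈p∩q⁻ F ⁅ f ⁆ x∈
                  in contradiction (subst (_∈ F) (x∈⁅y⁆⇒x≡y f x∈f) x∈F) f∉F

  module _ {H k} (unif : Uniform k H) (uni : Unicyclic H) where

    private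
      V = Fin (order H)
      E = Fin (size H)
      C₀ = proj₁ (proj₂ uni)
      root = cvert C₀ zero

    InSet : Subset (size H) → Cycle H → Set
    InSet F C = ∀ i → cedge C i ∈ F

    -- The Euler characteristic of a connected part tells whether it already
    -- contains the cycle.
    record Part (F : Subset (size H)) (U : Subset (order H)) : Set where
      field
        root∈   : root ∈ U
        covered : ∀ {e} → e ∈ F → edge H e ⊆ U
        reach   : ∀ {u} → u ∈ U → Star (AdjacentIn H F) root u
        euler   : (∣ U ∣ + ∣ F ∣ ≡ suc (k * ∣ F ∣) × (∀ C → ¬ InSet F C)) ⊎
                  (∣ U ∣ + ∣ F ∣ ≡ k * ∣ F ∣ × ∃[ C ] InSet F C)

    start : Part ⊥ ⁅ root ⁆
    start = record
      { root∈   = x∈⁅x⁆ root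
      ; covered = λ e∈⊥ → contradiction e∈⊥ ∉⊥
      ; reach   = λ u∈ → subst (Star (AdjacentIn H ⊥) root) (sym (x∈⁅y⁆⇒x≡y root u∈)) ε
      ; euler   = inj₁ (count , λ C C⊆⊥ → ∉⊥ (C⊆⊥ zero))
      }
      where
      count : ∣ ⁅ root ⁆ ∣ + ∣ ⊥ {size H} ∣ ≡ suc (k * ∣ ⊥ {size H} ∣)
      count rewrite ∣⁅x⁆∣≡1 root | ∣⊥∣≡0 (size H) = cong suc (sym (ℕ.*-zeroʳ k))

    AdjacentIn-sym : ∀ {F : Subset (size H)} {u v} → AdjacentIn H F u v → AdjacentIn H F v u
    AdjacentIn-sym (e , e∈F , u∈e , v∈e) = e , e∈F , v∈e , u∈e

    module _ {F U} (part : Part F U) {f} (f∉F : f ∉ F) {w} (w∈U : w ∈ U) (w∈f : w ∈ edge H f) where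

      open Part part

      private
        F′ = F ∪ ⁅ f ⁆
        U′ = U ∪ edge H f

      join : ∀ {u v} → u ∈ U → v ∈ U → Star (AdjacentIn H F) u v
      join u∈U v∈U = Star.reverse AdjacentIn-sym (reach u∈U) ◅◅ reach v∈U

      closing : ∀ {u v} → u ≢ v → u ∈ U ∩ edge H f → v ∈ U ∩ edge H f →
        ∃[ C ] (Link C u f × (∀ x → Link C x f → x ≡ u ⊎ x ≡ v) ×
          (∀ i → cedge C i ≡ f ⊎ cedge C i ∈ F))
      closing u≢v u∈ v∈ =
        let u∈U , u∈f = x∈p∩q⁻ U (edge H f) u∈
            v∈U , v∈f = x∈p∩q⁻ U (edge H f) v∈
        in close H F u≢v f∉F u∈f v∈f (join u∈U v∈U)

      -- Two vertices of f in the connected part give a cycle through f. A cycle inside F would be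
      -- the same one and contain f, which is not in F.
      2≤⇒acyclic : 2 ≤ ∣ U ∩ edge H f ∣ → ∀ C → ¬ InSet F C
      2≤⇒acyclic 2≤ C C⊆F =
        let u , v , u∈ , v∈ , v≢u = two-members 2≤
            C′ , link , _ = closing (v≢u ∘ sym) u∈ v∈
            i , f≡ , _ = links-transfer uni C′ C link
        in f∉F (subst (_∈ F) (sym f≡) (C⊆F i))

      -- Three such vertices x, y, z give a cycle linking x to f and another that links only y and z
      -- to f; these would be different cycles.
      ≤2 : ¬ 3 ≤ ∣ U ∩ edge H f ∣
      ≤2 3≤ =
        let x , y , z , x∈ , y∈ , z∈ , y≢x , z≢x , z≢y = three-members 3≤
            C  , link , _     = closing (y≢x ∘ sym) x∈ y∈
            C′ , _ , only , _ = closing (z≢y ∘ sym) y∈ z∈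
        in Sum.[ y≢x ∘ sym , z≢x ∘ sym ] (only x (links-transfer uni C C′ link))

      f∈F′ : f ∈ F′
      f∈F′ = x∈p∪q⁺ {p = F} (inj₂ (x∈⁅x⁆ f))

      F⊆F′ : F ⊆ F′
      F⊆F′ e∈F = x∈p∪q⁺ (inj₁ e∈F)

      F′-cases : ∀ {e} → e ∈ F′ → e ≡ f ⊎ e ∈ F
      F′-cases e∈ with x∈p∪q⁻ F ⁅ f ⁆ e∈
      ... | inj₁ e∈F = inj₂ e∈F
      ... | inj₂ e∈f = inj₁ (x∈⁅y⁆⇒x≡y f e∈f)

      -- A cycle through f has two vertices in f, each also in another of its hyperedges.
      1≡⇒acyclic : ∣ U ∩ edge H f ∣ ≡ 1 → (∀ C → ¬ InSet F C) → ∀ C → ¬ InSet F′ C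
      1≡⇒acyclic ≡1 acyclic C C⊆F′ with any? (λ i → cedge C i ≟ᶠ f)
      ... | no f∉C = acyclic C λ i → other i (F′-cases (C⊆F′ i))
        where
        other : ∀ i → cedge C i ≡ f ⊎ cedge C i ∈ F → cedge C i ∈ F
        other i (inj₁ eq) = contradiction (i , eq) f∉C
        other i (inj₂ ∈F) = ∈F
      ... | yes (i , eq) = contradiction
          (subst (2 ≤_) ≡1 (members⇒2≤ (x∈p∩q⁺ (v₁∈U , v₁∈f)) (x∈p∩q⁺ (v₂∈U , v₂∈f)) v₂≢v₁))
            λ { (s≤s ()) }
        where
        inF : ∀ j → j ≢ i → cedge C j ∈ F
        inF j j≢i with F′-cases (C⊆F′ j)
        ... | inj₁ eq′ = contradiction (cedge-distinct C (trans eq′ (sym eq))) j≢i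
        ... | inj₂ ∈F  = ∈F
        v₁∈U : cvert C i ∈ U
        v₁∈U = covered (inF (prev i) (prev≢ i))
          (subst (λ j → cvert C j ∈ edge H (cedge C (prev i))) (next-prev i) (next∈ C (prev i)))
        v₂∈U : cvert C (next i) ∈ U
        v₂∈U = covered (inF (next i) (next≢ i)) (here∈ C (next i))
        v₁∈f : cvert C i ∈ edge H f
        v₁∈f = subst (λ e → cvert C i ∈ edge H e) eq (here∈ C i)
        v₂∈f : cvert C (next i) ∈ edge H f
        v₂∈f = subst (λ e → cvert C (next i) ∈ edge H e) eq (next∈ C i)
        v₂≢v₁ : cvert C (next i) ≢ cvert C i
        v₂≢v₁ v≡ = next≢ i (cvert-distinct C v≡)

      -- With c = ∣ U ∩ f ∣ the difference ∣ U ∣ + ∣ F ∣ - k ∣ F ∣ changes by 1 - c. The case c = 1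
      -- keeps it and creates no cycle, c = 2 lowers it from 1 to 0 by closing the cycle, and all
      -- other c are impossible.
      grow : Part F′ U′
      grow = record
        { root∈   = x∈p∪q⁺ (inj₁ root∈)
        ; covered = λ e∈F′ x∈e → cover (F′-cases e∈F′) x∈e
        ; reach   = λ u∈U′ → reach′ (x∈p∪q⁻ U (edge H f) u∈U′)
        ; euler   = euler′ (∣ U ∩ edge H f ∣) refl euler
        }
        where
        open ≡-Reasoning
        cover : ∀ {e} → e ≡ f ⊎ e ∈ F → edge H e ⊆ U′
        cover (inj₁ refl) x∈e = x∈p∪q⁺ {p = U} (inj₂ x∈e)
        cover (inj₂ e∈F)  x∈e = x∈p∪q⁺ (inj₁ (covered e∈F x∈e))

        lift : ∀ {u v} → AdjacentIn H F u v → AdjacentIn H F′ u v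
        lift (e , e∈F , rest) = e , F⊆F′ e∈F , rest

        reach′ : ∀ {u} → u ∈ U ⊎ u ∈ edge H f → Star (AdjacentIn H F′) root u
        reach′ (inj₁ u∈U) = Star.map lift (reach u∈U)
        reach′ (inj₂ u∈f) = Star.map lift (reach w∈U) ◅◅ ((f , f∈F′ , w∈f , u∈f) ◅ ε)

        count : ∣ U′ ∣ + ∣ U ∩ edge H f ∣ ≡ ∣ U ∣ + k
        count = trans (∣∪∣+∣∩∣ U (edge H f)) (cong (∣ U ∣ +_) (unif f))

        1≤ : 1 ≤ ∣ U ∩ edge H f ∣
        1≤ = members⇒1≤ (x∈p∩q⁺ (w∈U , w∈f))

        total : ∀ c {x} → ∣ U ∩ edge H f ∣ ≡ c → ∣ U ∣ + ∣ F ∣ ≡ x → ∣ U′ ∣ + ∣ F′ ∣ + c ≡ suc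
          (x + k)
        total c {x} ≡c eq = begin
          ∣ U′ ∣ + ∣ F′ ∣ + c                 ≡⟨ cong₂ (λ a b → ∣ U′ ∣ + a + b) (insert-∉ f∉F)
            (sym ≡c) ⟩
          ∣ U′ ∣ + suc ∣ F ∣ + ∣ U ∩ edge H f ∣ ≡⟨ shuffle (∣ U′ ∣) (∣ F ∣) _ ⟩
          suc (∣ U′ ∣ + ∣ U ∩ edge H f ∣ + ∣ F ∣) ≡⟨ cong (λ a → suc (a + ∣ F ∣)) count ⟩
          suc (∣ U ∣ + k + ∣ F ∣)             ≡⟨ shuffle′ (∣ U ∣) k (∣ F ∣) ⟩
          suc (∣ U ∣ + ∣ F ∣ + k)             ≡⟨ cong (λ a → suc (a + k)) eq ⟩
          suc (x + k)                         ∎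
          where
          shuffle : ∀ a b c → a + suc b + c ≡ suc (a + c + b)
          shuffle a b c = trans (cong (_+ c) (ℕ.+-suc a b)) (cong suc (xy∙z≈xz∙y a b c))
          shuffle′ : ∀ a b c → suc (a + b + c) ≡ suc (a + c + b)
          shuffle′ a b c = cong suc (xy∙z≈xz∙y a b c)

        k*F′ : k * ∣ F ∣ + k ≡ k * ∣ F′ ∣
        k*F′ = trans (trans (ℕ.+-comm _ k) (sym (ℕ.*-suc k (∣ F ∣))))
          (cong (k *_) (sym (insert-∉ f∉F)))

        lift-cycle : ∃[ C ] InSet F C → ∃[ C ] InSet F′ C
        lift-cycle (C , C⊆F) = C , λ i → F⊆F′ (C⊆F i)

        new-cycle : 2 ≤ ∣ U ∩ edge H f ∣ → ∃[ C ] InSet F′ C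
        new-cycle 2≤ =
          let u , v , u∈ , v∈ , v≢u = two-members 2≤
              C , _ , _ , edges = closing (v≢u ∘ sym) u∈ v∈
          in C , λ i → inF′ (edges i)
          where
          inF′ : ∀ {e} → e ≡ f ⊎ e ∈ F → e ∈ F′
          inF′ (inj₁ refl) = f∈F′
          inF′ (inj₂ e∈F)  = F⊆F′ e∈F

        euler′ : ∀ c → ∣ U ∩ edge H f ∣ ≡ c →
          (∣ U ∣ + ∣ F ∣ ≡ suc (k * ∣ F ∣) × (∀ C → ¬ InSet F C)) ⊎
            (∣ U ∣ + ∣ F ∣ ≡ k * ∣ F ∣ × ∃[ C ] InSet F C) →
          (∣ U′ ∣ + ∣ F′ ∣ ≡ suc (k * ∣ F′ ∣) × (∀ C → ¬ InSet F′ C)) ⊎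
            (∣ U′ ∣ + ∣ F′ ∣ ≡ k * ∣ F′ ∣ × ∃[ C ] InSet F′ C)
        euler′ 0 eq _ = contradiction (subst (1 ≤_) eq 1≤) λ ()
        euler′ 1 eq (inj₁ (χ , acyclic)) = inj₁
          (ℕ.suc-injective (trans (ℕ.+-comm 1 _)
            (trans (total 1 eq χ) (cong (λ a → suc (suc a)) k*F′))) , 1≡⇒acyclic eq acyclic)
        euler′ 1 eq (inj₂ (χ , cycle))   = inj₂
          (ℕ.suc-injective (trans (ℕ.+-comm 1 _) (trans (total 1 eq χ) (cong suc k*F′))) ,
            lift-cycle cycle)
        euler′ 2 eq (inj₁ (χ , acyclic)) = inj₂
          (ℕ.suc-injective (ℕ.suc-injective (trans (ℕ.+-comm 2 _)
            (trans (total 2 eq χ) (cong (λ a → suc (suc a)) k*F′)))) ,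
           new-cycle (subst (2 ≤_) (sym eq) ℕ.≤-refl))
        euler′ 2 eq (inj₂ (χ , C , C⊆F)) = contradiction C⊆F
          (2≤⇒acyclic (subst (2 ≤_) (sym eq) ℕ.≤-refl) C)
        euler′ (suc (suc (suc c))) eq _  = contradiction
          (subst (3 ≤_) (sym eq) (s≤s (s≤s (s≤s z≤n)))) ≤2

    module _ (1≤k : 1 ≤ k) where

      -- `fuel` is the number of hyperedges still missing. When no hyperedge outside F touches U,
      -- connectedness makes U everything, and then F as well, since hyperedges are nonempty.
      saturate : ∀ fuel {F U} → Part F U → ∣ F ∣ + fuel ≡ size H → Part ⊤ ⊤
      saturate fuel {F} {U} part count
        with any? (λ f → any? (λ w → (¬? (f ∈? F)) ×-dec ((w ∈? U) ×-dec (w ∈? edge H f))))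
      saturate zero {F} {U} part count | yes (f , w , f∉F , w∈U , w∈f) =
        contradiction (subst (f ∈_) (sym (∣p∣≡n⇒p≡⊤ (trans (sym (ℕ.+-identityʳ _)) count))) ∈⊤) f∉F
      saturate (suc fuel) {F} {U} part count | yes (f , w , f∉F , w∈U , w∈f) =
        saturate fuel (grow part f∉F w∈U w∈f)
          (trans (cong (_+ fuel) (insert-∉ f∉F)) (trans (sym (ℕ.+-suc _ fuel)) count))
      saturate fuel {F} {U} part count | no stuck = subst₂ Part F≡⊤ U≡⊤ part
        where
        open Part part
        open ≡ using (subst₂)
        absorbed : ∀ {f w} → w ∈ U → w ∈ edge H f → f ∈ F
        absorbed {f} {w} w∈U w∈f with f ∈? F
        ... | yes f∈F = f∈F
        ... | no  f∉F = contradiction (f , w , f∉F , w∈U , w∈f) stuck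
        walk : ∀ {u v} → u ∈ U → Star (Adjacent H) u v → v ∈ U
        walk u∈U ε = u∈U
        walk u∈U ((e , u∈e , w∈e) ◅ as) = walk (covered (absorbed u∈U u∈e) w∈e) as
        allU : ∀ v → v ∈ U
        allU v = walk root∈ (proj₁ uni root v)
        U≡⊤ : U ≡ ⊤
        U≡⊤ = ⊆-antisym (λ _ → ∈⊤) (λ {v} _ → allU v)
        F≡⊤ : F ≡ ⊤
        F≡⊤ = ⊆-antisym (λ _ → ∈⊤) λ {f} _ →
          let w , w∈f = member {S = edge H f} (subst (1 ≤_) (sym (unif f)) 1≤k) in absorbed
                (allU w) w∈f

      -- The whole hypergraph contains the cycle, which selects the second alternative of `euler`: n
      -- = m(k - 1), written without subtraction.
      order-size : order H + size H ≡ k * size H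
      order-size with Part.euler (saturate (size H) start (cong (_+ size H) (∣⊥∣≡0 (size H))))
      ... | inj₁ (_ , acyclic) = contradiction (λ _ → ∈⊤) (acyclic C₀)
      ... | inj₂ (χ , _) = subst₂ (λ n m → n + m ≡ k * m) (∣⊤∣≡n (order H)) (∣⊤∣≡n (size H)) χ
        where open ≡ using (subst₂)

-- Disjoint pairs of hyperedges and the sum of squared degrees

module Disjointness where

  open import Data.Nat.Base using (_+_; _*_; _≤_; z≤n; s≤s)

  open ≡ using (refl; sym; trans; cong; cong₂; subst; module ≡-Reasoning)
  open Counting
  open Subsets

  sum-mono : ∀ {n} {f g : Fin n → ℕ} → (∀ i → f i ≤ g i) → sum f ≤ sum g
  sum-mono {zero}  {f} {g} f≤g = ℕ.≤-reflexive (trans (sum-empty f) (sym (sum-empty g)))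
  sum-mono {suc n} {f} {g} f≤g = begin
    sum f                      ≡⟨ sum-suc f ⟩
    f zero + sum (f ∘ suc)     ≤⟨ ℕ.+-mono-≤ (f≤g zero) (sum-mono (f≤g ∘ suc)) ⟩
    g zero + sum (g ∘ suc)     ≡⟨ sum-suc g ⟨
    sum g                      ∎
    where open ℕ.≤-Reasoning

  -- If one term of g were larger, monotonicity of the remaining sums would make its total larger
  -- too.
  sum-tight : ∀ {n} {f g : Fin n → ℕ} → (∀ i → f i ≤ g i) → sum g ≤ sum f → ∀ i → g i ≤ f i
  sum-tight {suc n} {f} {g} f≤g g≤f i = ℕ.+-cancelʳ-≤ (sum (f ∘ Fin.punchIn i)) (g i) (f i) (begin
    g i + sum (f ∘ Fin.punchIn i)  ≤⟨ ℕ.+-monoʳ-≤ (g i) (sum-mono (f≤g ∘ Fin.punchIn i)) ⟩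
    g i + sum (g ∘ Fin.punchIn i)  ≡⟨ sum-remove i g ⟨
    sum g                          ≤⟨ g≤f ⟩
    sum f                          ≡⟨ sum-remove i f ⟩
    f i + sum (f ∘ Fin.punchIn i)  ∎)
    where open ℕ.≤-Reasoning

  term≤sum : ∀ {n} (f : Fin n → ℕ) i → f i ≤ sum f
  term≤sum {suc n} f i = subst (f i ≤_) (sym (sum-remove i f)) (ℕ.m≤m+n _ _)

  member? : ∀ {g m} (t : Fin g → Fin m) e → (∃[ i ] t i ≡ e) ⊎ (∀ i → t i ≢ e)
  member? t e with any? (λ i → t i ≟ᶠ e)
  ... | yes found = inj₁ found
  ... | no  none  = inj₂ λ i eq → none (i , eq)

  -- A 0-1 weight, so that sums over the indices off t remain sums over all of `Fin m`.
  outside : ∀ {g m} → (Fin g → Fin m) → Fin m → ℕ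
  outside t e = ind (does (¬? (any? λ i → t i ≟ᶠ e)))

  outside-no : ∀ {g m} (t : Fin g → Fin m) {e} i → t i ≡ e → outside t e ≡ 0
  outside-no t {e} i eq = cong ind (dec-false (¬? (any? λ i → t i ≟ᶠ e)) λ none → none (i , eq))

  outside-yes : ∀ {g m} (t : Fin g → Fin m) {e} → (∀ i → t i ≢ e) → outside t e ≡ 1
  outside-yes t {e} none = cong ind (dec-true (¬? (any? λ i → t i ≟ᶠ e)) λ (i , eq) → none i eq)

  outside-weight : ∀ {g m} (t : Fin g → Fin m) (f : Fin m → ℕ) →
    (∀ {e} → (∀ i → t i ≢ e) → 1 ≤ f e) → ∀ e → outside t e ≤ outside t e * f e
  outside-weight t f 1≤f e with any? (λ i → t i ≟ᶠ e)
  ... | yes _   = z≤n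
  ... | no none = subst (1 ≤_) (sym (ℕ.+-identityʳ (f e))) (1≤f λ i eq → none (i , eq))

  -- By injectivity every index is hit by exactly one i, or by none, and then the `outside` weight
  -- takes over.
  sum-split : ∀ {g m} (t : Fin g → Fin m) → Injective _≡_ _≡_ t → (f : Fin m → ℕ) →
              sum f ≡ sum (λ i → f (t i)) + sum (λ e → outside t e * f e)
  sum-split t inj f = begin
    sum f
      ≡⟨ sum-cong pointwise ⟩
    sum (λ e → sum (λ i → ind (does (t i ≟ᶠ e)) * f e) + outside t e * f e)
      ≡⟨ sum-+ _ _ ⟩
    sum (λ e → sum (λ i → ind (does (t i ≟ᶠ e)) * f e)) + sum (λ e → outside t e * f e)
      ≡⟨ cong (_+ sum (λ e → outside t e * f e))
        (trans (sum-comm _) (sum-cong λ i → sum-δ (t i) f)) ⟩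
    sum (λ i → f (t i)) + sum (λ e → outside t e * f e) ∎
    where
    open ≡-Reasoning
    pointwise : ∀ e → f e ≡ sum (λ i → ind (does (t i ≟ᶠ e)) * f e) + outside t e * f e
    pointwise e with any? (λ i → t i ≟ᶠ e)
    ... | yes (i , refl) = sym (trans (ℕ.+-identityʳ _) (trans
          (sum-single i _ λ j j≢i → cong (_* f e) (ind-≢ (j≢i ∘ inj)))
          (trans (cong (_* f e) (ind-refl (t i))) (ℕ.*-identityˡ _))))
    ... | no none = sym (trans (cong (_+ (f e + 0))
      (sum-zero λ i → cong (_* f e) (ind-≢ λ eq → none (i , eq)))) (ℕ.+-identityʳ (f e)))

  sum-outside : ∀ {g m} (t : Fin g → Fin m) → Injective _≡_ _≡_ t → g + sum (outside t) ≡ m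
  sum-outside {g} {m} t inj = begin
    g + sum (outside t)
      ≡⟨ cong₂ _+_ (trans (sum-const g 1) (ℕ.*-identityʳ g)) (sum-cong λ e → ℕ.*-identityʳ _) ⟨
    sum {g} (λ _ → 1) + sum (λ e → outside t e * 1)
      ≡⟨ sum-split t inj (λ _ → 1) ⟨
    sum {m} (λ _ → 1)
      ≡⟨ trans (sum-const m 1) (ℕ.*-identityʳ m) ⟩
    m ∎
    where open ≡-Reasoning

  module _ (H : Hypergraph) where

    Meet : Fin (size H) → Fin (size H) → Set
    Meet e f = ∃[ v ] (v ∈ edge H e × v ∈ edge H f)

    meet? : ∀ e f → Dec (Meet e f)
    meet? e f = any? λ v → (v ∈? edge H e) ×-dec (v ∈? edge H f)

    disjoint : Fin (size H) → Fin (size H) → ℕ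
    disjoint e f = ind (does (¬? (meet? e f)))

    disjoint-no : ∀ {e f} → Meet e f → disjoint e f ≡ 0
    disjoint-no {e} {f} meet = cong ind (dec-false (¬? (meet? e f)) λ none → none meet)

    disjoint-yes : ∀ {e f} → ¬ Meet e f → disjoint e f ≡ 1
    disjoint-yes {e} {f} none = cong ind (dec-true (¬? (meet? e f)) none)

    disjoint≤0 : ∀ {e f} → disjoint e f ≤ 0 → Meet e f
    disjoint≤0 {e} {f} d≤0 with meet? e f
    ... | yes meet = meet
    ... | no  _    = contradiction d≤0 λ ()

    disjoint-comm : ∀ e f → disjoint e f ≡ disjoint f e
    disjoint-comm e f with meet? f e
    ... | yes (v , v∈f , v∈e) = disjoint-no (v , v∈e , v∈f)
    ... | no  none            = disjoint-yes λ (v , v∈e , v∈f) → none (v , v∈f , v∈e)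

    -- Ordered pairs; the diagonal contributes nothing as long as hyperedges are nonempty.
    disjointPairs : ℕ
    disjointPairs = sum λ e → sum λ f → disjoint e f

    -- By linearity a pair e ≠ f has either one common vertex or is disjoint, so it contributes 1 in
    -- total; a pair e = f contributes its size, 1 + k.
    degree²-disjointPairs : ∀ {k} → Uniform (suc k) H → Linear H →
      sum (λ v → degree H v * degree H v) + disjointPairs ≡ size H * (size H + k)
    degree²-disjointPairs {k} unif lin = begin
      sum (λ v → degree H v * degree H v) + disjointPairs
        ≡⟨ cong (_+ disjointPairs) (sum-degree² H) ⟩
      sum (λ e → sum λ f → ∣ edge H e ∩ edge H f ∣) + disjointPairs
        ≡⟨ trans (sym (sum-+ _ _)) (sum-cong λ e → sym (sum-+ _ _)) ⟩
      sum (λ e → sum λ f → ∣ edge H e ∩ edge H f ∣ + disjoint e f)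
        ≡⟨ sum-cong (λ e → trans (sum-cong (pointwise e)) (trans (sum-+ _ _)
             (cong₂ _+_ (trans (sum-const (size H) 1) (ℕ.*-identityʳ _)) (sum-δ e (λ _ → k))))) ⟩
      sum {size H} (λ e → size H + k)
        ≡⟨ sum-const (size H) _ ⟩
      size H * (size H + k) ∎
      where
      open ≡-Reasoning
      pointwise : ∀ e f → ∣ edge H e ∩ edge H f ∣ + disjoint e f ≡ 1 + ind (does (e ≟ᶠ f)) * k
      pointwise e f with e ≟ᶠ f
      ... | yes refl = cong₂ _+_ (trans (cong ∣_∣ (∩-idem (edge H e))) (unif e))
        (disjoint-no (v , v∈e , v∈e))
        where
        v∃ = member {S = edge H e} (subst (1 ≤_) (sym (unif e)) (s≤s z≤n))
        v = proj₁ v∃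
        v∈e = proj₂ v∃
      ... | no e≢f with ∣ edge H e ∩ edge H f ∣ in eq | lin e f e≢f
      ...   | 0 | _ = disjoint-yes λ (v , v∈e , v∈f) →
                contradiction (subst (1 ≤_) eq (members⇒1≤ (x∈p∩q⁺ (v∈e , v∈f)))) λ ()
      ...   | 1 | _ = cong suc (disjoint-no
                (let v , v∈ = member (subst (1 ≤_) (sym eq) ℕ.≤-refl) in v , x∈p∩q⁻ (edge H e)
                  (edge H f) v∈))
      ...   | suc (suc _) | s≤s ()

    module _ {g} (t : Fin g → Fin (size H)) where

      missed : Fin (size H) → ℕ
      missed e = sum λ i → disjoint e (t i)

      missedBy : Fin (size H) → ℕ
      missedBy e = sum λ f → outside t f * disjoint e f

      -- A block decomposition along t. By symmetry the two mixed blocks coincide, so each miss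
      -- between t and the rest counts twice.
      disjointPairs-split : Injective _≡_ _≡_ t → disjointPairs ≡
        (sum (λ i → missed (t i)) + sum (λ e → outside t e * missed e)) +
        (sum (λ e → outside t e * missed e) + sum (λ e → outside t e * missedBy e))
      disjointPairs-split inj = begin
        disjointPairs
          ≡⟨ sum-cong (λ e → sum-split t inj (disjoint e)) ⟩
        sum (λ e → missed e + missedBy e)
          ≡⟨ sum-split t inj _ ⟩
        sum (λ i → missed (t i) + missedBy (t i)) + sum
          (λ e → outside t e * (missed e + missedBy e))
          ≡⟨ cong₂ _+_ (trans (sum-+ _ _) (cong (sum (λ i → missed (t i)) +_) swap))
               (trans (sum-cong λ e → ℕ.*-distribˡ-+ (outside t e) _ _) (sum-+ _ _)) ⟩
        (sum (λ i → missed (t i)) + sum (λ e → outside t e * missed e)) +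
        (sum (λ e → outside t e * missed e) + sum (λ e → outside t e * missedBy e)) ∎
        where
        open ≡-Reasoning
        swap : sum (λ i → missedBy (t i)) ≡ sum (λ e → outside t e * missed e)
        swap = trans (sum-comm _) (sum-cong λ e → trans
          (sum-cong λ i → cong (outside t e *_) (disjoint-comm (t i) e)) (sum-*ˡ (outside t e) _))

-- Few disjoint pairs force a triangle with all other hyperedges at one corner

module Suns where

  open import Data.Nat.Base using (_+_; _*_; _≤_; s≤s)
  open ≡ using (refl; sym; trans; cong; cong₂; subst)
  open Counting
  open Subsets
  open Cycles
  open Order
  open Disjointness
  open Cycle

  third : ∀ (i j : Fin 3) → ∃[ k ] (k ≢ i × k ≢ j)
  third = from-yes (Fin.all? {n = 3} λ i → Fin.all? λ j → any? λ k → ¬? (k ≟ᶠ i) ×-dec ¬? (k ≟ᶠ j))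

  third-unique : ∀ (i j k l : Fin 3) → i ≢ j → k ≢ i → k ≢ j → l ≢ i → l ≢ j → k ≡ l
  third-unique = from-yes (Fin.all? {n = 3} λ i → Fin.all? λ j → Fin.all? λ k → Fin.all? λ l →
    ¬? (i ≟ᶠ j) →-dec (¬? (k ≟ᶠ i) →-dec (¬? (k ≟ᶠ j) →-dec
      (¬? (l ≟ᶠ i) →-dec (¬? (l ≟ᶠ j) →-dec (k ≟ᶠ l))))))

  -- A triangle with hyperedges t i, whose vertex w i lies opposite t i, and
  -- any number of further hyperedges attached at w 0.
  record Sun (H : Hypergraph) : Set where
    field
      t       : Fin 3 → Fin (size H)
      w       : Fin 3 → Fin (order H)
      t-inj   : Injective _≡_ _≡_ t
      on      : ∀ {i j} → i ≢ j → w i ∈ edge H (t j)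
      off     : ∀ i → w i ∉ edge H (t i)
      hub     : ∀ {e} → (∀ j → t j ≢ e) → w zero ∈ edge H e
      rim     : ∀ {e} → (∀ j → t j ≢ e) → ∀ i → i ≢ zero → w i ∉ edge H e
      private-vertex : ∀ {v e f} → e ≢ f → v ∈ edge H e → v ∈ edge H f → ∃[ i ] w i ≡ v
      cover   : ∀ v → ∃[ e ] v ∈ edge H e

  module _ {H : Hypergraph} (lin : Linear H) where

    private
      same-vertex : ∀ {e f} → e ≢ f → ∀ {u v} →
        u ∈ edge H e → u ∈ edge H f → v ∈ edge H e → v ∈ edge H f → u ≡ v
      same-vertex = linear-unique {H} lin

    -- If z is not on e, the three meeting points are distinct: x = y would lie on a and b and hence
    -- be z. So a, b and e form a triangle.
    pinch : ∀ {a b e x y z} → a ≢ b → e ≢ a → e ≢ b →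
      z ∈ edge H a → z ∈ edge H b → x ∈ edge H e → x ∈ edge H a → y ∈ edge H e → y ∈ edge H b →
      z ∈ edge H e ⊎ ∃[ C ] ((∃[ i ] cedge {H} C i ≡ e) ×
        (∀ i → cedge C i ≡ a ⊎ cedge C i ≡ b ⊎ cedge C i ≡ e))
    pinch {a} {b} {e} {x} {y} {z} a≢b e≢a e≢b za zb xe xa ye yb with z ∈? edge H e
    ... | yes ze = inj₁ ze
    ... | no ¬ze = inj₂
          ( triangle H a b e x z y a≢b (e≢b ∘ sym) (e≢a ∘ sym)
              (λ { refl → ¬ze xe }) (λ { refl → ¬ze ye })
              (λ { refl → ¬ze (subst (_∈ edge H e) (same-vertex a≢b xa yb za zb) xe) })
              xe xa za zb yb ye
          , (suc (suc zero) , refl)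
          , λ { zero → inj₁ refl ; (suc zero) → inj₂ (inj₁ refl) ; (suc (suc zero)) →
            inj₂ (inj₂ refl) })

    module _ (uni : Unicyclic H) where

      -- Three consecutive hyperedges of the cycle with the two vertices between them. Whether the
      -- outer two meet is left open, as the cycle may be longer than a triangle.
      record Arc : Set where
        field
          C    : Cycle H
          t    : Fin 3 → Fin (size H)
          t∈C  : ∀ i → ∃[ j ] cedge C j ≡ t i
          t-inj : Injective _≡_ _≡_ t
          v₁ v₂ : Fin (order H)
          v₁≢v₂ : v₁ ≢ v₂
          v₁∈t₀ : v₁ ∈ edge H (t zero)
          v₁∈t₁ : v₁ ∈ edge H (t (suc zero))
          v₂∈t₁ : v₂ ∈ edge H (t (suc zero))
          v₂∈t₂ : v₂ ∈ edge H (t (suc (suc zero)))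

      -- Linearity rules out length two, where the hyperedges would share both vertices; from length
      -- three on, the first three hyperedges serve.
      arc : Arc
      arc = from (proj₁ (proj₂ uni))
        where
        from : Cycle H → Arc
        from record { extra = zero ; cvert = cv ; cedge = ce ; cvert-distinct = cv-inj ;
          cedge-distinct = ce-inj ; here∈ = here∈ ; next∈ = next∈ } =
          contradiction (cv-inj (same-vertex {ce zero} {ce (suc zero)} (λ eq → case (ce-inj eq))
            (here∈ zero) (next∈ (suc zero)) (next∈ zero) (here∈ (suc zero)))) λ ()
          where
          case : zero ≢ suc {1} zero
          case ()
        from C@record { extra = suc x ; cvert = cv ; cedge = ce ; cvert-distinct = cv-inj ;
          cedge-distinct = ce-inj ; here∈ = here∈ ; next∈ = next∈ } = record
          { C = C
          ; t = λ i → ce (i Fin.↑ˡ x)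
          ; t∈C = λ i → i Fin.↑ˡ x , refl
          ; t-inj = λ eq → Fin.↑ˡ-injective x _ _ (ce-inj eq)
          ; v₁ = cv (suc zero)
          ; v₂ = cv (suc (suc zero))
          ; v₁≢v₂ = λ eq → case (cv-inj eq)
          ; v₁∈t₀ = subst (λ i → cv i ∈ edge H (ce zero)) (next-inject₁ zero) (next∈ zero)
          ; v₁∈t₁ = here∈ (suc zero)
          ; v₂∈t₁ = subst (λ i → cv i ∈ edge H (ce (suc zero))) (next-inject₁ (suc zero))
            (next∈ (suc zero))
          ; v₂∈t₂ = here∈ (suc (suc zero))
          }
          where
          case : suc zero ≢ suc {suc (suc x)} (suc zero)
          case ()

      module FromArc (arc : Arc) where

        open Arc arc

        private
          t₀ = t zero
          t₁ = t (suc zero)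
          t₂ = t (suc (suc zero))

          t≢ : ∀ {i j} → i ≢ j → t i ≢ t j
          t≢ i≢j eq = i≢j (t-inj eq)

          t∈cycle : ∀ C′ i → ∃[ j ] t i ≡ cedge C′ j
          t∈cycle C′ i = let j , eq = t∈C i ; l , eq′ = edge-transfer uni C C′ j in l , trans
                               (sym eq) eq′

        Outside : Fin (size H) → Set
        Outside e = ∀ j → t j ≢ e

        -- The other alternative of `pinch` is a triangle made of a, b and e. It avoids `t l`,
        -- although every cycle contains the whole arc.
        forced : ∀ {a b e x y z} l → t l ≢ a → t l ≢ b → t l ≢ e → a ≢ b → e ≢ a → e ≢ b →
          z ∈ edge H a → z ∈ edge H b → x ∈ edge H e → x ∈ edge H a → y ∈ edge H e → y ∈ edge H b →
          z ∈ edge H e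
        forced l l≢a l≢b l≢e a≢b e≢a e≢b za zb xe xa ye yb =
          Sum.[ id , (λ (C′ , _ , edges) → let j , eq = t∈cycle C′ l in
            contradiction (edges j) Sum.[ l≢a ∘ trans eq , Sum.[ l≢b ∘ trans eq , l≢e ∘ trans eq ]
              ]) ]
            (pinch a≢b e≢a e≢b za zb xe xa ye yb)

        -- Meeting t₀ and t₁ forces v₁ into e, since the triangle otherwise formed omits t₂;
        -- likewise t₁ and t₂ force v₂. Then e shares two vertices with t₁.
        misses-one : ∀ e → Outside e → ¬ (∀ i → Meet H e (t i))
        misses-one e out meets =
          let a , ae , a₀ = meets zero
              b , be , b₁ = meets (suc zero)
              c , ce , c₂ = meets (suc (suc zero))
          in v₁≢v₂ (same-vertex (out (suc zero)) v₁∈t₁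
               (forced (suc (suc zero)) (t≢ λ ()) (t≢ λ ()) (out _) (t≢ λ ()) (out _ ∘ sym)
                 (out _ ∘ sym) v₁∈t₀ v₁∈t₁ ae a₀ be b₁)
               v₂∈t₁
               (forced zero (t≢ λ ()) (t≢ λ ()) (out _) (t≢ λ ()) (out _ ∘ sym) (out _ ∘ sym)
                 v₂∈t₁ v₂∈t₂ be b₁ ce c₂))

        misses-some : ∀ {e} → Outside e → ∃[ c ] ¬ Meet H e (t c)
        misses-some {e} out = Fin.¬∀⟶∃¬ 3 _ (λ i → meet? H e (t i)) (misses-one e out)

        -- Every hyperedge outside the arc misses one of its members, so already
        -- these pairs account for all that few disjoint pairs allow.
        module _ {o} (3+o≡m : 3 + o ≡ size H) (few : disjointPairs H ≤ o + o) where

          private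
            o≡ : sum (outside t) ≡ o
            o≡ = ℕ.+-cancelˡ-≡ 3 _ _ (trans (sum-outside t t-inj) (sym 3+o≡m))

            -- The numbers of disjoint pairs inside the arc, between the arc and the rest, and
            -- within the rest. From A + 2S + P ≤ 2o and S ≥ o follow A = P = 0 and S = o.
            A = sum (λ i → missed H t (t i))
            S = sum (λ e → outside t e * missed H t e)
            P = sum (λ e → outside t e * missedBy H t e)

            outside≤ : ∀ e → outside t e ≤ outside t e * missed H t e
            outside≤ = outside-weight t (missed H t) 1≤missed
              where
              1≤missed : ∀ {e} → Outside e → 1 ≤ missed H t e
              1≤missed {e} out = let i , ¬m = misses-some out in
                subst (_≤ missed H t e) (disjoint-yes H ¬m) (term≤sum (λ i → disjoint H e (t i)) i)

            o≤S : o ≤ S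
            o≤S = subst (_≤ S) o≡ (sum-mono outside≤)

            total : (A + S) + (S + P) ≤ o + o
            total = subst (_≤ o + o) (disjointPairs-split H t t-inj) few

            A+S≤o : A + S ≤ o
            A+S≤o = ℕ.+-cancelʳ-≤ o (A + S) o
              (ℕ.≤-trans (ℕ.+-monoʳ-≤ (A + S) (ℕ.≤-trans o≤S (ℕ.m≤m+n S P))) total)

            S+P≤o : S + P ≤ o
            S+P≤o = ℕ.+-cancelˡ-≤ o (S + P) o
              (ℕ.≤-trans (ℕ.+-monoˡ-≤ (S + P) (ℕ.≤-trans o≤S (ℕ.m≤n+m S A))) total)

            A≤0 : A ≤ 0
            A≤0 = ℕ.+-cancelʳ-≤ S A 0 (ℕ.≤-trans A+S≤o o≤S)

            P≤0 : P ≤ 0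
            P≤0 = ℕ.+-cancelˡ-≤ S P 0 (ℕ.≤-trans S+P≤o
              (ℕ.≤-trans o≤S (ℕ.≤-reflexive (sym (ℕ.+-identityʳ S)))))

            S≤o : S ≤ sum (outside t)
            S≤o = ℕ.≤-trans (ℕ.m≤m+n S P) (ℕ.≤-trans S+P≤o (ℕ.≤-reflexive (sym o≡)))

          opaque
            meet-t : ∀ i j → Meet H (t i) (t j)
            meet-t i j = disjoint≤0 H (ℕ.≤-trans (term≤sum (λ j → disjoint H (t i) (t j)) j)
              (ℕ.≤-trans (term≤sum (λ i → missed H t (t i)) i) A≤0))

          -- S equals its lower bound, so no term may exceed its own bound of one miss.
          missed≤1 : ∀ {e} → Outside e → missed H t e ≤ 1
          missed≤1 {e} out = subst (λ o → o * missed H t e ≤ o) (outside-yes t out)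
            (sum-tight outside≤ S≤o e) ∙ʳ
            where
            _∙ʳ : 1 * missed H t e ≤ 1 → missed H t e ≤ 1
            le ∙ʳ = subst (_≤ 1) (ℕ.*-identityˡ _) le

          meet-outside : ∀ {e f} → Outside e → Outside f → Meet H e f
          meet-outside {e} {f} oute outf = disjoint≤0 H (begin
            disjoint H e f                  ≡⟨ ℕ.*-identityˡ _ ⟨
            1 * disjoint H e f              ≡⟨ cong (_* disjoint H e f) (outside-yes t outf) ⟨
            outside t f * disjoint H e f    ≤⟨ term≤sum (λ f → outside t f * disjoint H e f) f ⟩
            missedBy H t e                  ≡⟨ ℕ.*-identityˡ _ ⟨
            1 * missedBy H t e              ≡⟨ cong (_* missedBy H t e) (outside-yes t oute) ⟨
            outside t e * missedBy H t e    ≤⟨ term≤sum (λ e → outside t e * missedBy H t e) e ⟩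
            P                               ≤⟨ P≤0 ⟩
            0                               ∎)
            where open ℕ.≤-Reasoning

          private
            -- A = 0 makes the two ends of the arc meet, which closes it to a triangle.
            v₀ = proj₁ (meet-t zero (suc (suc zero)))
            v₀∈t₀ = proj₁ (proj₂ (meet-t zero (suc (suc zero))))
            v₀∈t₂ = proj₂ (proj₂ (meet-t zero (suc (suc zero))))

          -- Listed so that `w i` is the corner opposite `t i`.
          w : Fin 3 → Fin (order H)
          w = lookup (v₂ ∷ v₀ ∷ v₁ ∷ [])

          on : ∀ {i j} → i ≢ j → w i ∈ edge H (t j)
          on {zero}         {zero}         i≢j = contradiction refl i≢j
          on {zero}         {suc zero}     i≢j = v₂∈t₁
          on {zero}         {suc (suc zero)} i≢j = v₂∈t₂
          on {suc zero}     {zero}         i≢j = v₀∈t₀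
          on {suc zero}     {suc zero}     i≢j = contradiction refl i≢j
          on {suc zero}     {suc (suc zero)} i≢j = v₀∈t₂
          on {suc (suc zero)} {zero}         i≢j = v₁∈t₀
          on {suc (suc zero)} {suc zero}     i≢j = v₁∈t₁
          on {suc (suc zero)} {suc (suc zero)} i≢j = contradiction refl i≢j

          off : ∀ i → w i ∉ edge H (t i)
          off zero           v₂∈t₀ = v₁≢v₂ (same-vertex (t≢ λ ()) v₁∈t₀ v₁∈t₁ v₂∈t₀ v₂∈t₁)
          off (suc zero)     v₀∈t₁ = v₁≢v₂ (trans (same-vertex (t≢ λ ()) v₁∈t₀ v₁∈t₁ v₀∈t₀ v₀∈t₁)
                                                  (same-vertex (t≢ λ ()) v₀∈t₁ v₀∈t₂ v₂∈t₁ v₂∈t₂))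
          off (suc (suc zero)) v₁∈t₂ = v₁≢v₂ (same-vertex (t≢ λ ()) v₁∈t₁ v₁∈t₂ v₂∈t₁ v₂∈t₂)

          w≢ : ∀ {i j} → i ≢ j → w i ≢ w j
          w≢ {i} {j} i≢j eq = off j (subst (_∈ edge H (t j)) eq (on i≢j))

          T : Cycle H
          T = triangle H t₀ t₁ t₂ v₀ v₁ v₂ (t≢ λ ()) (t≢ λ ()) (t≢ λ ())
                (w≢ {suc zero} {suc (suc zero)} λ ()) v₁≢v₂ (w≢ {suc zero} {zero} λ ())
                v₀∈t₂ v₀∈t₀ v₁∈t₀ v₁∈t₁ v₂∈t₁ v₂∈t₂

          -- Every cycle has the hyperedges of the triangle `T`, so from here on any cycle through
          -- an outside hyperedge is a contradiction.
          cycle⊆t : ∀ C′ i → ∃[ j ] t j ≡ cedge C′ i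
          cycle⊆t C′ i with edge-transfer uni C′ T i
          ... | zero           , eq = zero , sym eq
          ... | suc zero       , eq = suc zero , sym eq
          ... | suc (suc zero) , eq = suc (suc zero) , sym eq

          pinched : ∀ {a b e x y z} → a ≢ b → e ≢ a → e ≢ b → Outside e →
            z ∈ edge H a → z ∈ edge H b → x ∈ edge H e → x ∈ edge H a → y ∈ edge H e →
              y ∈ edge H b →
            z ∈ edge H e
          pinched {e = e} a≢b e≢a e≢b out za zb xe xa ye yb =
            Sum.[ id , (λ (C′ , (i , eq) , _) → contradiction (trans (proj₂ (cycle⊆t C′ i)) eq)
              (out _)) ]
              (pinch a≢b e≢a e≢b za zb xe xa ye yb)

          corner : ∀ {e i j k} → Outside e → i ≢ j → k ≢ i → k ≢ j →
                   Meet H e (t i) → Meet H e (t j) → w k ∈ edge H e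
          corner {i = i} {j} out i≢j k≢i k≢j (x , xe , xi) (y , ye , yj) =
            pinched (t≢ i≢j) (out i ∘ sym) (out j ∘ sym) out (on k≢i) (on k≢j) xe xi ye yj

          -- An outside hyperedge misses just one side `t c` and meets the other two, so it passes
          -- through their common corner, which is `w c`.
          some-hub : ∀ {e} → Outside e → ∃[ c ] w c ∈ edge H e
          some-hub {e} out =
            let i , i≢c , _   = third c c
                j , j≢c , j≢i = third c i
            in c , corner out (j≢i ∘ sym) (i≢c ∘ sym) (j≢c ∘ sym) (meets i i≢c) (meets j j≢c)
            where
            c  = proj₁ (misses-some out)
            ¬m = proj₂ (misses-some out)
            meets : ∀ i → i ≢ c → Meet H e (t i)
            meets i i≢c with meet? H e (t i)
            ... | yes m = m
            ... | no ¬mᵢ = contradiction (begin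
              2                                             ≡⟨ cong₂ _+_ (disjoint-yes H ¬m)
                (disjoint-yes H ¬mᵢ) ⟨
              disjoint H e (t c) + disjoint H e (t i)       ≡⟨ cong
                (λ l → disjoint H e (t c) + disjoint H e (t l)) (Fin.punchIn-punchOut (i≢c ∘ sym)) ⟨
              disjoint H e (t c) + disjoint H e (t (Fin.punchIn c (Fin.punchOut (i≢c ∘ sym))))
                ≤⟨ ℕ.+-monoʳ-≤ (disjoint H e (t c))
                  (term≤sum (λ l → disjoint H e (t (Fin.punchIn c l))) _) ⟩
              disjoint H e (t c) + sum (λ l → disjoint H e (t (Fin.punchIn c l))) ≡⟨ sum-remove c
                (λ l → disjoint H e (t l)) ⟨
              missed H t e                                  ≤⟨ missed≤1 out ⟩
              1                                             ∎) λ { (s≤s ()) }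
              where open ℕ.≤-Reasoning

          -- If c and d differed, e, f and the side `t j` through both corners would meet pairwise.
          -- As they may not form a new triangle, f contains `w c` as well as `w d` and so shares
          -- two vertices with `t j`.
          same-hub : ∀ {e f c d} → Outside e → Outside f → w c ∈ edge H e → w d ∈ edge H f → c ≡ d
          same-hub {e} {f} {c} {d} oute outf c∈e d∈f with c ≟ᶠ d
          ... | yes c≡d = c≡d
          ... | no  c≢d = contradiction
                (same-vertex (outf j) (on (j≢c ∘ sym)) c∈f (on (j≢d ∘ sym)) d∈f) (w≢ c≢d)
            where
            j = proj₁ (third c d)
            j≢c = proj₁ (proj₂ (third c d))
            j≢d = proj₂ (proj₂ (third c d))
            c∈f : w c ∈ edge H f
            c∈f with f ≟ᶠ e
            ... | yes refl = c∈e
            ... | no  f≢e  = let y , ye , yf = meet-outside oute outf in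
                  pinched (oute j) (outf j ∘ sym) f≢e outf (on (j≢c ∘ sym)) c∈e d∈f
                    (on (j≢d ∘ sym)) yf ye

          -- With no outside hyperedge any corner will do; otherwise one of them fixes the corner
          -- for all.
          centre : ∃[ c ] (∀ {e} → Outside e → w c ∈ edge H e)
          centre with any? (λ e → ¬? (any? λ j → t j ≟ᶠ e))
          ... | no none = zero , λ {e} out → contradiction (e , λ (j , eq) → out j eq) none
          ... | yes (e , oute) =
            let out = λ j eq → oute (j , eq)
                c , c∈e = some-hub out
            in c , λ {f} outf → let d , d∈f = some-hub outf in
                   subst (λ i → w i ∈ edge H f) (sym (same-hub {c = c} {d} out outf c∈e d∈f)) d∈f

          sun : Sun H
          sun = record
            { t = t′ ; w = w′
            ; t-inj = σ-inj ∘ t-inj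
            ; on = λ i≢j → on (i≢j ∘ σ-inj)
            ; off = λ i → off (σ i)
            ; hub = λ out → hub′ (outside′ out)
            ; rim = λ out → rim′ (outside′ out)
            ; private-vertex = private′
            ; cover = cover′
            }
            where
            c = proj₁ centre
            -- The corner shared by the outside hyperedges is renamed to index `zero`, as `Sun`
            -- requires.
            π = Perm.transpose zero c
            σ = π Perm.⟨$⟩ʳ_
            t′ = t ∘ σ
            w′ = w ∘ σ

            σ-inj : ∀ {i j} → σ i ≡ σ j → i ≡ j
            σ-inj eq = trans (sym (Perm.inverseˡ π))
              (trans (cong (π Perm.⟨$⟩ˡ_) eq) (Perm.inverseˡ π))

            σ≢ : ∀ {i j} → i ≢ j → σ i ≢ σ j
            σ≢ i≢j = i≢j ∘ σ-inj

            on′ : ∀ i j → i ≢ j → w′ i ∈ edge H (t′ j)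
            on′ i j i≢j = on (σ≢ i≢j)

            outside′ : ∀ {e} → (∀ j → t′ j ≢ e) → Outside e
            outside′ {e} out j eq = out (π Perm.⟨$⟩ˡ j) (trans (cong t (Perm.inverseʳ π)) eq)

            hub′ : ∀ {e} → Outside e → w′ zero ∈ edge H e
            hub′ = proj₂ centre

            rim′ : ∀ {e} → Outside e → ∀ i → i ≢ zero → w′ i ∉ edge H e
            rim′ {e} out i i≢0 i∈e =
              let j , j≢i , j≢0 = third i zero in
              w≢ (σ≢ i≢0) (same-vertex (out (σ j)) (on (σ≢ (j≢i ∘ sym))) i∈e (on (σ≢ (j≢0 ∘ sym)))
                (hub′ out))

            -- Meeting the side opposite the hub, besides another side at the hub, would force a
            -- second corner onto f. On the two sides through the hub the common vertex is the hub
            -- itself, by linearity.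
            mixed : ∀ {v f} i → Outside f → v ∈ edge H (t′ i) → v ∈ edge H f → ∃[ i ] w′ i ≡ v
            mixed zero    out v∈t v∈f = contradiction
              (corner {i = σ zero} {σ (suc zero)} {σ (suc (suc zero))} out
                (σ≢ {zero} {suc zero} λ ()) (σ≢ {suc (suc zero)} {zero} λ ())
                  (σ≢ {suc (suc zero)} {suc zero} λ ())
                (_ , v∈f , v∈t) (_ , hub′ out , on′ zero (suc zero) λ ()))
              (rim′ out (suc (suc zero)) λ ())
            mixed (suc i) out v∈t v∈f =
              zero , same-vertex (out (σ (suc i))) (on′ zero (suc i) λ ()) (hub′ out) v∈t v∈f

            private′ : ∀ {v e f} → e ≢ f → v ∈ edge H e → v ∈ edge H f → ∃[ i ] w′ i ≡ v
            private′ {v} {e} {f} e≢f v∈e v∈f = cases (member? t′ e) (member? t′ f)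
              where
              cases : (∃[ i ] t′ i ≡ e) ⊎ (∀ i → t′ i ≢ e) → (∃[ i ] t′ i ≡ f) ⊎ (∀ i → t′ i ≢ f)
                → ∃[ i ] w′ i ≡ v
              cases (inj₁ (i , refl)) (inj₁ (j , refl)) =
                let k , k≢i , k≢j = third i j in
                k , same-vertex e≢f (on (σ≢ k≢i)) (on (σ≢ k≢j)) v∈e v∈f
              cases (inj₁ (i , refl)) (inj₂ outf) = mixed i (outside′ outf) v∈e v∈f
              cases (inj₂ oute) (inj₁ (j , refl)) = mixed j (outside′ oute) v∈f v∈e
              cases (inj₂ oute) (inj₂ outf) =
                zero , same-vertex e≢f (hub′ (outside′ oute)) (hub′ (outside′ outf)) v∈e v∈f

            cover′ : ∀ v → ∃[ e ] v ∈ edge H e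
            cover′ v with v ≟ᶠ v₁
            ... | yes refl = t₀ , v₁∈t₀
            ... | no  v≢v₁ = first (proj₁ uni v v₁)
              where
              first : Star (Adjacent H) v v₁ → ∃[ e ] v ∈ edge H e
              first ε = contradiction refl v≢v₁
              first ((e , v∈e , _) ◅ _) = e , v∈e

      few-disjoint⇒Sun : ∀ {o} → 3 + o ≡ size H → disjointPairs H ≤ o + o → Sun H
      few-disjoint⇒Sun = FromArc.sun arc

-- Bijections from equal fibre sizes

module Matching where

  open import Data.Nat.Base using (_+_; _≤_)
  open ≡ using (refl; sym; trans; cong; subst; module ≡-Reasoning)
  open Counting
  open Disjointness
  open Perm using (_⟨$⟩ʳ_)

  ind-yes : ∀ {P : Set} (P? : Dec P) → P → ind (does P?) ≡ 1
  ind-yes P? p = cong ind (dec-true P? p)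

  ind-no : ∀ {P : Set} (P? : Dec P) → ¬ P → ind (does P?) ≡ 0
  ind-no P? ¬p = cong ind (dec-false P? ¬p)

  ind-⇔ : ∀ {P Q : Set} (P? : Dec P) (Q? : Dec Q) → (P → Q) → (Q → P) →
    ind (does P?) ≡ ind (does Q?)
  ind-⇔ P? (yes q) to from = ind-yes P? (from q)
  ind-⇔ P? (no ¬q) to from = ind-no P? (¬q ∘ to)

  module _ {K : Set} (_≟_ : DecidableEquality K) where

    fibre : ∀ {n} → (Fin n → K) → K → ℕ
    fibre c κ = sum λ i → ind (does (c i ≟ κ))

    fibre≡1 : ∀ {n} (c : Fin n → K) {κ} b → c b ≡ κ → (∀ i → c i ≡ κ → i ≡ b) → fibre c κ ≡ 1
    fibre≡1 c b cb≡κ unique = trans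
      (sum-single b _ λ i i≢b → ind-no (c i ≟ _) (i≢b ∘ unique i)) (ind-yes (c b ≟ _) cb≡κ)

    1≤fibre : ∀ {n} (c : Fin n → K) i → 1 ≤ fibre c (c i)
    1≤fibre c i = subst (_≤ fibre c (c i)) (ind-yes (c i ≟ c i) refl)
      (term≤sum (λ j → ind (does (c j ≟ c i))) i)

    fibre-member : ∀ {n} (c : Fin n → K) {κ} → 1 ≤ fibre c κ → ∃[ i ] c i ≡ κ
    fibre-member c {κ} 1≤ with any? (λ i → c i ≟ κ)
    ... | yes found = found
    ... | no  none  = contradiction
          (subst (1 ≤_) (sum-zero λ i → ind-no (c i ≟ κ) λ eq → none (i , eq)) 1≤) λ ()

    -- Element `zero` is sent to some element of the same colour, and removing both keeps the fibres
    -- equal. Equal fibres also force the two index sets to have the same size.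
    match : ∀ {m n} (c : Fin m → K) (c′ : Fin n → K) → (∀ κ → fibre c κ ≡ fibre c′ κ) →
            ∃[ π ] (∀ i → c′ (π ⟨$⟩ʳ i) ≡ c i)
    match {zero}  {zero}  c c′ eq = Perm.id , λ ()
    match {zero}  {suc n} c c′ eq = contradiction
      (subst (1 ≤_) (trans (sym (eq (c′ zero))) (sum-empty _)) (1≤fibre c′ zero)) λ ()
    match {suc m} {zero}  c c′ eq = contradiction
      (subst (1 ≤_) (trans (eq (c zero)) (sum-empty _)) (1≤fibre c zero)) λ ()
    match {suc m} {suc n} c c′ eq =
      let π , π-ok = match (c ∘ suc) (c′ ∘ Fin.punchIn j) smaller in
      Perm.insert zero j π , λ where
        zero    → c′j≡
        (suc i) → trans (cong c′ (Perm.insert-punchIn zero j π i)) (π-ok i)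
      where
      j∃ = fibre-member c′ (subst (1 ≤_) (eq (c zero)) (1≤fibre c zero))
      j = proj₁ j∃
      c′j≡ = proj₂ j∃
      smaller : ∀ κ → fibre (c ∘ suc) κ ≡ fibre (c′ ∘ Fin.punchIn j) κ
      smaller κ = ℕ.+-cancelˡ-≡ (ind (does (c zero ≟ κ))) _ _ (begin
        ind (does (c zero ≟ κ)) + fibre (c ∘ suc) κ               ≡⟨ sum-suc _ ⟨
        fibre c κ                                                 ≡⟨ eq κ ⟩
        fibre c′ κ                                                ≡⟨ sum-remove j
          (λ i → ind (does (c′ i ≟ κ))) ⟩
        ind (does (c′ j ≟ κ)) + fibre (c′ ∘ Fin.punchIn j) κ      ≡⟨ cong
          (λ x → ind (does (x ≟ κ)) + fibre (c′ ∘ Fin.punchIn j) κ) c′j≡ ⟩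
        ind (does (c zero ≟ κ)) + fibre (c′ ∘ Fin.punchIn j) κ    ∎)
        where open ≡-Reasoning

-- Uniqueness of suns up to isomorphism

module SunShape where

  open import Data.Nat.Base using (_+_; _*_)
  open ≡ using (refl; sym; trans; cong; subst; module ≡-Reasoning)
  open Counting
  open Subsets
  open Disjointness
  open Suns using (Sun)
  open Matching
  open Perm using (Permutation; _⟨$⟩ʳ_; _⟨$⟩ˡ_)

  -- The kind `just j` is the triangle side opposite corner j, and `nothing` is a hyperedge attached
  -- at the hub; incidence with corners depends on the kind only.
  Incident : Fin 3 → Maybe (Fin 3) → Set
  Incident i (just j) = i ≢ j
  Incident i nothing  = i ≡ zero

  _≟ᵏ_ : DecidableEquality (Maybe (Fin 3))
  _≟ᵏ_ = Maybe.≡-dec _≟ᶠ_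

  _≟ᵛ_ : ∀ {m} → DecidableEquality (Fin 3 ⊎ Fin m)
  _≟ᵛ_ = Sum.≡-dec _≟ᶠ_ _≟ᶠ_

  module _ {H : Hypergraph} (S : Sun H) where

    open Sun S

    w-inj : Injective _≡_ _≡_ w
    w-inj {i} {j} eq with i ≟ᶠ j
    ... | yes i≡j = i≡j
    ... | no  i≢j = contradiction (subst (_∈ edge H (t j)) eq (on i≢j)) (off j)

    kind : Fin (size H) → Maybe (Fin 3)
    kind e = Sum.[ just ∘ proj₁ , (λ _ → nothing) ] (member? t e)

    kind-just : ∀ {e j} → kind e ≡ just j → t j ≡ e
    kind-just {e} eq with member? t e
    kind-just refl | inj₁ (i , tᵢ≡e) = tᵢ≡e

    kind-t : ∀ j → kind (t j) ≡ just j
    kind-t j with member? t (t j)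
    ... | inj₁ (i , eq) = cong just (t-inj eq)
    ... | inj₂ none     = contradiction refl (none j)

    w∈⇒incident : ∀ {i e} → w i ∈ edge H e → Incident i (kind e)
    w∈⇒incident {i} {e} i∈e with member? t e
    ... | inj₁ (j , refl) = λ { refl → off i i∈e }
    ... | inj₂ out with i ≟ᶠ zero
    ...   | yes i≡0 = i≡0
    ...   | no  i≢0 = contradiction i∈e (rim out i i≢0)

    incident⇒w∈ : ∀ {i e} → Incident i (kind e) → w i ∈ edge H e
    incident⇒w∈ {i} {e} inc with member? t e
    ... | inj₁ (j , refl) = on inc
    ... | inj₂ out with refl ← inc = hub out

    fibre-just : ∀ j → fibre _≟ᵏ_ kind (just j) ≡ 1
    fibre-just j = fibre≡1 _≟ᵏ_ kind (t j) (kind-t j) λ e eq → sym (kind-just eq)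

    fibre-nothing : 3 + fibre _≟ᵏ_ kind nothing ≡ size H
    fibre-nothing = trans (cong (3 +_) (sum-cong pointwise)) (sum-outside t t-inj)
      where
      pointwise : ∀ e → ind (does (kind e ≟ᵏ nothing)) ≡ outside t e
      pointwise e with member? t e
      ... | inj₁ (j , eq) = sym (outside-no t j eq)
      ... | inj₂ out      = sym (outside-yes t out)

    -- A vertex that is no corner lies in a single hyperedge, so `cover v` involves no choice.
    place : Fin (order H) → Fin 3 ⊎ Fin (size H)
    place v = Sum.[ inj₁ ∘ proj₁ , (λ _ → inj₂ (proj₁ (cover v))) ] (member? w v)

    place-inj₁ : ∀ {v i} → place v ≡ inj₁ i → w i ≡ v
    place-inj₁ {v} eq with member? w v
    place-inj₁ refl | inj₁ (i , wᵢ≡v) = wᵢ≡v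

    place-w : ∀ i → place (w i) ≡ inj₁ i
    place-w i with member? w (w i)
    ... | inj₁ (j , eq) = cong inj₁ (w-inj eq)
    ... | inj₂ none     = contradiction refl (none i)

    private-edge : ∀ {v e} → (∀ i → w i ≢ v) → v ∈ edge H e → proj₁ (cover v) ≡ e
    private-edge {v} {e} none v∈e with proj₁ (cover v) ≟ᶠ e
    ... | yes eq = eq
    ... | no  ≢e = let i , eq = private-vertex ≢e (proj₂ (cover v)) v∈e in contradiction eq (none i)

    place-inj₂-∈ : ∀ {v f} → place v ≡ inj₂ f → v ∈ edge H f
    place-inj₂-∈ {v} eq with member? w v
    place-inj₂-∈ {v} refl | inj₂ none = proj₂ (cover v)

    place-inj₂-unique : ∀ {v f e} → place v ≡ inj₂ f → v ∈ edge H e → f ≡ e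
    place-inj₂-unique {v} eq v∈e with member? w v
    place-inj₂-unique refl v∈e | inj₂ none = private-edge none v∈e

    fibre-inj₁ : ∀ i → fibre _≟ᵛ_ place (inj₁ i) ≡ 1
    fibre-inj₁ i = fibre≡1 _≟ᵛ_ place (w i) (place-w i) λ v eq → sym (place-inj₁ eq)

    -- A hyperedge consists of its corners and its private vertices, so uniformity determines how
    -- many private ones it has.
    fibre-inj₂ : ∀ e → sum (λ i → w i ∈# edge H e) + fibre _≟ᵛ_ place (inj₂ e) ≡ ∣ edge H e ∣
    fibre-inj₂ e = trans (cong (sum (λ i → w i ∈# edge H e) +_) (sum-cong pointwise))
      (trans (sym (sum-split w w-inj (_∈# edge H e))) (sym (∣∣≡sum (edge H e))))
      where
      pointwise : ∀ v → ind (does (place v ≟ᵛ inj₂ e)) ≡ outside w v * v ∈# edge H e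
      pointwise v with member? w v
      ... | inj₁ (i , eq) = sym (cong (_* v ∈# edge H e) (outside-no w i eq))
      ... | inj₂ none     = trans
            (ind-⇔ (inj₂ (proj₁ (cover v)) ≟ᵛ inj₂ e) (v ∈? edge H e)
              (λ { refl → proj₂ (cover v) }) (λ v∈e → cong inj₂ (private-edge none v∈e)))
            (sym (trans (cong (_* v ∈# edge H e) (outside-yes w none)) (ℕ.*-identityˡ _)))

    -- Kinds and places are a complete invariant: incidence can be recovered from them, so
    -- bijections that respect both form an isomorphism.
    ∈⇔place : ∀ v e → v ∈ edge H e ⇔ Sum.[ (λ i → Incident i (kind e)) , (_≡ e) ] (place v)
    ∈⇔place v e with place v in eq
    ... | inj₁ i = let w≡v = place-inj₁ eq in mk⇔
          (λ v∈e → w∈⇒incident (subst (_∈ edge H e) (sym w≡v) v∈e))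
          (λ inc → subst (_∈ edge H e) w≡v (incident⇒w∈ inc))
    ... | inj₂ f = mk⇔ (place-inj₂-unique eq) (λ { refl → place-inj₂-∈ eq })

  module _ {k} {H H′ : Hypergraph} (S : Sun H) (S′ : Sun H′)
           (unif : Uniform k H) (unif′ : Uniform k H′) (size≡ : size H ≡ size H′) where

    private
      fibres : ∀ κ → fibre _≟ᵏ_ (kind S) κ ≡ fibre _≟ᵏ_ (kind S′) κ
      fibres (just j) = trans (fibre-just S j) (sym (fibre-just S′ j))
      fibres nothing  = ℕ.+-cancelˡ-≡ 3 _ _ (trans (fibre-nothing S)
        (trans size≡ (sym (fibre-nothing S′))))

      matchₑ = match _≟ᵏ_ (kind S) (kind S′) fibres

      τ : Permutation (size H) (size H′)
      τ = proj₁ matchₑ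

      kind-τ : ∀ e → kind S′ (τ ⟨$⟩ʳ e) ≡ kind S e
      kind-τ = proj₂ matchₑ

      τ-inj : ∀ {e f} → τ ⟨$⟩ʳ e ≡ τ ⟨$⟩ʳ f → e ≡ f
      τ-inj eq = trans (sym (Perm.inverseˡ τ)) (trans (cong (τ ⟨$⟩ˡ_) eq) (Perm.inverseˡ τ))

      -- Places mention hyperedges of `H`; renaming them by `τ` makes them comparable with the
      -- places in `H′`.
      place-τ : Fin (order H) → Fin 3 ⊎ Fin (size H′)
      place-τ v = Sum.map₂ (τ ⟨$⟩ʳ_) (place S v)

      -- Hyperedges matched by kind contain the same corners; being of equal size, they then have
      -- equally many private vertices.
      corners : ∀ e → sum (λ i → Sun.w S i ∈# edge H e) ≡ sum
        (λ i → Sun.w S′ i ∈# edge H′ (τ ⟨$⟩ʳ e))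
      corners e = sum-cong λ i → ind-⇔ (Sun.w S i ∈? edge H e) (Sun.w S′ i ∈? edge H′ (τ ⟨$⟩ʳ e))
        (λ i∈e → incident⇒w∈ S′ (subst (Incident i) (sym (kind-τ e)) (w∈⇒incident S i∈e)))
        (λ i∈e → incident⇒w∈ S (subst (Incident i) (kind-τ e) (w∈⇒incident S′ i∈e)))

      map₂-inj₁ : ∀ {i} (x : Fin 3 ⊎ Fin (size H)) → Sum.map₂ (τ ⟨$⟩ʳ_) x ≡ inj₁ i → x ≡ inj₁ i
      map₂-inj₁ (inj₁ i) refl = refl

      map₂-inj₂ : ∀ {e} (x : Fin 3 ⊎ Fin (size H)) → Sum.map₂ (τ ⟨$⟩ʳ_) x ≡ inj₂ (τ ⟨$⟩ʳ e) →
        x ≡ inj₂ e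
      map₂-inj₂ (inj₂ f) eq = cong inj₂ (τ-inj (Sum.inj₂-injective eq))

      fibresᵛ-τ : ∀ e → fibre _≟ᵛ_ place-τ (inj₂ (τ ⟨$⟩ʳ e)) ≡ fibre _≟ᵛ_ (place S′)
        (inj₂ (τ ⟨$⟩ʳ e))
      fibresᵛ-τ e = ℕ.+-cancelˡ-≡ (sum (λ i → Sun.w S i ∈# edge H e)) _ _ (begin
        sum (λ i → Sun.w S i ∈# edge H e) + fibre _≟ᵛ_ place-τ (inj₂ (τ ⟨$⟩ʳ e))
          ≡⟨ cong (sum (λ i → Sun.w S i ∈# edge H e) +_) (sum-cong λ v →
               ind-⇔ (place-τ v ≟ᵛ inj₂ (τ ⟨$⟩ʳ e)) (place S v ≟ᵛ inj₂ e)
                 (map₂-inj₂ (place S v)) (cong (Sum.map₂ (τ ⟨$⟩ʳ_)))) ⟩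
        sum (λ i → Sun.w S i ∈# edge H e) + fibre _≟ᵛ_ (place S) (inj₂ e)
          ≡⟨ trans (fibre-inj₂ S e) (trans (unif e)
            (sym (trans (fibre-inj₂ S′ (τ ⟨$⟩ʳ e)) (unif′ _)))) ⟩
        sum (λ i → Sun.w S′ i ∈# edge H′ (τ ⟨$⟩ʳ e)) + fibre _≟ᵛ_ (place S′) (inj₂ (τ ⟨$⟩ʳ e))
          ≡⟨ cong (_+ fibre _≟ᵛ_ (place S′) (inj₂ (τ ⟨$⟩ʳ e))) (corners e) ⟨
        sum (λ i → Sun.w S i ∈# edge H e) + fibre _≟ᵛ_ (place S′) (inj₂ (τ ⟨$⟩ʳ e)) ∎)
        where open ≡-Reasoning

      fibresᵛ : ∀ κ → fibre _≟ᵛ_ place-τ κ ≡ fibre _≟ᵛ_ (place S′) κ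
      fibresᵛ (inj₁ i) = trans (sum-cong λ v → ind-⇔ (place-τ v ≟ᵛ inj₁ i) (place S v ≟ᵛ inj₁ i)
                                  (map₂-inj₁ (place S v)) (cong (Sum.map₂ (τ ⟨$⟩ʳ_))))
                               (trans (fibre-inj₁ S i) (sym (fibre-inj₁ S′ i)))
      fibresᵛ (inj₂ f) = subst (λ f → fibre _≟ᵛ_ place-τ (inj₂ f) ≡ fibre _≟ᵛ_ (place S′) (inj₂ f))
                               (Perm.inverseʳ τ) (fibresᵛ-τ (τ ⟨$⟩ˡ f))

      matchᵥ = match _≟ᵛ_ place-τ (place S′) fibresᵛ

    Sun-unique : H ≅ H′
    Sun-unique = proj₁ matchᵥ , τ , incidence
      where
      σ = proj₁ matchᵥ
      transfer : ∀ {e} (x : Fin 3 ⊎ Fin (size H)) →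
        Sum.[ (λ i → Incident i (kind S e)) , (_≡ e) ] x ⇔
        Sum.[ (λ i → Incident i (kind S′ (τ ⟨$⟩ʳ e))) , (_≡ τ ⟨$⟩ʳ e) ] (Sum.map₂ (τ ⟨$⟩ʳ_) x)
      transfer {e} (inj₁ i) = mk⇔ (subst (Incident i) (sym (kind-τ e)))
        (subst (Incident i) (kind-τ e))
      transfer     (inj₂ f) = mk⇔ (cong (τ ⟨$⟩ʳ_)) τ-inj

      incidence : ∀ v e → v ∈ edge H e ⇔ (σ ⟨$⟩ʳ v) ∈ edge H′ (τ ⟨$⟩ʳ e)
      incidence v e = ⇔-sym (∈⇔place S′ (σ ⟨$⟩ʳ v) (τ ⟨$⟩ʳ e)) ⇔-∘
        subst (λ x → v ∈ edge H e ⇔ Sum.[ (λ i → Incident i (kind S′ (τ ⟨$⟩ʳ e))) , (_≡ τ ⟨$⟩ʳ e)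
          ] x)
          (sym (proj₂ matchᵥ v)) (transfer (place S v) ⇔-∘ ∈⇔place S v e)

-- Suns are linear and unicyclic; their disjoint pairs

module SunClass where

  open import Data.Nat.Base using (_+_; _*_; _≤_; z≤n; s≤s)
  open ≡ using (refl; sym; trans; cong; cong₂; subst; module ≡-Reasoning)
  open Counting
  open Subsets
  open Cycles
  open Cycle
  open Disjointness
  open Suns
  open SunShape

  module _ {H : Hypergraph} (S : Sun H) where

    open Sun S

    -- A hyperedge attached at the hub has a single corner, so two corners already identify a side
    -- of the triangle.
    two-corners : ∀ {i j} e → i ≢ j → Incident i (kind S e) → Incident j (kind S e) →
                  ∃[ l ] (t l ≡ e × l ≢ i × l ≢ j)
    two-corners {i} {j} e i≢j inc-i inc-j with kind S e in eq
    ... | just l  = l , kind-just S eq , inc-i ∘ sym , inc-j ∘ sym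
    ... | nothing = contradiction (trans inc-i (sym inc-j)) i≢j

    corners-edge : ∀ {i j e} → i ≢ j → w i ∈ edge H e → w j ∈ edge H e →
                   ∃[ l ] (t l ≡ e × l ≢ i × l ≢ j)
    corners-edge {e = e} i≢j i∈e j∈e = two-corners e i≢j (w∈⇒incident S i∈e) (w∈⇒incident S j∈e)

    corners-determine : ∀ {i j e f} → i ≢ j → w i ∈ edge H e → w j ∈ edge H e →
                        w i ∈ edge H f → w j ∈ edge H f → e ≡ f
    corners-determine {i} {j} i≢j ie je if jf =
      let l  , l≡ , l≢i , l≢j = corners-edge i≢j ie je
          l′ , l′≡ , l′≢i , l′≢j = corners-edge i≢j if jf
      in trans (sym l≡) (trans (cong t (third-unique i j l l′ i≢j l≢i l≢j l′≢i l′≢j)) l′≡)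

    common-unique : ∀ {e f} → e ≢ f → ∀ {u v} → u ∈ edge H e → u ∈ edge H f → v ∈ edge H e →
      v ∈ edge H f → u ≡ v
    common-unique {e} {f} e≢f {u} {v} ue uf ve vf
      with private-vertex e≢f ue uf | private-vertex e≢f ve vf
    ... | i , refl | j , refl with i ≟ᶠ j
    ...   | yes i≡j = cong w i≡j
    ...   | no  i≢j = contradiction (corners-determine i≢j ue ve uf vf) e≢f

    Sun-linear : Linear H
    Sun-linear e f e≢f with 2 ℕ.≤? ∣ edge H e ∩ edge H f ∣
    ... | no  ≱2 = ℕ.s≤s⁻¹ (ℕ.≰⇒> ≱2)
    ... | yes 2≤ =
      let u , v , u∈ , v∈ , v≢u = two-members 2≤
          ue , uf = x∈p∩q⁻ (edge H e) (edge H f) u∈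
          ve , vf = x∈p∩q⁻ (edge H e) (edge H f) v∈
      in contradiction (common-unique e≢f ve vf ue uf) v≢u

    to-hub : ∀ v → Star (Adjacent H) v (w zero)
    to-hub v = let e , v∈e = cover v in via e v∈e (w zero ∈? edge H e)
      where
      via : ∀ e → v ∈ edge H e → Dec (w zero ∈ edge H e) → Star (Adjacent H) v (w zero)
      via e v∈e (yes 0∈e) = (e , v∈e , 0∈e) ◅ ε
      via e v∈e (no  0∉e) with member? t e
      ... | inj₂ out                 = contradiction (hub out) 0∉e
      ... | inj₁ (suc i , refl)      = contradiction (on λ ()) 0∉e
      -- Only the side opposite the hub avoids it; the walk goes through corner 1 and the side
      -- opposite corner 2.
      ... | inj₁ (zero  , refl)      =
            (t zero , v∈e , on {suc zero} {zero} λ ()) ◅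
            (t (suc (suc zero)) , on {suc zero} {suc (suc zero)} (λ ()) , on {zero}
              {suc (suc zero)} λ ()) ◅ ε

    Sun-connected : Connected H
    Sun-connected u v = to-hub u ◅◅ Star.reverse (λ (e , u∈e , v∈e) → e , v∈e , u∈e) (to-hub v)

    -- The vertex lies on two consecutive hyperedges of the cycle, which are distinct, and only
    -- corners lie on two hyperedges.
    corner-at : ∀ (C : Cycle H) i → ∃[ a ] w a ≡ cvert C i
    corner-at C i = private-vertex (prev≢ i ∘ cedge-distinct C)
      (subst (λ j → cvert C j ∈ edge H (cedge C (prev i))) (next-prev i) (next∈ C (prev i)))
        (here∈ C i)

    corner-index : (C : Cycle H) → Fin (2 + extra C) → Fin 3
    corner-index C i = proj₁ (corner-at C i)

    corner≢ : ∀ C i → corner-index C i ≢ corner-index C (next i)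
    corner≢ C i eq = next≢ i (cvert-distinct C
      (trans (sym (proj₂ (corner-at C (next i))))
        (trans (cong w (sym eq)) (proj₂ (corner-at C i)))))

    corner-here : ∀ C i → w (corner-index C i) ∈ edge H (cedge C i)
    corner-here C i = subst (_∈ edge H (cedge C i)) (sym (proj₂ (corner-at C i))) (here∈ C i)

    corner-next : ∀ C i → w (corner-index C (next i)) ∈ edge H (cedge C i)
    corner-next C i = subst (_∈ edge H (cedge C i)) (sym (proj₂ (corner-at C (next i)))) (next∈ C i)

    edge-at : ∀ C i → ∃[ l ] (t l ≡ cedge C i × l ≢ corner-index C i × l ≢ corner-index C (next i))
    edge-at C i = corners-edge (corner≢ C i) (corner-here C i) (corner-next C i)

    edge-index : (C : Cycle H) → Fin (2 + extra C) → Fin 3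
    edge-index C i = proj₁ (edge-at C i)

    edge-index-inj : ∀ C → Injective _≡_ _≡_ (edge-index C)
    edge-index-inj C {i} {j} eq = cedge-distinct C
      (trans (sym (proj₁ (proj₂ (edge-at C i)))) (trans (cong t eq) (proj₁ (proj₂ (edge-at C j)))))

    at-least-3 : (C : Cycle H) → 1 ≤ extra C
    at-least-3 record { extra = suc _ } = s≤s z≤n
    at-least-3 record { extra = zero ; cvert-distinct = cv-inj ; cedge-distinct = ce-inj ; here∈
      = here∈ ; next∈ = next∈ } =
      contradiction (cv-inj (common-unique (λ eq → case (ce-inj eq)) (here∈ zero)
        (next∈ (suc zero)) (next∈ zero) (here∈ (suc zero)))) λ ()
      where
      case : zero ≢ suc {1} zero
      case ()

    -- A side l left out would extend `edge-index` to an injection of at least four elements into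
    -- three.
    edge-index-surj : ∀ C l → ∃[ i ] edge-index C i ≡ l
    edge-index-surj C l with member? (edge-index C) l
    ... | inj₁ found = found
    ... | inj₂ none  = contradiction (Fin.injective⇒≤ {f = extended} extended-inj)
                         (ℕ.<⇒≱ (s≤s (s≤s (s≤s (at-least-3 C)))))
      where
      extended : Fin (3 + extra C) → Fin 3
      extended zero    = l
      extended (suc i) = edge-index C i
      extended-inj : Injective _≡_ _≡_ extended
      extended-inj {zero}  {zero}  eq = refl
      extended-inj {zero}  {suc j} eq = contradiction (sym eq) (none j)
      extended-inj {suc i} {zero}  eq = contradiction eq (none i)
      extended-inj {suc i} {suc j} eq = cong suc (edge-index-inj C eq)

    -- The links of every cycle are the incidences of the triangle.
    Canonical : Fin (order H) → Fin (size H) → Set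
    Canonical v e = ∃[ a ] ∃[ l ] (w a ≡ v × t l ≡ e × a ≢ l)

    link⇒canonical : ∀ C {v e} → Link C v e → Canonical v e
    link⇒canonical C (i , refl , inj₁ refl) =
      let l , eq , l≢ , _ = edge-at C i in _ , l , proj₂ (corner-at C i) , eq , l≢ ∘ sym
    link⇒canonical C (i , refl , inj₂ refl) =
      let l , eq , _ , l≢ = edge-at C i in _ , l , proj₂ (corner-at C (next i)) , eq , l≢ ∘ sym

    canonical⇒link : ∀ C {v e} → Canonical v e → Link C v e
    canonical⇒link C (a , l , refl , refl , a≢l) =
      let i , eqᵢ = edge-index-surj C l
          l′ , tl′ , l≢₁ , l≢₂ = edge-at C i
      in i , trans (cong t (sym eqᵢ)) tl′ , pick i (subst (_≢ corner-index C i) eqᵢ l≢₁)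
                                                  (subst (_≢ corner-index C (next i)) eqᵢ l≢₂)
      where
      -- The two corners of the i-th hyperedge and a all differ from l, so among three indices a is
      -- one of the two.
      pick : ∀ i → l ≢ corner-index C i → l ≢ corner-index C (next i) →
        w a ≡ cvert C i ⊎ w a ≡ cvert C (next i)
      pick i l≢₁ l≢₂ with a ≟ᶠ corner-index C i
      ... | yes refl = inj₁ (proj₂ (corner-at C i))
      ... | no  a≢   = inj₂ (trans (cong w (third-unique l (corner-index C i) a _ l≢₁ a≢l a≢
        (l≢₂ ∘ sym) (corner≢ C i ∘ sym)))
                                   (proj₂ (corner-at C (next i))))

    Sun-triangle : Cycle H
    Sun-triangle = triangle H (t zero) (t (suc zero)) (t (suc (suc zero))) (w (suc zero))
      (w (suc (suc zero))) (w zero)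
      (λ eq → case₁ (t-inj eq)) (λ eq → case₂ (t-inj eq)) (λ eq → case₃ (t-inj eq))
      (λ eq → case₂ (w-inj S eq)) (λ eq → case₃ (sym (w-inj S eq)))
        (λ eq → case₁ (sym (w-inj S eq)))
      (on λ ()) (on λ ()) (on λ ()) (on λ ()) (on λ ()) (on λ ())
      where
      case₁ : zero ≢ suc {2} zero
      case₁ ()
      case₂ : suc {2} zero ≢ suc (suc zero)
      case₂ ()
      case₃ : zero ≢ suc {2} (suc zero)
      case₃ ()

    Sun-unicyclic : Unicyclic H
    Sun-unicyclic = Sun-connected , Sun-triangle , λ C v e →
      mk⇔ (canonical⇒link C ∘ link⇒canonical Sun-triangle)
        (canonical⇒link Sun-triangle ∘ link⇒canonical C)

    meet-tt : ∀ i j → Meet H (t i) (t j)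
    meet-tt i j = let l , l≢i , l≢j = third i j in w l , on l≢i , on l≢j

    meet-rays : ∀ {e f} → (∀ j → t j ≢ e) → (∀ j → t j ≢ f) → Meet H e f
    meet-rays oute outf = w zero , hub oute , hub outf

    meet-ray : ∀ {e} → (∀ j → t j ≢ e) → ∀ j → Meet H e (t (suc j))
    meet-ray out j = w zero , hub out , on λ ()

    -- A common vertex would be a corner; the hub is not on the opposite side, and the other corners
    -- are not on attached hyperedges.
    miss-ray : ∀ {e} → (∀ j → t j ≢ e) → ¬ Meet H e (t zero)
    miss-ray out (v , v∈e , v∈t) with private-vertex (out zero ∘ sym) v∈e v∈t
    ... | zero  , refl = off zero v∈t
    ... | suc i , refl = rim out (suc i) (λ ()) v∈e

    missed-ray : ∀ {e} → (∀ j → t j ≢ e) → missed H t e ≡ 1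
    missed-ray {e} out = trans
      (sum-single zero (λ i → disjoint H e (t i)) λ { zero 0≢0 → contradiction refl 0≢0
                                                    ; (suc j) _ → disjoint-no H (meet-ray out j) })
      (disjoint-yes H (miss-ray out))

    -- The only disjoint pairs join an attached hyperedge to the side opposite the hub: one for each
    -- of the o attached ones, in both orders.
    Sun-disjointPairs : ∀ {o} → 3 + o ≡ size H → disjointPairs H ≡ o + o
    Sun-disjointPairs {o} 3+o≡m = begin
      disjointPairs H
        ≡⟨ disjointPairs-split H t t-inj ⟩
      (sum (λ i → missed H t (t i)) + Σmissed) +
        (Σmissed + sum (λ e → outside t e * missedBy H t e))
        ≡⟨ cong₂ _+_ (cong (_+ Σmissed) (sum-zero λ i → sum-zero λ j → disjoint-no H (meet-tt i j)))
             (cong (Σmissed +_) (sum-zero none-between)) ⟩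
      Σmissed + (Σmissed + 0)
        ≡⟨ cong₂ _+_ Σmissed≡o (trans (ℕ.+-identityʳ _) Σmissed≡o) ⟩
      o + o ∎
      where
      open ≡-Reasoning
      Σmissed = sum (λ e → outside t e * missed H t e)

      one-each : ∀ e → outside t e * missed H t e ≡ outside t e
      one-each e with member? t e
      ... | inj₁ (i , eq) = trans (cong (_* missed H t e) (outside-no t i eq))
        (sym (outside-no t i eq))
      ... | inj₂ out      = trans (cong (outside t e *_) (missed-ray out)) (ℕ.*-identityʳ _)

      Σmissed≡o : Σmissed ≡ o
      Σmissed≡o = trans (sum-cong one-each) (ℕ.+-cancelˡ-≡ 3 _ _
        (trans (sum-outside t t-inj) (sym 3+o≡m)))

      none-between : ∀ e → outside t e * missedBy H t e ≡ 0
      none-between e with member? t e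
      ... | inj₁ (i , eq) = cong (_* missedBy H t e) (outside-no t i eq)
      ... | inj₂ out      = trans (cong (outside t e *_) (sum-zero between))
        (ℕ.*-zeroʳ (outside t e))
        where
        between : ∀ f → outside t f * disjoint H e f ≡ 0
        between f with member? t f
        ... | inj₁ (i , eq) = cong (_* disjoint H e f) (outside-no t i eq)
        ... | inj₂ outf     = trans (cong (outside t f *_) (disjoint-no H (meet-rays out outf)))
          (ℕ.*-zeroʳ (outside t f))

-- The extremal hypergraph is a sun

module ExtremalHypergraph where

  open import Data.Nat.Base using (_+_; _*_)
  open ≡ using (refl; sym; trans; cong; cong₂; subst)
  open Counting
  open Subsets
  open Cycles using (prev; next-prev)
  open Suns
  open SunShape using (w-inj)

  ∈-++ˡ⁺ : ∀ {m n x} {S : Subset m} {T : Subset n} → x ∈ S → x ↑ˡ n ∈ S ++ T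
  ∈-++ˡ⁺ {x = x} {S} {T} x∈S = Vec.lookup⇒[]= _ (S ++ T)
    (trans (Vec.lookup-++ˡ S T x) (Vec.[]=⇒lookup x∈S))

  ∈-++ˡ⁻ : ∀ {m n x} {S : Subset m} {T : Subset n} → x ↑ˡ n ∈ S ++ T → x ∈ S
  ∈-++ˡ⁻ {x = x} {S} {T} x∈ = Vec.lookup⇒[]= _ S
    (trans (sym (Vec.lookup-++ˡ S T x)) (Vec.[]=⇒lookup x∈))

  ∈-++ʳ⁺ : ∀ {m n y} {S : Subset m} {T : Subset n} → y ∈ T → m ↑ʳ y ∈ S ++ T
  ∈-++ʳ⁺ {y = y} {S} {T} y∈T = Vec.lookup⇒[]= _ (S ++ T)
    (trans (Vec.lookup-++ʳ S T y) (Vec.[]=⇒lookup y∈T))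

  ∈-++ʳ⁻ : ∀ {m n y} {S : Subset m} {T : Subset n} → m ↑ʳ y ∈ S ++ T → y ∈ T
  ∈-++ʳ⁻ {y = y} {S} {T} y∈ = Vec.lookup⇒[]= _ T
    (trans (sym (Vec.lookup-++ʳ S T y)) (Vec.[]=⇒lookup y∈))

  data Split m n : Fin (m + n) → Set where
    left  : ∀ x → Split m n (x ↑ˡ n)
    right : ∀ y → Split m n (m ↑ʳ y)

  split : ∀ m n (v : Fin (m + n)) → Split m n v
  split m n v with splitAt m v in eq
  ... | inj₁ x = subst (Split m n) (Fin.splitAt⁻¹-↑ˡ eq) (left x)
  ... | inj₂ y = subst (Split m n) (Fin.splitAt⁻¹-↑ʳ eq) (right y)

  ∣++∣ : ∀ {m n} (S : Subset m) (T : Subset n) → ∣ S ++ T ∣ ≡ ∣ S ∣ + ∣ T ∣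
  ∣++∣ []          T = refl
  ∣++∣ (true  ∷ S) T = cong suc (∣++∣ S T)
  ∣++∣ (false ∷ S) T = ∣++∣ S T

  ∣concat∣ : ∀ {m s} (S : Fin m → Subset s) → ∣ Vec.concat (Vec.tabulate S) ∣ ≡ sum (λ f → ∣ S f ∣)
  ∣concat∣ {zero}  S = sym (sum-empty _)
  ∣concat∣ {suc m} S = trans (∣++∣ (S zero) _)
    (trans (cong (∣ S zero ∣ +_) (∣concat∣ (S ∘ suc))) (sym (sum-suc _)))

  ∣block∣ : ∀ {m} s (e : Fin m) → ∣ block s e ∣ ≡ s
  ∣block∣ s e = trans (∣concat∣ λ f → if does (e ≟ᶠ f) then ⊤ {s} else ⊥)
    (trans (sum-cong λ f → pointwise (does (e ≟ᶠ f))) (sum-δ e (λ _ → s)))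
    where
    pointwise : ∀ b → ∣ (if b then ⊤ {s} else ⊥) ∣ ≡ ind b * s
    pointwise true  = trans (∣⊤∣≡n s) (sym (ℕ.*-identityˡ s))
    pointwise false = ∣⊥∣≡0 s

  lookup-block : ∀ {m s} (e f : Fin m) (r : Fin s) →
    lookup (block s e) (Fin.combine f r) ≡ lookup (if does (e ≟ᶠ f) then ⊤ {s} else ⊥) r
  lookup-block {s = s} e f r = trans (Vec.lookup-concat (Vec.tabulate F) f r)
    (cong (λ S → lookup S r) (Vec.lookup∘tabulate F f))
    where
    F = λ f → if does (e ≟ᶠ f) then ⊤ {s} else ⊥

  ∈-block⁺ : ∀ {m s} (e : Fin m) (r : Fin s) → Fin.combine e r ∈ block s e
  ∈-block⁺ {s = s} e r = Vec.lookup⇒[]= _ (block s e) (trans (lookup-block e e r)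
    (trans (cong (λ b → lookup (if b then ⊤ {s} else ⊥) r) (dec-true (e ≟ᶠ e) refl))
      (Vec.lookup-replicate r true)))

  ∈-block⁻ : ∀ {m s} {e f : Fin m} {r : Fin s} → Fin.combine f r ∈ block s e → e ≡ f
  ∈-block⁻ {s = s} {e} {f} {r} r∈ with e ≟ᶠ f in eq
  ... | yes e≡f = e≡f
  ... | no  e≢f = contradiction (trans (sym (Vec.lookup-replicate r false)) (trans
        (cong (λ b → lookup (if b then ⊤ {s} else ⊥) r) (sym (dec-false (e ≟ᶠ f) e≢f)))
        (trans (sym (lookup-block e f r)) (Vec.[]=⇒lookup r∈)))) λ ()

  -- Hyperedge e of `C₃` joins e and `next e`, so the one opposite vertex i is `next i`.
  C₃-on : ∀ (i j : Fin 3) → i ≢ j → i ∈ edge C₃ (next j)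
  C₃-on = from-yes (Fin.all? {n = 3} λ i → Fin.all? λ j → ¬? (i ≟ᶠ j) →-dec (i ∈? edge C₃ (next j)))

  C₃-off : ∀ (i : Fin 3) → i ∉ edge C₃ (next i)
  C₃-off = from-yes (Fin.all? {n = 3} λ i → ¬? (i ∈? edge C₃ (next i)))

  next-injective : ∀ (i j : Fin 3) → next i ≡ next j → i ≡ j
  next-injective = from-yes (Fin.all? {n = 3} λ i → Fin.all? λ j → (next i ≟ᶠ next j) →-dec
    (i ≟ᶠ j))

  C₃-uniform : ∀ (e : Fin 3) → ∣ edge C₃ e ∣ ≡ 2
  C₃-uniform = from-yes (Fin.all? {n = 3} λ e → ∣ edge C₃ e ∣ ℕ.≟ 2)

  -- No hyperedge lies off the triangle, which makes `hub` and `rim` vacuous; each inserted vertex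
  -- lies in the block of one hyperedge.
  hypertriangle-Sun : ∀ s → Sun (insertCored s C₃)
  hypertriangle-Sun s = record
    { t = next
    ; w = _↑ˡ (3 * s)
    ; t-inj = λ {i} {j} → next-injective i j
    ; on = λ {i} {j} i≢j → ∈-++ˡ⁺ {T = block s (next j)} (C₃-on i j i≢j)
    ; off = λ i i∈ → C₃-off i (∈-++ˡ⁻ {T = block s (next i)} i∈)
    ; hub = λ {e} out → contradiction (next-prev e) (out (prev e))
    ; rim = λ {e} out → contradiction (next-prev e) (out (prev e))
    ; private-vertex = λ {v} → private′ (split 3 (3 * s) v)
    ; cover = λ v → cover′ (split 3 (3 * s) v)
    }
    where
    private′ : ∀ {v e f} → Split 3 (3 * s) v → e ≢ f →
      v ∈ edge C₃ e ++ block s e → v ∈ edge C₃ f ++ block s f → ∃[ i ] i ↑ˡ (3 * s) ≡ v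
    private′ (left x)  _ _ _ = x , refl
    private′ {e = e} {f} (right y) e≢f y∈e y∈f with Fin.combine-surjective {3} {s} y
    ... | q , r , refl = contradiction
          (trans (∈-block⁻ {e = e} {q} {r} (∈-++ʳ⁻ {S = edge C₃ e} y∈e))
            (sym (∈-block⁻ {e = f} {q} {r} (∈-++ʳ⁻ {S = edge C₃ f} y∈f)))) e≢f

    cover′ : ∀ {v} → Split 3 (3 * s) v → ∃[ e ] v ∈ edge C₃ e ++ block s e
    cover′ (left x)  = x , ∈-++ˡ⁺ {T = block s x} (x∈p∪q⁺ (inj₁ (x∈⁅x⁆ x)))
    cover′ (right y) with Fin.combine-surjective {3} {s} y
    ... | q , r , refl = q , ∈-++ʳ⁺ {S = edge C₃ q} (∈-block⁺ q r)

  hypertriangle-uniform : ∀ s → Uniform (2 + s) (insertCored s C₃)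
  hypertriangle-uniform s e = trans (∣++∣ (edge C₃ e) (block s e))
    (cong₂ _+_ (C₃-uniform e) (∣block∣ s e))

  module _ {s : ℕ} {H : Hypergraph} {v : Fin (order H)} (S : Sun H) (w₀≡v : Sun.w S zero ≡ v) where

    open Sun S

    private
      H′ = addPendant s H v

    -- The new hyperedge is number `zero`, the others are shifted by `suc`. It is attached at v, so
    -- `w₀≡v` makes it pass through the hub.
    addPendant-Sun : Sun H′
    addPendant-Sun = record
      { t = λ j → suc (t j)
      ; w = λ i → w i ↑ˡ suc s
      ; t-inj = t-inj ∘ Fin.suc-injective
      ; on = λ i≢j → ∈-++ˡ⁺ (on i≢j)
      ; off = λ i i∈ → off i (∈-++ˡ⁻ i∈)
      ; hub = hub′
      ; rim = rim′
      ; private-vertex = λ {v} → private′ (split (order H) (suc s) v)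
      ; cover = λ v → cover′ (split (order H) (suc s) v)
      }
      where
      hub′ : ∀ {e} → (∀ j → suc (t j) ≢ e) → w zero ↑ˡ suc s ∈ edge H′ e
      hub′ {zero}  out = ∈-++ˡ⁺ (subst (_∈ ⁅ v ⁆) (sym w₀≡v) (x∈⁅x⁆ v))
      hub′ {suc e} out = ∈-++ˡ⁺ (hub λ j eq → out j (cong suc eq))

      rim′ : ∀ {e} → (∀ j → suc (t j) ≢ e) → ∀ i → i ≢ zero → w i ↑ˡ suc s ∉ edge H′ e
      rim′ {zero}  out i i≢0 i∈ = i≢0 (w-inj S (trans (x∈⁅y⁆⇒x≡y v (∈-++ˡ⁻ i∈)) (sym w₀≡v)))
      rim′ {suc e} out i i≢0 i∈ = rim (λ j eq → out j (cong suc eq)) i i≢0 (∈-++ˡ⁻ i∈)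

      private′ : ∀ {u e f} → Split (order H) (suc s) u → e ≢ f → u ∈ edge H′ e → u ∈ edge H′ f →
                 ∃[ i ] w i ↑ˡ suc s ≡ u
      private′ {e = zero}  {zero}  _         e≢f _   _   = contradiction refl e≢f
      private′ {e = zero}  {suc f} (left x)  _   x∈e _   = zero , cong (_↑ˡ suc s)
        (trans w₀≡v (sym (x∈⁅y⁆⇒x≡y v (∈-++ˡ⁻ x∈e))))
      private′ {e = suc e} {zero}  (left x)  _   _   x∈f = zero , cong (_↑ˡ suc s)
        (trans w₀≡v (sym (x∈⁅y⁆⇒x≡y v (∈-++ˡ⁻ x∈f))))
      private′ {e = suc e} {suc f} (left x)  e≢f x∈e x∈f =
        let i , eq = private-vertex (e≢f ∘ cong suc) (∈-++ˡ⁻ x∈e) (∈-++ˡ⁻ x∈f) in i , cong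
              (_↑ˡ suc s) eq
      private′ {e = zero}  {suc f} (right y) _   _   y∈f = contradiction
        (∈-++ʳ⁻ {S = edge H f} y∈f) ∉⊥
      private′ {e = suc e}         (right y) _   y∈e _   = contradiction
        (∈-++ʳ⁻ {S = edge H e} y∈e) ∉⊥

      cover′ : ∀ {u} → Split (order H) (suc s) u → ∃[ e ] u ∈ edge H′ e
      cover′ (left x)  = let e , x∈e = cover x in suc e , ∈-++ˡ⁺ x∈e
      cover′ (right y) = zero , ∈-++ʳ⁺ {S = ⁅ v ⁆} ∈⊤

  addPendant-uniform : ∀ {s H v} → Uniform (2 + s) H → Uniform (2 + s) (addPendant s H v)
  addPendant-uniform {s} {v = v} unif zero = trans (∣++∣ ⁅ v ⁆ (⊤ {suc s}))
    (cong₂ _+_ (∣⁅x⁆∣≡1 v) (∣⊤∣≡n (suc s)))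
  addPendant-uniform {s} {H} unif (suc e)  = trans (∣++∣ (edge H e) (⊥ {suc s}))
    (trans (cong₂ _+_ (unif e) (∣⊥∣≡0 (suc s))) (ℕ.+-identityʳ _))

  -- The equation for the hub is carried along, because `addPendants` renames v at each step.
  addPendants-Sun : ∀ {s} p {H v} (S : Sun H) → Sun.w S zero ≡ v → Uniform (2 + s) H →
    Sun (addPendants s p H v) × Uniform (2 + s) (addPendants s p H v) × size (addPendants s p H v)
      ≡ p + size H
  addPendants-Sun zero    S w₀≡v unif = S , unif , refl
  addPendants-Sun {s} (suc p) {H} {v} S w₀≡v unif =
    let S′ , unif′ , size≡ = addPendants-Sun p (addPendant-Sun {s} S w₀≡v) (cong (_↑ˡ suc s) w₀≡v)
                               (addPendant-uniform {s} {H} {v} unif)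
    in S′ , unif′ , trans size≡ (ℕ.+-suc p (size H))

-- Comparing orders and sums of squared degrees

module Comparison where

  open import Data.Nat.Base using (_+_; _*_; _<_; z≤n; s≤s)
  open ≡ using (refl; sym; trans; cong; module ≡-Reasoning)
  open Counting
  open Order
  open Disjointness
  open Suns
  open SunShape
  open SunClass
  open ExtremalHypergraph

  extremal : ∀ s p → let X = C₃⟨ 2 + s ⟩⊙S p in Sun X × Uniform (2 + s) X × size X ≡ 3 + p
  extremal s p =
    let S , unif , size≡ = addPendants-Sun p (hypertriangle-Sun s) refl (hypertriangle-uniform s)
    in S , unif , trans size≡ (ℕ.+-comm p 3)

  extremal-class : ∀ s p → LinearUnicyclic (2 + s) (3 + p) (C₃⟨ 2 + s ⟩⊙S p)
  extremal-class s p = let S , unif , size≡ = extremal s p in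
    unif , Sun-linear S , Sun-unicyclic S , size≡

  order≡ : ∀ {k m H H′} → LinearUnicyclic (suc k) m H → LinearUnicyclic (suc k) m H′ →
    order H ≡ order H′
  order≡ {k} {m} {H} {H′} (unif , _ , uni , refl) (unif′ , _ , uni′ , size≡) =
    ℕ.+-cancelʳ-≡ (size H) _ _ (begin
      order H + size H    ≡⟨ order-size unif uni (s≤s z≤n) ⟩
      suc k * size H      ≡⟨ cong (suc k *_) size≡ ⟨
      suc k * size H′     ≡⟨ order-size unif′ uni′ (s≤s z≤n) ⟨
      order H′ + size H′  ≡⟨ cong (order H′ +_) size≡ ⟩
      order H′ + size H   ∎)
    where open ≡-Reasoning

  degree² : Hypergraph → ℕ
  degree² H = sum λ v → degree H v * degree H v

  -- Σ d(v)² and the number of disjoint pairs have a fixed sum. At most 2p disjoint pairs would make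
  -- `H` a sun and so isomorphic to the extremal one; more than 2p leave a smaller sum of squares.
  degree²-extremal : ∀ s p {H} → LinearUnicyclic (2 + s) (3 + p) H → ¬ (H ≅ (C₃⟨ 2 + s ⟩⊙S p)) →
                     degree² H < degree² (C₃⟨ 2 + s ⟩⊙S p)
  degree²-extremal s p {H} (unif , lin , uni , size≡) H≇X with disjointPairs H ℕ.≤? p + p
  ... | yes few = contradiction
        (Sun-unique (few-disjoint⇒Sun lin uni (sym size≡) few) S unif unifX
          (trans size≡ (sym sizeX))) H≇X
    where
    S     = proj₁ (extremal s p)
    unifX = proj₁ (proj₂ (extremal s p))
    sizeX = proj₂ (proj₂ (extremal s p))
  ... | no many = ℕ.+-cancelʳ-< (p + p) _ _ (begin-strict
        degree² H + (p + p)            <⟨ ℕ.+-monoʳ-< (degree² H) (ℕ.≰⇒> many) ⟩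
        degree² H + disjointPairs H    ≡⟨ degree²-disjointPairs H unif lin ⟩
        size H * (size H + suc s)      ≡⟨ cong (λ m → m * (m + suc s)) (trans size≡ (sym sizeX)) ⟩
        size X * (size X + suc s)      ≡⟨ degree²-disjointPairs X unifX (Sun-linear S) ⟨
        degree² X + disjointPairs X    ≡⟨ cong (degree² X +_) (Sun-disjointPairs S (sym sizeX)) ⟩
        degree² X + (p + p)            ∎)
    where
    open ℕ.≤-Reasoning
    X     = C₃⟨ 2 + s ⟩⊙S p
    S     = proj₁ (extremal s p)
    unifX = proj₁ (proj₂ (extremal s p))
    sizeX = proj₂ (proj₂ (extremal s p))

  two-in-range : ∀ n r → 3 ≤ n → 2 ≤ n * suc r ^ (n ∸ 1) ∸ 1
  two-in-range n r 3≤n = ℕ.∸-monoˡ-≤ 1 (ℕ.≤-trans 3≤n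
    (ℕ.m≤m*n n (suc r ^ (n ∸ 1)) {{ℕ.m^n≢0 (suc r) (n ∸ 1)}}))

  3≤order : ∀ {H} → Sun H → 3 ≤ order H
  3≤order S = injective⇒≤ (w-inj S)
    where open import Data.Fin.Properties using (injective⇒≤)

-- Deciding the order at the second trace

module Separation {c ℓ₁ ℓ₂ ℓ₃} (F : OrderedField c ℓ₁ ℓ₂ ℓ₃) where

  open OrderedField F hiding (zero)
  open import Relation.Binary.Reasoning.Setoid setoid
  open AlphaTraces F
  open Comparison

  *-monoʳ-< : ∀ {x y z} → 0# < z → x < y → z * x < z * y
  *-monoʳ-< {x} {y} {z} 0<z x<y = <-respˡ-≈ (+-identityˡ _)
    (<-respʳ-≈ eq (+-monoˡ-< (z * x) (*-pos 0<z 0<y-x)))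
    where
    0<y-x : 0# < y - x
    0<y-x = <-respˡ-≈ (-‿inverseʳ x) (+-monoˡ-< (- x) x<y)
    eq : z * (y - x) + z * x ≈ z * y
    eq = trans (sym (distribˡ z _ _)) (*-congˡ (trans (+-assoc y (- x) x)
      (trans (+-congˡ (-‿inverseˡ x)) (+-identityʳ y))))

  fromℕ-mono-< : ∀ {m n} → m ℕ.< n → fromℕ m < fromℕ n
  fromℕ-mono-< {m} {n} m<n = <-respʳ-≈
    (trans (sym (fromℕ-+ (suc d) m)) (reflexive
      (≡.cong fromℕ (≡.trans (≡.sym (ℕ.+-suc d m)) (ℕ.m∸n+n≡m m<n)))))
    (<-respˡ-≈ (+-identityˡ _) (+-monoˡ-< (fromℕ m) (0<fromℕ-suc d)))
    where d = n ∸ suc m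

  separate : ∀ s p α {H} → 0# < α → LinearUnicyclic (2 ℕ.+ s) (3 ℕ.+ p) H →
    ¬ (H ≅ (C₃⟨ 2 ℕ.+ s ⟩⊙S p)) →
             _∙_⊢_≺_ F α (2 ℕ.+ s) H (C₃⟨ 2 ℕ.+ s ⟩⊙S p)
  separate s p α {H} 0<α inClass@(unif , lin , uni , size≡) H≇X =
    n≡ , 2 , ℕ.s≤s ℕ.z≤n , two-in-range (order H) s (≡.subst (3 ℕ.≤_) (≡.sym n≡) (3≤order S)) ,
      equal , larger
    where
    X     = C₃⟨ 2 ℕ.+ s ⟩⊙S p
    S     = proj₁ (extremal s p)
    unifX = proj₁ (proj₂ (extremal s p))
    sizeX = proj₂ (proj₂ (extremal s p))

    n≡ : order H ≡ order X
    n≡ = order≡ inClass (extremal-class s p)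

    m≡ : size H ≡ size X
    m≡ = ≡.trans size≡ (≡.sym sizeX)

    equal : ∀ t → t ℕ.< 2 → Tr F t (Aα F α (suc s) H) ≈ Tr F t (Aα F α (suc s) X)
    equal 0 _ = reflexive (≡.cong (λ n → fromℕ (n ℕ.* suc s ^ (n ∸ 1))) n≡)
    equal 1 _ = trans (Tr₁-uniform H α s unif) (trans
      (reflexive (≡.cong₂ (λ n m → fromℕ (suc s ^ (n ∸ 1)) * (α * fromℕ (m ℕ.* suc (suc s)))) n≡
        m≡))
      (sym (Tr₁-uniform X α s unifX)))
    equal (suc (suc t)) (ℕ.s≤s (ℕ.s≤s ()))

    -- Both traces have the same positive factor (k - 1)^(n - 1) and the same mixed part, and α² is
    -- positive, so the sums of squared degrees decide.
    larger : Tr F 2 (Aα F α (suc s) H) < Tr F 2 (Aα F α (suc s) X)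
    larger = <-respˡ-≈ (sym (Tr₂-uniform H α s unif lin)) (<-respʳ-≈
      (trans (reflexive (≡.cong₂ (λ n m → fromℕ (suc s ^ (n ∸ 1)) *
        (α * α * fromℕ (degree² X) + cross-total α s m)) n≡ m≡))
             (sym (Tr₂-uniform X α s unifX (SunClass.Sun-linear S))))
      (*-monoʳ-< (0<fromℕ (suc s ^ (order H ∸ 1)) {{ℕ.m^n≢0 (suc s) (order H ∸ 1)}})
        (+-monoˡ-< (cross-total α s (size H))
          (*-monoʳ-< (*-pos 0<α 0<α) (fromℕ-mono-< (degree²-extremal s p inClass H≇X))))))

open OrderedField using (Carrier; _<_; 0#; 1#)

theorem5p2 : ∀ {c ℓ₁ ℓ₂ ℓ₃} (F : OrderedField c ℓ₁ ℓ₂ ℓ₃)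
    (k m : ℕ) (α : Carrier F) →
    2 ≤ k → 3 ≤ m → _<_ F (0# F) α → _<_ F α (1# F) →
    IsLast F α k (LinearUnicyclic k m) (C₃⟨ k ⟩⊙S (m ∸ 3))
theorem5p2 F (suc (suc s)) (suc (suc (suc p))) α (ℕ.s≤s (ℕ.s≤s _)) (ℕ.s≤s (ℕ.s≤s (ℕ.s≤s _))) 0<α _ =
  Comparison.extremal-class s p , λ H → Separation.separate F s p α 0<α
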